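{- Let $\mathbf{d}$ be a Dyck path on an $n\times n$ board with bounce number $|\mathbf{m}|=3$, let $P=P(\mathbf{d})$, and let $G=\mathrm{inc}(P)$. Let $c=|S_1|$, $b=|S_2|$, $a=|S_3|$. Then for every integer $l$ with $0\le l\le\min\{a,b,c\}$, the coefficient of $e_{(n-2l-1,l+1,l)}$ in the expansion of $X_G(\mathbf{x},q)$ in the elementary symmetric function basis lies in $\mathbb{N}[q]$.
   Context: A Dyck path on an $n\times n$ board is a sequence $\mathbf{d}=(d_1,\dots,d_{n-1})$ of positive integers with $d_1\le\cdots\le d_{n-1}\le n$ and $d_i\ge i$. The poset $P(\mathbf{d})$ on $[n]$ has relations $i\prec j$ iff $i<n$ and $d_i<j\le n$ (a natural unit interval order). The bounce sequence $\mathbf{m}=(m_0,\dots,m_l)$ is given by $m_0=d_1$, $m_i=d_{m_{i-1}+1}$, stopping at $m_l=n$; the bounce number is $|\mathbf{m}|=l+1$. When $|\mathbf{m}|=3$, $\mathbf{m}=(m_0,m_1,n)$ and $S_1=\{1,\dots,m_0\}$, $S_2=\{m_0+1,\dots,m_1\}$, $S_3=\{m_1+1,\dots,n\}$. The incomparability graph $\mathrm{inc}(P)$ has vertex set $[n]$ with an edge between two elements iff they are incomparable in $P$. For a graph $G$ on vertex set $[n]$, the chromatic quasisymmetric function is $X_G(\mathbf{x},q)=\sum_{\kappa}q^{\mathrm{asc}(\kappa)}\prod_{v}x_{\kappa(v)}$, summed over proper colorings $\kappa:[n]\to\{1,2,3,\dots\}$, where $\mathrm{asc}(\kappa)$ is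 the number of edges $\{i,j\}$ with $i<j$ and $\kappa(i)<\kappa(j)$; for $G=\mathrm{inc}(P(\mathbf{d}))$ it is symmetric in $\mathbf{x}$, and $e_\lambda$ denotes the elementary symmetric functions. -}

module Defs where

open import Data.Nat using (ℕ; zero; suc; _+_; _∸_; _<ᵇ_; _≤ᵇ_; _≡ᵇ_; _≤_; _<_)
open import Data.Bool using (Bool; true; false; _∧_; _∨_; not; if_then_else_)
open import Data.Fin using (Fin; toℕ)
open import Data.List using (List; []; _∷_; map; concatMap; foldr; upTo; allFin)
open import Data.Vec using (Vec; lookup) renaming ([] to []ᵥ; _∷_ to _∷ᵥ_)
open import Data.Integer using (ℤ; +_) renaming (_+_ to _+ℤ_; _*_ to _*ℤ_)
open import Data.Product using (_×_)
open import Relation.Binary.PropositionalEquality using (_≡_)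

count : {A : Set} → (A → Bool) → List A → ℕ
count p [] = 0
count p (x ∷ xs) = if p x then suc (count p xs) else count p xs

allB : {A : Set} → (A → Bool) → List A → Bool
allB p [] = true
allB p (x ∷ xs) = p x ∧ allB p xs

filterB : {A : Set} → (A → Bool) → List A → List A
filterB p [] = []
filterB p (x ∷ xs) = if p x then x ∷ filterB p xs else filterB p xs

vecs : {A : Set} → List A → (m : ℕ) → List (Vec A m)
vecs as zero = []ᵥ ∷ []
vecs as (suc m) = concatMap (λ v → map (λ a → a ∷ᵥ v) as) (vecs as m)

sumℤ : List ℤ → ℤ
sumℤ = foldr _+ℤ_ (+ 0)

-- Dyck paths, the natural unit interval order, bounce data
-- A Dyck path is d : ℕ → ℕ, of which only d 1, …, d (n-1) are relevant.

IsDyck : ℕ → (ℕ → ℕ) → Set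
IsDyck n d =
  (∀ i → 1 ≤ i → i < n → (i ≤ d i) × (d i ≤ n)) ×
  (∀ i → 1 ≤ i → suc i < n → d i ≤ d (suc i))

-- d extended by the convention d_n = n (used only for the bounce path)
dd : ℕ → (ℕ → ℕ) → ℕ → ℕ
dd n d i = if i <ᵇ n then d i else n

bm0 : ℕ → (ℕ → ℕ) → ℕ
bm0 n d = d 1

bm1 : ℕ → (ℕ → ℕ) → ℕ
bm1 n d = dd n d (suc (bm0 n d))

bm2 : ℕ → (ℕ → ℕ) → ℕ
bm2 n d = dd n d (suc (bm1 n d))

Bounce3 : ℕ → (ℕ → ℕ) → Set
Bounce3 n d = (bm0 n d < n) × (bm1 n d < n) × (bm2 n d ≡ n)

prec : ℕ → (ℕ → ℕ) → ℕ → ℕ → Bool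
prec n d i j = (i <ᵇ n) ∧ ((d i <ᵇ j) ∧ (j ≤ᵇ n))

-- vertex v : Fin n stands for the element suc (toℕ v) of [n]
lab : {n : ℕ} → Fin n → ℕ
lab v = suc (toℕ v)

edge : (n : ℕ) → (ℕ → ℕ) → Fin n → Fin n → Bool
edge n d u v =
  not (lab u ≡ᵇ lab v) ∧ (not (prec n d (lab u) (lab v)) ∧ not (prec n d (lab v) (lab u)))

-- Chromatic quasisymmetric function, restricted to n variables x₁…xₙ.
-- Colorings κ : [n] → {1,…,n}.

colorings : (n : ℕ) → List (Fin n → Fin n)
colorings n = map lookup (vecs (allFin n) n)

proper : (n : ℕ) → (ℕ → ℕ) → (Fin n → Fin n) → Bool
proper n d κ =
  allB (λ u → allB (λ v → not (edge n d u v) ∨ not (toℕ (κ u) ≡ᵇ toℕ (κ v)))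
                   (allFin n))
       (allFin n)

asc : (n : ℕ) → (ℕ → ℕ) → (Fin n → Fin n) → ℕ
asc n d κ = foldr _+_ 0 (map (λ u → count (λ v →
    (toℕ u <ᵇ toℕ v) ∧ (edge n d u v ∧ (toℕ (κ u) <ᵇ toℕ (κ v)))) (allFin n)) (allFin n))

hasContent : (n : ℕ) → (Fin n → Fin n) → (Fin n → ℕ) → Bool
hasContent n κ α =
  allB (λ j → count (λ v → toℕ (κ v) ≡ᵇ toℕ j) (allFin n) ≡ᵇ α j) (allFin n)

-- coefficient of x^α q^k in X_G(x₁,…,xₙ,q), G = inc(P(d))
Xcoef : (n : ℕ) → (ℕ → ℕ) → (Fin n → ℕ) → ℕ → ℕ
Xcoef n d α k =
  count (λ κ → proper n d κ ∧ (hasContent n κ α ∧ (asc n d κ ≡ᵇ k))) (colorings n)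

-- Elementary symmetric functions in n variables:
-- e_λ = ∏_i e_{λ_i}, e_r = Σ_{S ⊆ [n], |S| = r} x^S.

subsets : (n : ℕ) → List (Vec Bool n)
subsets n = vecs (true ∷ false ∷ []) n

size : {n : ℕ} → Vec Bool n → ℕ
size {n} S = count (lookup S) (allFin n)

tuples : (n : ℕ) → List ℕ → List (List (Vec Bool n))
tuples n [] = [] ∷ []
tuples n (r ∷ λs) =
  concatMap (λ S → map (λ ts → S ∷ ts) (tuples n λs))
            (filterB (λ S → size S ≡ᵇ r) (subsets n))

mult : {n : ℕ} → List (Vec Bool n) → Fin n → ℕ
mult ts j = count (λ S → lookup S j) ts

-- coefficient of x^α in e_λ(x₁,…,xₙ)
ecoef : (n : ℕ) → List ℕ → (Fin n → ℕ) → ℕ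
ecoef n λs α = count (λ ts → allB (λ j → mult ts j ≡ᵇ α j) (allFin n)) (tuples n λs)

-- Partitions of n, as weakly decreasing lists of positive parts

partsLE : ℕ → ℕ → ℕ → List (List ℕ)
partsLE fuel m zero = [] ∷ []
partsLE zero m (suc k) = []
partsLE (suc fuel) m (suc k) =
  concatMap (λ r → map (λ p → r ∷ p) (partsLE fuel r (suc k ∸ r)))
            (filterB (λ r → r ≤ᵇ m) (map suc (upTo (suc k))))

partitions : ℕ → List (List ℕ)
partitions n = partsLE n n n

insertDesc : ℕ → List ℕ → List ℕ
insertDesc x [] = x ∷ []
insertDesc x (y ∷ ys) = if y ≤ᵇ x then x ∷ y ∷ ys else y ∷ insertDesc x ys

sortDesc : List ℕ → List ℕ
sortDesc = foldr insertDesc []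

dropZeros : List ℕ → List ℕ
dropZeros = filterB (λ r → not (r ≡ᵇ 0))

-- the partition (n-2l-1, l+1, l), sorted, zero parts removed (e₀ = 1)
targetPart : ℕ → ℕ → List ℕ
targetPart n l = sortDesc (dropZeros ((n ∸ (l + l) ∸ 1) ∷ suc l ∷ l ∷ []))

-- q-polynomials with integer coefficients, as coefficient sequences ℕ → ℤ.
-- X_G = Σ_{λ ⊢ n} c_λ(q) e_λ, compared coefficientwise in x^α q^k.
ExpandsAs : (n : ℕ) → (ℕ → ℕ) → (List ℕ → ℕ → ℤ) → Set
ExpandsAs n d c = ∀ (α : Fin n → ℕ) (k : ℕ) →
  + Xcoef n d α k ≡ sumℤ (map (λ μ → c μ k *ℤ + ecoef n μ α) (partitions n))

{-# OPTIONS --safe #-}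
module Submission where

-- For a chain C of a natural unit interval order Q, let up(C) count the edges of inc(Q) from C up to
-- Q ∖ C.  Splitting off the smallest colour class shows that the linear functional φ_Q on symmetric
-- polynomials with φ_Q(e_{a₁}e_{a₂}⋯) = [x^a] X_Q satisfies φ_Q(e_j g) = Σ q^{up(C)} φ_{Q∖C}(g), the
-- sum being over the chains C of size j; it is well defined because X_Q is symmetric.  Bounce number 3
-- leaves no chain of size 4, so three variables suffice, and by duality the coefficient of e_μ in X_Q
-- is φ_Q(m_μ(u,v,w)).  Since m_{(a+l,b+l,c+l)} = e₃^l m_{(a,b,c)}, peeling off l chains of size 3
-- reduces the theorem to m_{(p,1)} = p_p e₁ - p_{p+1}.  Now φ_Q(p_N) for N = |Q| is [N]_q Π [b_w]_q,
-- where b_w is the number of upper neighbours of w and w runs over all vertices but the last: the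
-- alternating sum over chains telescopes when the smallest vertex is removed.  It remains to see that
-- [N-1]_q Σ_v q^{up(v)} B(Q∖v) - [N]_q B(Q) has nonnegative coefficients, where B(Q) = Π [b_w]_q; this
-- follows by induction on N, the case of a complete graph being an equality.

open import Defs
open import Level using (0ℓ)
open import Algebra.Bundles using (CommutativeRing)
open import Algebra.Solver.Ring.AlmostCommutativeRing using (fromCommutativeRing; _-Raw-AlmostCommutative⟶_)
import Algebra.Solver.Ring as RingSolver
open import Data.Bool using (Bool; true; false; _∧_; _∨_; not)
open import Data.Bool.Properties using (∧-assoc; ∧-comm; ∧-identityʳ; ∧-zeroʳ; T-≡)
open import Data.Empty using (⊥; ⊥-elim)
open import Data.Fin as Fin using (Fin; toℕ)
open import Data.Integer as ℤ using (ℤ) renaming (_≤_ to _≤ℤ_)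
import Data.Integer.Properties as ℤₚ
open import Data.List using (List; []; _∷_; _++_; length; map; foldr; concatMap; replicate; tabulate; allFin; upTo)
open import Data.List.Properties using (≡-dec; map-cong; map-tabulate; length-tabulate)
open import Data.List.Membership.Propositional using (_∈_; lose)
open import Data.List.Membership.Propositional.Properties using (∈-map⁺; ∈-concatMap⁺; ∈-upTo⁺; ∈-allFin)
open import Data.List.Relation.Binary.Permutation.Propositional as Perm using (_↭_)
open import Data.List.Relation.Binary.Permutation.Propositional.Properties using (shift; ++⁺ˡ)
open import Data.List.Relation.Ternary.Interleaving using ([])
open import Data.List.Relation.Ternary.Interleaving.Propositional using (Interleaving; consˡ; consʳ)
open import Data.List.Relation.Unary.All as All using (All; []; _∷_)
import Data.List.Relation.Unary.All.Properties as Allₚ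
open import Data.List.Relation.Unary.AllPairs as AllPairs using (AllPairs; []; _∷_)
import Data.List.Relation.Unary.AllPairs.Properties as AllPairsₚ
open import Data.List.Relation.Unary.Any as Any using (Any; here; there; any?)
open import Data.Maybe using (Maybe; just; nothing)
open import Data.Nat as ℕ using (ℕ; zero; suc; _≤_; z≤n; s≤s; _∸_; _≡ᵇ_; _<ᵇ_; _≤ᵇ_)
open import Data.Nat.Properties as ℕₚ
  using (suc-injective; n≤1+n; ≤-refl; ≤-trans; m≤m+n; m≤n+m; +-suc; 1+n≰n; m+n∸m≡n; <⇒≢)
open import Data.Nat.ListAction using (sum)
open import Data.Nat.ListAction.Properties using (sum-↭)
open import Data.Nat.Solver using () renaming (module +-*-Solver to ℕ-Solver)
open import Data.Product using (Σ; _×_; _,_; proj₁; proj₂; ∃; Σ-syntax)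
open import Data.Sum using (_⊎_; inj₁; inj₂)
open import Data.Unit using (⊤; tt)
open import Data.Vec using (Vec; lookup) renaming ([] to []ᵥ; _∷_ to _∷ᵥ_; tail to tailᵥ)
open import Relation.Binary.Definitions using (tri<; tri≈; tri>)
open import Relation.Binary.PropositionalEquality as ≡ using (_≡_; _≢_; _≗_; cong; cong₂)
open import Relation.Nullary using (yes; no; ¬_)
open import Function using (_∘_; id; flip; Equivalence)
open import Algebra.Properties.CommutativeSemigroup ℕₚ.+-commutativeSemigroup using (interchange; x∙yz≈y∙xz; xy∙z≈xz∙y)

-- The duality is transposition of 0-1 matrices: the number with row sums (i, j, k) and column sums
-- a is the coefficient of x^a in e_(i,j,k) and also that of u^i v^j w^k in e_{a₁}e_{a₂}⋯. Once X_Q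
-- is expanded in the e_μ, pairing with m_τ(u,v,w) therefore isolates a single coefficient. In the
-- final induction let W be the sum over v and delete the smallest vertex w, with b = b_w. Then W(Q)
-- is [b] W(Q - w) plus q^(b-1) times an excess: q B(Q - w) minus the part of W(Q - w) that comes
-- from neighbours of w. The excess is positive unless w is adjacent to all other vertices, and then
-- the graph is complete. Because [N-1] = 1 + q [N-2], the induction must also carry the cruder
-- bound W ≥ B. A disconnected graph has B = 0, so only connected ones need this argument, and
-- connectivity survives deletion of the smallest vertex. Positivity is an abstract cone `Pos`
-- closed under sums and products, so each inequality exhibits its positive remainder.

record Weights : Set₁ where
  field
    commRing : CommutativeRing 0ℓ 0ℓ
  open CommutativeRing commRing public
  field
    q        : Carrier
    fromℤ    : CommutativeRing.rawRing ℤₚ.+-*-commutativeRing -Raw-AlmostCommutative⟶ fromCommutativeRing commRing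
    Pos      : Carrier → Set
    Pos-resp : ∀ {x y} → x ≈ y → Pos x → Pos y
    Pos-0    : Pos 0#
    Pos-1    : Pos 1#
    Pos-q    : Pos q
    Pos-+    : ∀ {x y} → Pos x → Pos y → Pos (x + y)
    Pos-*    : ∀ {x y} → Pos x → Pos y → Pos (x * y)

-- q-integers and indicators over an abstract coefficient ring

module Polynomials (𝒲 : Weights) where
  open Weights 𝒲 public
  open import Relation.Binary.Reasoning.Setoid setoid public

  private
    ℤ-rawRing = CommutativeRing.rawRing ℤₚ.+-*-commutativeRing
    module F = _-Raw-AlmostCommutative⟶_ fromℤ

    -- Agrees with fromℤ, but sends the literals 0 and 1 to 0# and 1# on the nose, as `con` needs.
    ⟦_⟧ : ℤ → Carrier
    ⟦ ℤ.+ 0 ⟧ = 0#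
    ⟦ ℤ.+ 1 ⟧ = 1#
    ⟦ z ⟧     = F.⟦ z ⟧

    ⟦⟧-fromℤ : ∀ z → ⟦ z ⟧ ≈ F.⟦ z ⟧
    ⟦⟧-fromℤ (ℤ.+ 0)           = sym F.0-homo
    ⟦⟧-fromℤ (ℤ.+ 1)           = sym F.1-homo
    ⟦⟧-fromℤ (ℤ.+ suc (suc n)) = refl
    ⟦⟧-fromℤ (ℤ.-[1+ n ])      = refl

    coefficients : ℤ-rawRing -Raw-AlmostCommutative⟶ fromCommutativeRing commRing
    coefficients = record
      { ⟦_⟧    = ⟦_⟧
      ; +-homo = λ x y → trans (⟦⟧-fromℤ _) (trans (F.+-homo x y) (sym (+-cong (⟦⟧-fromℤ x) (⟦⟧-fromℤ y))))
      ; *-homo = λ x y → trans (⟦⟧-fromℤ _) (trans (F.*-homo x y) (sym (*-cong (⟦⟧-fromℤ x) (⟦⟧-fromℤ y))))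
      ; -‿homo = λ x → trans (⟦⟧-fromℤ _) (trans (F.-‿homo x) (sym (-‿cong (⟦⟧-fromℤ x))))
      ; 0-homo = refl
      ; 1-homo = refl
      }

    coeff≟ : (a b : ℤ) → Maybe (⟦ a ⟧ ≈ ⟦ b ⟧)
    coeff≟ a b with a ℤ.≟ b
    ... | yes e = just (reflexive (≡.cong ⟦_⟧ e))
    ... | no _  = nothing

  open RingSolver ℤ-rawRing (fromCommutativeRing commRing) coefficients coeff≟ public
    using (solve; Polynomial; _:=_; _:+_; _:*_; _:-_; :-_; con)

  :0 :1 : ∀ {n} → Polynomial n
  :0 = con (ℤ.+ 0)
  :1 = con (ℤ.+ 1)

  infixr 8 q^_
  q^_ : ℕ → Carrier
  q^ zero  = 1#
  q^ suc n = q * q^ n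

  [_] : ℕ → Carrier
  [ zero ]  = 0#
  [ suc n ] = 1# + q * [ n ]

  ι : ℕ → Carrier
  ι zero    = 0#
  ι (suc n) = 1# + ι n

  ind : Bool → Carrier
  ind true  = 1#
  ind false = 0#

  -- Applied to edge counts, it is the indicator that no edge is present; by `isZero-+` the
  -- indicators of disjoint sets of edges multiply.
  isZero : ℕ → Carrier
  isZero zero    = 1#
  isZero (suc _) = 0#

  δ : ℕ → ℕ → Carrier
  δ zero    zero    = 1#
  δ zero    (suc _) = 0#
  δ (suc _) zero    = 0#
  δ (suc m) (suc n) = δ m n

  δ-refl : ∀ n → δ n n ≈ 1#
  δ-refl zero    = refl
  δ-refl (suc n) = δ-refl n

  δ-≢ : ∀ m n → n ≢ m → δ m n ≈ 0#
  δ-≢ zero    zero    n≢m = ⊥-elim (n≢m ≡.refl)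
  δ-≢ zero    (suc n) n≢m = refl
  δ-≢ (suc m) zero    n≢m = refl
  δ-≢ (suc m) (suc n) n≢m = δ-≢ m n (n≢m ∘ ≡.cong suc)

  ≡⇒≈ : ∀ {x y} → x ≡ y → x ≈ y
  ≡⇒≈ = reflexive

  q^-+ : ∀ m n → q^ (m ℕ.+ n) ≈ q^ m * q^ n
  q^-+ zero    n = sym (*-identityˡ _)
  q^-+ (suc m) n = trans (*-congˡ (q^-+ m n)) (sym (*-assoc _ _ _))

  [suc] : ∀ n → [ suc n ] ≈ [ n ] + q^ n
  [suc] zero    = solve 1 (λ x → :1 :+ x :* :0 := :0 :+ :1) refl q
  [suc] (suc n) = begin
    1# + q * [ suc n ]            ≈⟨ +-congˡ (*-congˡ ([suc] n)) ⟩
    1# + q * ([ n ] + q^ n)       ≈⟨ solve 4 (λ o a b c → o :+ a :* (b :+ c) := (o :+ a :* b) :+ a :* c) refl 1# q [ n ] (q^ n) ⟩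
    (1# + q * [ n ]) + q * q^ n   ∎

  isZero-+ : ∀ m n → isZero (m ℕ.+ n) ≈ isZero m * isZero n
  isZero-+ zero    n = sym (*-identityˡ _)
  isZero-+ (suc m) n = sym (zeroˡ _)

  Pos-q^ : ∀ n → Pos (q^ n)
  Pos-q^ zero    = Pos-1
  Pos-q^ (suc n) = Pos-* Pos-q (Pos-q^ n)

  Pos-[] : ∀ n → Pos [ n ]
  Pos-[] zero    = Pos-0
  Pos-[] (suc n) = Pos-+ Pos-1 (Pos-* Pos-q (Pos-[] n))

  Pos-isZero : ∀ n → Pos (isZero n)
  Pos-isZero zero    = Pos-1
  Pos-isZero (suc n) = Pos-0

  Pos-δ : ∀ m n → Pos (δ m n)
  Pos-δ zero    zero    = Pos-1
  Pos-δ zero    (suc _) = Pos-0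
  Pos-δ (suc _) zero    = Pos-0
  Pos-δ (suc m) (suc n) = Pos-δ m n

-- Chromatic functions of interval orders

-- `A x y` encodes: x < y, and x and y are incomparable in the interval order.
record IntervalOrder : Set₁ where
  field
    V        : Set
    _<_      : V → V → Set
    A        : V → V → Bool
    A-irrefl : ∀ x → A x x ≡ false
    A-asym   : ∀ {x y} → x < y → A y x ≡ false
    A-closeˡ : ∀ {x y z} → x < y → y < z → A x z ≡ true → A x y ≡ true
    A-closeʳ : ∀ {x y z} → x < y → y < z → A x z ≡ true → A y z ≡ true
    A-height : ∀ {w x y z} → w < x → x < y → y < z →
               A w x ≡ false → A x y ≡ false → A y z ≡ false → ⊥

bit : Bool → ℕ
bit true  = 1
bit false = 0

All-split : ∀ {X : Set} {P : X → Set} {C R Q : List X} → Interleaving C R Q → All P Q → All P C × All P R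
All-split []        []       = [] , []
All-split (consˡ i) (p ∷ ps) = let c , r = All-split i ps in p ∷ c , r
All-split (consʳ i) (p ∷ ps) = let c , r = All-split i ps in c , p ∷ r

AllPairs-split : ∀ {X : Set} {S : X → X → Set} {C R Q : List X} →
                 Interleaving C R Q → AllPairs S Q → AllPairs S C × AllPairs S R
AllPairs-split []        []       = [] , []
AllPairs-split (consˡ i) (p ∷ ps) = let c , r = AllPairs-split i ps in proj₁ (All-split i p) ∷ c , r
AllPairs-split (consʳ i) (p ∷ ps) = let c , r = AllPairs-split i ps in c , proj₂ (All-split i p) ∷ r

length-split : ∀ {X : Set} {C R Q : List X} → Interleaving C R Q → length C ℕ.+ length R ≡ length Q
length-split []                    = ≡.refl
length-split (consˡ i)             = cong suc (length-split i)
length-split {C = C} (consʳ i) = ≡.trans (+-suc (length C) _) (cong suc (length-split i))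

-- Sums over subsets and their complements

module Splittings (𝒲 : Weights) where
  open Polynomials 𝒲

  -- One summand for each of the 2^|Q| sublists `C` with complement `R`. Both inherit the order of
  -- `Q`, so an `Interleaving` proof passes sortedness and lengths on to them.
  Σs : {X : Set} → List X → (List X → List X → Carrier) → Carrier
  Σs []      f = f [] []
  Σs (w ∷ Q) f = Σs Q (λ C R → f (w ∷ C) R) + Σs Q (λ C R → f C (w ∷ R))

  module _ {X : Set} where

    Σs-cong : ∀ (Q : List X) {f g} → (∀ {C R} → Interleaving C R Q → f C R ≈ g C R) → Σs Q f ≈ Σs Q g
    Σs-cong []      h = h []
    Σs-cong (w ∷ Q) h = +-cong (Σs-cong Q (λ i → h (consˡ i))) (Σs-cong Q (λ i → h (consʳ i)))

    Σs-0 : ∀ (Q : List X) {f} → (∀ {C R} → Interleaving C R Q → f C R ≈ 0#) → Σs Q f ≈ 0#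
    Σs-0 []      h = h []
    Σs-0 (w ∷ Q) h = trans (+-cong (Σs-0 Q (λ i → h (consˡ i))) (Σs-0 Q (λ i → h (consʳ i)))) (+-identityˡ 0#)

    Σs-+ : ∀ (Q : List X) (f g : List X → List X → Carrier) → Σs Q (λ C R → f C R + g C R) ≈ Σs Q f + Σs Q g
    Σs-+ []      f g = refl
    Σs-+ (w ∷ Q) f g = trans (+-cong (Σs-+ Q _ _) (Σs-+ Q _ _))
      (solve 4 (λ a b c d → (a :+ b) :+ (c :+ d) := (a :+ c) :+ (b :+ d)) refl _ _ _ _)

    Σs-* : ∀ (Q : List X) x (f : List X → List X → Carrier) → Σs Q (λ C R → x * f C R) ≈ x * Σs Q f
    Σs-* []      x f = refl
    Σs-* (w ∷ Q) x f = trans (+-cong (Σs-* Q x _) (Σs-* Q x _)) (sym (distribˡ _ _ _))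

    Σs-neg : ∀ (Q : List X) (f : List X → List X → Carrier) → Σs Q (λ C R → - f C R) ≈ - Σs Q f
    Σs-neg []      f = refl
    Σs-neg (w ∷ Q) f = trans (+-cong (Σs-neg Q _) (Σs-neg Q _))
      (solve 2 (λ a b → :- a :+ :- b := :- (a :+ b)) refl _ _)

    Σs-Pos : ∀ (Q : List X) {f} → (∀ {C R} → Interleaving C R Q → Pos (f C R)) → Pos (Σs Q f)
    Σs-Pos []      h = h []
    Σs-Pos (w ∷ Q) h = Pos-+ (Σs-Pos Q (λ i → h (consˡ i))) (Σs-Pos Q (λ i → h (consʳ i)))

    Σs-∅ : ∀ (Q : List X) (f : List X → List X → Carrier) → Σs Q (λ C R → isZero (length C) * f C R) ≈ f [] Q
    Σs-∅ []      f = *-identityˡ _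
    Σs-∅ (w ∷ Q) f = trans (+-cong (Σs-0 Q (λ _ → zeroˡ _)) (Σs-∅ Q (λ C R → f C (w ∷ R)))) (+-identityˡ _)

    -- Both sides run over the ordered decompositions of `Q` into blocks `C`, `D`, `S`; the left
    -- side splits off `C` first, the right side `S`. This merges two successive colour classes into
    -- one set `U`.
    Σs-assoc : ∀ (Q : List X) (f : List X → List X → List X → Carrier) →
               Σs Q (λ C R → Σs R (λ D S → f C D S)) ≈ Σs Q (λ U S → Σs U (λ C D → f C D S))
    Σs-assoc []      f = refl
    Σs-assoc (w ∷ Q) f = begin
      a + Σs Q (λ C R → Σs R (λ D S → f C (w ∷ D) S) + Σs R (λ D S → f C D (w ∷ S)))
        ≈⟨ +-congˡ (Σs-+ Q _ _) ⟩
      a + (b + c)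
        ≈⟨ +-cong (Σs-assoc Q _) (+-cong (Σs-assoc Q _) (Σs-assoc Q _)) ⟩
      a′ + (b′ + c′)
        ≈⟨ sym (+-assoc _ _ _) ⟩
      (a′ + b′) + c′
        ≈⟨ +-congʳ (sym (Σs-+ Q _ _)) ⟩
      Σs Q (λ U S → Σs U (λ C D → f (w ∷ C) D S) + Σs U (λ C D → f C (w ∷ D) S)) + c′ ∎
      where
      a = Σs Q (λ C R → Σs R (λ D S → f (w ∷ C) D S))
      b = Σs Q (λ C R → Σs R (λ D S → f C (w ∷ D) S))
      c = Σs Q (λ C R → Σs R (λ D S → f C D (w ∷ S)))
      a′ = Σs Q (λ U S → Σs U (λ C D → f (w ∷ C) D S))
      b′ = Σs Q (λ U S → Σs U (λ C D → f C (w ∷ D) S))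
      c′ = Σs Q (λ U S → Σs U (λ C D → f C D (w ∷ S)))

  ΣL : {Y : Set} → List Y → (Y → Carrier) → Carrier
  ΣL []       f = 0#
  ΣL (x ∷ xs) f = f x + ΣL xs f

  module _ {Y : Set} where
    ΣL-cong : ∀ (xs : List Y) {f g} → All (λ x → f x ≈ g x) xs → ΣL xs f ≈ ΣL xs g
    ΣL-cong []       []       = refl
    ΣL-cong (x ∷ xs) (e ∷ es) = +-cong e (ΣL-cong xs es)

    ΣL-0 : ∀ (xs : List Y) {f} → All (λ x → f x ≈ 0#) xs → ΣL xs f ≈ 0#
    ΣL-0 []       []       = refl
    ΣL-0 (x ∷ xs) (e ∷ es) = trans (+-cong e (ΣL-0 xs es)) (+-identityˡ 0#)

    ΣL-+ : ∀ (xs : List Y) (f g : Y → Carrier) → ΣL xs (λ x → f x + g x) ≈ ΣL xs f + ΣL xs g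
    ΣL-+ []       f g = sym (+-identityˡ 0#)
    ΣL-+ (x ∷ xs) f g = trans (+-congˡ (ΣL-+ xs f g))
      (solve 4 (λ a b c d → (a :+ b) :+ (c :+ d) := (a :+ c) :+ (b :+ d)) refl (f x) (g x) (ΣL xs f) (ΣL xs g))

    ΣL-* : ∀ (xs : List Y) y (f : Y → Carrier) → ΣL xs (λ x → y * f x) ≈ y * ΣL xs f
    ΣL-* []       y f = sym (zeroʳ y)
    ΣL-* (x ∷ xs) y f = trans (+-congˡ (ΣL-* xs y f)) (sym (distribˡ _ _ _))

    ΣL-++ : ∀ (xs ys : List Y) f → ΣL (xs ++ ys) f ≈ ΣL xs f + ΣL ys f
    ΣL-++ []       ys f = sym (+-identityˡ _)
    ΣL-++ (x ∷ xs) ys f = trans (+-congˡ (ΣL-++ xs ys f)) (sym (+-assoc _ _ _))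

    ΣL-map : ∀ {X : Set} (h : X → Y) xs (f : Y → Carrier) → ΣL (map h xs) f ≈ ΣL xs (f ∘ h)
    ΣL-map h []       f = refl
    ΣL-map h (x ∷ xs) f = +-congˡ (ΣL-map h xs f)

    ΣL-concatMap : ∀ {X : Set} (h : X → List Y) xs (f : Y → Carrier) → ΣL (concatMap h xs) f ≈ ΣL xs (λ x → ΣL (h x) f)
    ΣL-concatMap h []       f = refl
    ΣL-concatMap h (x ∷ xs) f = trans (ΣL-++ (h x) _ f) (+-congˡ (ΣL-concatMap h xs f))

-- The chromatic function as an iterated sum over chains

module Chromatic (𝒲 : Weights) (𝒪 : IntervalOrder) where
  open Polynomials 𝒲
  open Splittings 𝒲
  open IntervalOrder 𝒪 using (V; A)
  open IntervalOrder 𝒪 hiding (V; A)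

  Sorted : List V → Set
  Sorted = AllPairs _<_

  hit : V → List V → ℕ
  hit w []      = 0
  hit w (x ∷ C) = bit (A w x) ℕ.+ hit w C

  -- When `C` is the class of the smallest colour, an edge between `C` and the rest is an ascent
  -- exactly if its lower end lies in `C`.
  up : List V → List V → ℕ
  up []      R = 0
  up (u ∷ C) R = hit u R ℕ.+ up C R

  inner : List V → ℕ
  inner []      = 0
  inner (w ∷ C) = hit w C ℕ.+ inner C

  -- `isZero (inner C)` restricts to stable sets of the incomparability graph, that is, to chains of
  -- the order.
  wt : ℕ → List V → List V → Carrier
  wt a C R = δ a (length C) * (isZero (inner C) * q^ up C R)

  -- Coefficient of x^a in X_{inc(Q)}, peeling off the class of the smallest colour first.
  X : List V → List ℕ → Carrier
  X Q []       = isZero (length Q)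
  X Q (a ∷ as) = Σs Q (λ C R → wt a C R * X R as)

  hit-split : ∀ w {C R Q} → Interleaving C R Q → hit w C ℕ.+ hit w R ≡ hit w Q
  hit-split w []                          = ≡.refl
  hit-split w {x ∷ C} (consˡ i)           = ≡.trans (ℕₚ.+-assoc (bit (A w x)) _ _) (cong (bit (A w x) ℕ.+_) (hit-split w i))
  hit-split w {C} {x ∷ R} (consʳ i)       = ≡.trans (x∙yz≈y∙xz (hit w C) (bit (A w x)) _) (cong (bit (A w x) ℕ.+_) (hit-split w i))

  up-splitʳ : ∀ C {D S R} → Interleaving D S R → up C R ≡ up C D ℕ.+ up C S
  up-splitʳ []      i = ≡.refl
  up-splitʳ (u ∷ C) {D} {S} i = ≡.trans (cong₂ ℕ._+_ (≡.sym (hit-split u i)) (up-splitʳ C i)) (interchange (hit u D) (hit u S) (up C D) (up C S))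

  up-splitˡ : ∀ {C D U} S → Interleaving C D U → up U S ≡ up C S ℕ.+ up D S
  up-splitˡ S []                    = ≡.refl
  up-splitˡ {u ∷ _} S (consˡ i) = ≡.trans (cong (hit u S ℕ.+_) (up-splitˡ S i)) (≡.sym (ℕₚ.+-assoc (hit u S) _ _))
  up-splitˡ {C} {u ∷ _} S (consʳ i) = ≡.trans (cong (hit u S ℕ.+_) (up-splitˡ S i)) (x∙yz≈y∙xz (hit u S) (up C S) _)

  -- `A` points from the lower to the upper end of an edge, so no vertex of `C` has an edge up to
  -- `w`.
  up-below : ∀ {w C} R → All (w <_) C → up C (w ∷ R) ≡ up C R
  up-below R []                    = ≡.refl
  up-below R (w<u ∷ ps) rewrite A-asym w<u = cong (hit _ R ℕ.+_) (up-below R ps)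

  X-0 : ∀ Q as → X Q (0 ∷ as) ≈ X Q as
  X-0 Q as = begin
    Σs Q (λ C R → wt 0 C R * X R as)              ≈⟨ Σs-cong Q (λ {C} {R} _ → lemma C R) ⟩
    Σs Q (λ C R → isZero (length C) * rest C R)   ≈⟨ Σs-∅ Q rest ⟩
    (1# * 1#) * X Q as                            ≈⟨ solve 1 (λ x → (:1 :* :1) :* x := x) refl (X Q as) ⟩
    X Q as                                        ∎
    where
    rest : List V → List V → Carrier
    rest C R = (isZero (inner C) * q^ up C R) * X R as
    lemma : ∀ C R → wt 0 C R * X R as ≈ isZero (length C) * rest C R
    lemma []      R = *-assoc _ _ _
    lemma (_ ∷ _) R = *-assoc _ _ _

  wt-Pos : ∀ a C R → Pos (wt a C R)
  wt-Pos a C R = Pos-* (Pos-δ a (length C)) (Pos-* (Pos-isZero (inner C)) (Pos-q^ (up C R)))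

  X-Pos : ∀ Q as → Pos (X Q as)
  X-Pos Q []       = Pos-isZero (length Q)
  X-Pos Q (a ∷ as) = Σs-Pos Q (λ {C} {R} _ → Pos-* (wt-Pos a C R) (X-Pos R as))

-- Symmetry in the colours

module Symmetry (𝒲 : Weights) (𝒪 : IntervalOrder) where
  open Polynomials 𝒲
  open Splittings 𝒲
  open IntervalOrder 𝒪
  open Chromatic 𝒲 𝒪

  -- By `A-closeˡ` an edge from `w` to a later vertex would force the edge to `x`.
  hit-none : ∀ {w x U} → Sorted (w ∷ x ∷ U) → A w x ≡ false → hit w U ≡ 0
  hit-none {w} {x} ((w<x ∷ _) ∷ (x<U ∷ _)) ¬wx = go x<U
    where
    go : ∀ {U} → All (x <_) U → hit w U ≡ 0
    go [] = ≡.refl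
    go {y ∷ U} (x<y ∷ ps) with A w y in wy
    ... | false = go ps
    ... | true with ≡.trans (≡.sym ¬wx) (A-closeˡ w<x x<y wy)
    ...   | ()

  hit-0ˡ : ∀ {w C D U} → hit w U ≡ 0 → Interleaving C D U → hit w C ≡ 0
  hit-0ˡ {w} {C} h i = ℕₚ.m+n≡0⇒m≡0 (hit w C) (≡.trans (hit-split w i) h)

  hit-0ʳ : ∀ {w C D U} → hit w U ≡ 0 → Interleaving C D U → hit w D ≡ 0
  hit-0ʳ {w} {C} h i = ℕₚ.m+n≡0⇒n≡0 (hit w C) (≡.trans (hit-split w i) h)

  private
    Fun : Set
    Fun = (ℕ → ℕ → Carrier) → Carrier

    s₁ s₂ : (ℕ → ℕ → Carrier) → ℕ → ℕ → Carrier
    s₁ φ i j = φ (suc i) j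
    s₂ φ i j = φ i (suc j)

    kernel : List V → List V → ℕ → ℕ → ℕ → (ℕ → ℕ → Carrier) → Carrier
    kernel C D a b u φ = (isZero a * isZero b) * (q^ u * φ (length C) (length D))

    term : (ℕ → ℕ → Carrier) → List V → List V → Carrier
    term φ C D = kernel C D (inner C) (inner D) (up C D) φ

    -- The sum over proper 2-colourings of the graph on `U`, with `φ` recording the two class sizes.
    -- Symmetry in two adjacent colours becomes invariance under `flip`.
    Φ : List V → Fun
    Φ U φ = Σs U (term φ)

    Φ₁ Φ₂ : V → List V → Fun
    Φ₁ w U φ = Σs U (λ C D → term φ (w ∷ C) D)
    Φ₂ w U φ = Σs U (λ C D → term φ C (w ∷ D))

    -- The two-coloured graph is a union of paths.  F₁ and F₂ are its generating functions with the
    -- smallest vertex in the first, respectively second, class; the shape records the parity of the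
    -- path through that vertex.
    data Shape (F₁ F₂ : Fun) : Set where
      odd  : (g : Fun) → (∀ φ → g φ ≈ g (flip φ)) →
             (∀ φ → F₁ φ ≈ g (s₁ φ)) → (∀ φ → F₂ φ ≈ g (s₂ φ)) → Shape F₁ F₂
      even : (g : Fun) → (∀ φ → g φ ≈ g (flip φ)) →
             (∀ φ → F₁ φ ≈ q * g (s₁ (s₂ φ))) → (∀ φ → F₂ φ ≈ g (s₁ (s₂ φ))) → Shape F₁ F₂

    -- Exchanging the colours interchanges the two families of an odd path, while an even path adds
    -- equally to both classes and each family is symmetric by itself.
    shape-sym : ∀ {F₁ F₂} → Shape F₁ F₂ → ∀ φ → F₁ φ + F₂ φ ≈ F₁ (flip φ) + F₂ (flip φ)
    shape-sym {F₁} {F₂} (odd g g-sym p₁ p₂) φ = begin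
      F₁ φ + F₂ φ                               ≈⟨ +-cong (p₁ φ) (p₂ φ) ⟩
      g (s₁ φ) + g (s₂ φ)                       ≈⟨ +-cong (g-sym _) (g-sym _) ⟩
      g (s₂ (flip φ)) + g (s₁ (flip φ))         ≈⟨ +-comm _ _ ⟩
      g (s₁ (flip φ)) + g (s₂ (flip φ))         ≈⟨ sym (+-cong (p₁ _) (p₂ _)) ⟩
      F₁ (flip φ) + F₂ (flip φ)                 ∎
    shape-sym (even g g-sym p₁ p₂) φ =
      trans (+-cong (p₁ φ) (p₂ φ)) (trans (+-cong (*-congˡ (g-sym _)) (g-sym _)) (sym (+-cong (p₁ _) (p₂ _))))

    term-value : ∀ φ C D a b u → inner C ≡ a → inner D ≡ b → up C D ≡ u → term φ C D ≈ kernel C D a b u φ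
    term-value φ C D _ _ _ ≡.refl ≡.refl ≡.refl = refl

    kernel-q : ∀ C D a b u φ → kernel C D a b (suc u) φ ≈ q * kernel C D a b u φ
    kernel-q C D a b u φ = solve 4 (λ x y z t → x :* ((y :* z) :* t) := y :* (x :* (z :* t))) refl
      (isZero a * isZero b) q (q^ u) (φ (length C) (length D))

    improperˡ : ∀ φ C D {n} → inner C ≡ suc n → term φ C D ≈ 0#
    improperˡ φ C D e = trans (*-congʳ (trans (*-congʳ (≡⇒≈ (cong isZero e))) (zeroˡ _))) (zeroˡ _)

    improperʳ : ∀ φ C D {n} → inner D ≡ suc n → term φ C D ≈ 0#
    improperʳ φ C D e = trans (*-congʳ (trans (*-congˡ (≡⇒≈ (cong isZero e))) (zeroʳ _))) (zeroˡ _)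

    inner-edge : ∀ w x C → A w x ≡ true → inner (w ∷ x ∷ C) ≡ suc (hit w C ℕ.+ inner (x ∷ C))
    inner-edge w x C wx rewrite wx = ≡.refl

    -- The later neighbours of `w` are mutually adjacent and form an initial segment of `U`. With
    -- none, `w` is isolated; with one, it extends the path of its successor; with more, there is a
    -- triangle and no proper 2-colouring.
    path : ∀ w U → Sorted (w ∷ U) → Shape (Φ₁ w U) (Φ₂ w U)
    Φ-sym : ∀ U → Sorted U → ∀ φ → Φ U φ ≈ Φ U (flip φ)

    isolated : ∀ w U → Sorted (w ∷ U) → hit w U ≡ 0 → Shape (Φ₁ w U) (Φ₂ w U)
    isolated w U (w<U ∷ U↑) h = odd (Φ U) (Φ-sym U U↑)
      (λ φ → Σs-cong U λ {C} {D} i → term-value φ (w ∷ C) D (inner C) (inner D) (up C D)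
         (cong (ℕ._+ inner C) (hit-0ˡ h i)) ≡.refl (cong (ℕ._+ up C D) (hit-0ʳ h i)))
      (λ φ → Σs-cong U λ {C} {D} i → term-value φ C (w ∷ D) (inner C) (inner D) (up C D)
         ≡.refl (cong (ℕ._+ inner D) (hit-0ʳ h i)) (up-below D (proj₁ (All-split i w<U))))

    -- `v` must take the other class, so `w` prolongs the path through `v` and flips its parity. The
    -- new edge is an ascent, worth a factor `q`, exactly when `w` is in the first class.
    linked : ∀ w v U → Sorted (w ∷ v ∷ U) → A w v ≡ true → hit w U ≡ 0 → Shape (Φ₁ w (v ∷ U)) (Φ₂ w (v ∷ U))
    linked w v U ((w<v ∷ w<U) ∷ s@(v<U ∷ _)) wv h with path v U s
    ... | shape = extend shape
      where
      step₁ : ∀ φ → Φ₁ w (v ∷ U) φ ≈ q * Φ₂ v U (s₁ φ)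
      step₁ φ = begin
        Σs U (λ C D → term φ (w ∷ v ∷ C) D) + Σs U (λ C D → term φ (w ∷ C) (v ∷ D))
          ≈⟨ +-cong (Σs-0 U λ {C} {D} _ → improperˡ φ (w ∷ v ∷ C) D (inner-edge w v C wv))
                    (Σs-cong U λ {C} {D} i → trans (term-value φ (w ∷ C) (v ∷ D) (inner C) (inner (v ∷ D)) (suc (up C (v ∷ D)))
                        (cong (ℕ._+ inner C) (hit-0ˡ h i)) ≡.refl
                        (cong (ℕ._+ up C (v ∷ D)) (cong₂ (λ b n → bit b ℕ.+ n) wv (hit-0ʳ h i))))
                      (kernel-q (w ∷ C) (v ∷ D) (inner C) (inner (v ∷ D)) (up C (v ∷ D)) φ)) ⟩
        0# + Σs U (λ C D → q * term (s₁ φ) C (v ∷ D))   ≈⟨ +-identityˡ _ ⟩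
        Σs U (λ C D → q * term (s₁ φ) C (v ∷ D))        ≈⟨ Σs-* U q _ ⟩
        q * Φ₂ v U (s₁ φ) ∎

      step₂ : ∀ φ → Φ₂ w (v ∷ U) φ ≈ Φ₁ v U (s₂ φ)
      step₂ φ = begin
        Σs U (λ C D → term φ (v ∷ C) (w ∷ D)) + Σs U (λ C D → term φ C (w ∷ v ∷ D))
          ≈⟨ +-cong (Σs-cong U λ {C} {D} i → term-value φ (v ∷ C) (w ∷ D) (inner (v ∷ C)) (inner D) (up (v ∷ C) D)
                        ≡.refl (cong (ℕ._+ inner D) (hit-0ʳ h i)) (up-below D (w<v ∷ proj₁ (All-split i w<U))))
                    (Σs-0 U λ {C} {D} _ → improperʳ φ C (w ∷ v ∷ D) (inner-edge w v D wv)) ⟩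
        Φ₁ v U (s₂ φ) + 0#   ≈⟨ +-identityʳ _ ⟩
        Φ₁ v U (s₂ φ) ∎

      extend : Shape (Φ₁ v U) (Φ₂ v U) → Shape (Φ₁ w (v ∷ U)) (Φ₂ w (v ∷ U))
      extend (odd g g-sym p₁ p₂)  = even g g-sym
        (λ φ → trans (step₁ φ) (*-congˡ (p₂ (s₁ φ)))) (λ φ → trans (step₂ φ) (p₁ (s₂ φ)))
      extend (even g g-sym p₁ p₂) = odd (λ ψ → q * g (s₁ (s₂ ψ))) (λ ψ → *-congˡ (g-sym _))
        (λ φ → trans (step₁ φ) (*-congˡ (p₂ (s₁ φ)))) (λ φ → trans (step₂ φ) (p₁ (s₂ φ)))

    -- Two of three mutually adjacent vertices share a class, so every term vanishes and `even`
    -- holds with `g` zero.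
    triangle : ∀ w v x U → A w v ≡ true → A w x ≡ true → A v x ≡ true → Shape (Φ₁ w (v ∷ x ∷ U)) (Φ₂ w (v ∷ x ∷ U))
    triangle w v x U wv wx vx = even (λ _ → 0#) (λ _ → refl)
      (λ φ → trans (+-cong
          (+-cong (Σs-0 U λ {C} {D} _ → improperˡ φ (w ∷ v ∷ x ∷ C) D (inner-edge w v (x ∷ C) wv))
                  (Σs-0 U λ {C} {D} _ → improperˡ φ (w ∷ v ∷ C) (x ∷ D) (inner-edge w v C wv)))
          (+-cong (Σs-0 U λ {C} {D} _ → improperˡ φ (w ∷ x ∷ C) (v ∷ D) (inner-edge w x C wx))
                  (Σs-0 U λ {C} {D} _ → improperʳ φ (w ∷ C) (v ∷ x ∷ D) (inner-edge v x D vx))))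
          (solve 1 (λ y → (:0 :+ :0) :+ (:0 :+ :0) := y :* :0) refl q))
      (λ φ → trans (+-cong
          (+-cong (Σs-0 U λ {C} {D} _ → improperˡ φ (v ∷ x ∷ C) (w ∷ D) (inner-edge v x C vx))
                  (Σs-0 U λ {C} {D} _ → improperʳ φ (v ∷ C) (w ∷ x ∷ D) (inner-edge w x D wx)))
          (+-cong (Σs-0 U λ {C} {D} _ → improperʳ φ (x ∷ C) (w ∷ v ∷ D) (inner-edge w v D wv))
                  (Σs-0 U λ {C} {D} _ → improperʳ φ C (w ∷ v ∷ x ∷ D) (inner-edge w v (x ∷ D) wv))))
          (solve 0 ((:0 :+ :0) :+ (:0 :+ :0) := :0) refl))

    path₁ : ∀ w v U → Sorted (w ∷ v ∷ U) → ∀ b → A w v ≡ b → Shape (Φ₁ w (v ∷ U)) (Φ₂ w (v ∷ U))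
    path₂ : ∀ w v x U → Sorted (w ∷ v ∷ x ∷ U) → A w v ≡ true → ∀ b → A w x ≡ b →
            Shape (Φ₁ w (v ∷ x ∷ U)) (Φ₂ w (v ∷ x ∷ U))

    path w []      s = isolated w [] s ≡.refl
    path w (v ∷ U) s = path₁ w v U s (A w v) ≡.refl

    path₁ w v U       s false wv = isolated w (v ∷ U) s (cong₂ (λ b n → bit b ℕ.+ n) wv (hit-none s wv))
    path₁ w v []      s true  wv = linked w v [] s wv ≡.refl
    path₁ w v (x ∷ U) s true  wv = path₂ w v x U s wv (A w x) ≡.refl

    path₂ w v x U s@((_ ∷ w<x ∷ w<U) ∷ _ ∷ x<U ∷ U↑) wv false wx =
      linked w v (x ∷ U) s wv (cong₂ (λ b n → bit b ℕ.+ n) wx (hit-none ((w<x ∷ w<U) ∷ x<U ∷ U↑) wx))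
    path₂ w v x U ((w<v ∷ _) ∷ (v<x ∷ _) ∷ _) wv true wx = triangle w v x U wv wx (A-closeʳ w<v v<x wx)

    Φ-sym []      s φ = refl
    Φ-sym (w ∷ U) s φ = shape-sym (path w U s) φ

  -- The two classes are merged into `U`. The ascents from `U` to the remaining vertices do not
  -- depend on how `U` is divided, so the exchange concerns `Φ U` alone.
  X-swap : ∀ Q a b as → Sorted Q → X Q (a ∷ b ∷ as) ≈ X Q (b ∷ a ∷ as)
  X-swap Q a b as Q↑ = trans (regroup a b) (trans (Σs-cong Q λ {U} {S} i → *-congˡ (flipped i)) (sym (regroup b a)))
    where
    classes : ℕ → ℕ → ℕ → ℕ → Carrier
    classes a b i j = δ a i * δ b j

    flipped : ∀ {U S} → Interleaving U S Q → Φ U (classes a b) ≈ Φ U (classes b a)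
    flipped {U} i = trans (Φ-sym U (proj₁ (AllPairs-split i Q↑)) (classes a b))
                          (Σs-cong U λ _ → *-congˡ (*-congˡ (*-comm _ _)))

    regroup : ∀ a b → X Q (a ∷ b ∷ as) ≈ Σs Q (λ U S → (q^ up U S * X S as) * Φ U (classes a b))
    regroup a b = begin
      Σs Q (λ C R → wt a C R * Σs R (λ D S → wt b D S * X S as))
        ≈⟨ Σs-cong Q (λ {C} {R} _ → sym (Σs-* R _ _)) ⟩
      Σs Q (λ C R → Σs R (λ D S → wt a C R * (wt b D S * X S as)))
        ≈⟨ Σs-cong Q (λ {C} {R} _ → Σs-cong R λ {D} {S} i → trans
             (*-congʳ (*-congˡ (*-congˡ (trans (≡⇒≈ (cong q^_ (up-splitʳ C i))) (q^-+ (up C D) (up C S))))))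
             (solve 8 (λ da ic qd qs db id qu x →
                 (da :* (ic :* (qd :* qs))) :* ((db :* (id :* qu)) :* x)
                 := ((qs :* qu) :* x) :* ((ic :* id) :* (qd :* (da :* db)))) refl
               (δ a (length C)) (isZero (inner C)) (q^ up C D) (q^ up C S) (δ b (length D)) (isZero (inner D)) (q^ up D S) (X S as))) ⟩
      Σs Q (λ C R → Σs R (λ D S → ((q^ up C S * q^ up D S) * X S as) * term (classes a b) C D))
        ≈⟨ Σs-assoc Q _ ⟩
      Σs Q (λ U S → Σs U (λ C D → ((q^ up C S * q^ up D S) * X S as) * term (classes a b) C D))
        ≈⟨ Σs-cong Q (λ {U} {S} _ → trans
             (Σs-cong U λ {C} {D} i → *-congʳ (*-congʳ (sym (trans (≡⇒≈ (cong q^_ (up-splitˡ S i))) (q^-+ (up C S) (up D S))))))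
             (Σs-* U _ _)) ⟩
      Σs Q (λ U S → (q^ up U S * X S as) * Φ U (classes a b)) ∎

  X-↭ : ∀ {as bs} Q → Sorted Q → as ↭ bs → X Q as ≈ X Q bs
  X-↭ Q s Perm.refl         = refl
  X-↭ Q s (Perm.prep a p)   = Σs-cong Q λ {C} {R} i → *-congˡ (X-↭ R (proj₂ (AllPairs-split i s)) p)
  X-↭ Q s (Perm.swap {xs} a b p) = trans (X-swap Q a b xs s)
    (Σs-cong Q λ {C} {R} i → *-congˡ (Σs-cong R λ {D} {S} j → *-congˡ
      (X-↭ S (proj₂ (AllPairs-split j (proj₂ (AllPairs-split i s)))) p)))
  X-↭ Q s (Perm.trans p p′) = trans (X-↭ Q s p) (X-↭ Q s p′)

-- Positivity of the coefficient of e_(N-1,1)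

module Functionals (𝒲 : Weights) where
  open Polynomials 𝒲

  -- H N F, P N F and M N F pair F, regarded as a linear functional on ℤ[e₁,e₂,e₃] whose value at
  -- e_{a₁}e_{a₂}⋯ is F (a₁ ∷ a₂ ∷ ⋯), with h_N, with p_{N+1} = Σ_j (-1)^{j-1} j e_j h_{N+1-j},
  -- and with m_{(N+2,1)} = p_{N+2} e₁ - p_{N+3}.  H₁ and H₂ are H at N-1 and N-2.
  H H₁ H₂ : ℕ → (List ℕ → Carrier) → Carrier
  H zero    F = F []
  H (suc N) F = (H N (F ∘ (1 ∷_)) - H₁ N (F ∘ (2 ∷_))) + H₂ N (F ∘ (3 ∷_))
  H₁ zero    F = 0#
  H₁ (suc N) F = H N F
  H₂ zero    F = 0#
  H₂ (suc N) F = H₁ N F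

  P : ℕ → (List ℕ → Carrier) → Carrier
  P N F = (H N (F ∘ (1 ∷_)) - (1# + 1#) * H₁ N (F ∘ (2 ∷_))) + (1# + (1# + 1#)) * H₂ N (F ∘ (3 ∷_))

  M : ℕ → (List ℕ → Carrier) → Carrier
  M N F = P (suc N) (F ∘ (1 ∷_)) - P (suc (suc N)) F

  -- `Λ` stands for a finite weighted sum: over chains in `layer-additive`, over partitions in the
  -- e-expansion. That `H`, `P` and `M` commute with it gives φ_Q(e_j g) = Σ q^{up(C)} φ_{Q - C}(g)
  -- for the functions g they represent.
  record Additive {J : Set} (Λ : (J → Carrier) → Carrier) : Set where
    field
      Λ-cong : ∀ {f g} → (∀ j → f j ≈ g j) → Λ f ≈ Λ g
      Λ-+    : ∀ f g → Λ (λ j → f j + g j) ≈ Λ f + Λ g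
      Λ-*    : ∀ x f → Λ (λ j → x * f j) ≈ x * Λ f
    Λ-0 : Λ (λ _ → 0#) ≈ 0#
    Λ-0 = trans (Λ-cong (λ _ → sym (zeroˡ 0#))) (trans (Λ-* 0# (λ _ → 0#)) (zeroˡ _))
    Λ-neg : ∀ f → Λ (λ j → - f j) ≈ - Λ f
    Λ-neg f = trans (Λ-cong (λ j → solve 1 (λ x → :- x := (:- :1) :* x) refl (f j)))
              (trans (Λ-* (- 1#) f) (solve 1 (λ x → (:- :1) :* x := :- x) refl (Λ f)))

  H-cong  : ∀ N {F G} → (∀ as → F as ≈ G as) → H N F ≈ H N G
  H₁-cong : ∀ N {F G} → (∀ as → F as ≈ G as) → H₁ N F ≈ H₁ N G
  H₂-cong : ∀ N {F G} → (∀ as → F as ≈ G as) → H₂ N F ≈ H₂ N G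
  H-cong zero    e = e []
  H-cong (suc N) e = +-cong (+-cong (H-cong N (λ as → e (1 ∷ as))) (-‿cong (H₁-cong N (λ as → e (2 ∷ as)))))
                            (H₂-cong N (λ as → e (3 ∷ as)))
  H₁-cong zero    e = refl
  H₁-cong (suc N) e = H-cong N e
  H₂-cong zero    e = refl
  H₂-cong (suc N) e = H₁-cong N e

  P-cong : ∀ N {F G} → (∀ as → F as ≈ G as) → P N F ≈ P N G
  P-cong N e = +-cong (+-cong (H-cong N (λ as → e (1 ∷ as))) (-‿cong (*-congˡ (H₁-cong N (λ as → e (2 ∷ as))))))
                      (*-congˡ (H₂-cong N (λ as → e (3 ∷ as))))

  M-cong : ∀ N {F G} → (∀ as → F as ≈ G as) → M N F ≈ M N G
  M-cong N e = +-cong (P-cong (suc N) (λ as → e (1 ∷ as))) (-‿cong (P-cong (suc (suc N)) e))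

  module _ {J : Set} {Λ : (J → Carrier) → Carrier} (additive : Additive Λ) where
    open Additive additive

    private
      Λ-combo : ∀ x y z (f g h : J → Carrier) →
        (x * Λ f - y * Λ g) + z * Λ h ≈ Λ (λ j → (x * f j - y * g j) + z * h j)
      Λ-combo x y z f g h = sym (trans (Λ-+ _ _) (+-cong (trans (Λ-+ _ _)
        (+-cong (Λ-* x f) (trans (Λ-neg _) (-‿cong (Λ-* y g))))) (Λ-* z h)))

      H-step : ∀ x y z → (x - y) + z ≈ (1# * x - 1# * y) + 1# * z
      H-step = solve 3 (λ x y z → (x :- y) :+ z := (:1 :* x :- :1 :* y) :+ :1 :* z) refl

      at : ℕ → (J → List ℕ → Carrier) → J → List ℕ → Carrier
      at k F j as = F j (k ∷ as)

    H-Λ  : ∀ N (F : J → List ℕ → Carrier) → H N (λ as → Λ (λ j → F j as)) ≈ Λ (λ j → H N (F j))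
    H₁-Λ : ∀ N (F : J → List ℕ → Carrier) → H₁ N (λ as → Λ (λ j → F j as)) ≈ Λ (λ j → H₁ N (F j))
    H₂-Λ : ∀ N (F : J → List ℕ → Carrier) → H₂ N (λ as → Λ (λ j → F j as)) ≈ Λ (λ j → H₂ N (F j))
    H-Λ zero    F = refl
    H-Λ (suc N) F = begin
      H (suc N) (λ as → Λ (λ j → F j as))
        ≈⟨ +-cong (+-cong (H-Λ N (at 1 F)) (-‿cong (H₁-Λ N (at 2 F)))) (H₂-Λ N (at 3 F)) ⟩
      (Λ x₁ - Λ x₂) + Λ x₃
        ≈⟨ H-step (Λ x₁) (Λ x₂) (Λ x₃) ⟩
      (1# * Λ x₁ - 1# * Λ x₂) + 1# * Λ x₃
        ≈⟨ Λ-combo 1# 1# 1# x₁ x₂ x₃ ⟩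
      Λ (λ j → (1# * x₁ j - 1# * x₂ j) + 1# * x₃ j)
        ≈⟨ Λ-cong (λ j → sym (H-step (x₁ j) (x₂ j) (x₃ j))) ⟩
      Λ (λ j → H (suc N) (F j)) ∎
      where
      x₁ x₂ x₃ : J → Carrier
      x₁ j = H N (at 1 F j)
      x₂ j = H₁ N (at 2 F j)
      x₃ j = H₂ N (at 3 F j)
    H₁-Λ zero    F = sym Λ-0
    H₁-Λ (suc N) F = H-Λ N F
    H₂-Λ zero    F = sym Λ-0
    H₂-Λ (suc N) F = H₁-Λ N F

    P-Λ : ∀ N (F : J → List ℕ → Carrier) → P N (λ as → Λ (λ j → F j as)) ≈ Λ (λ j → P N (F j))
    P-Λ N F = begin
      P N (λ as → Λ (λ j → F j as))
        ≈⟨ +-cong (+-cong (H-Λ N (at 1 F)) (-‿cong (*-congˡ (H₁-Λ N (at 2 F))))) (*-congˡ (H₂-Λ N (at 3 F))) ⟩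
      (Λ x₁ - two * Λ x₂) + three * Λ x₃
        ≈⟨ P-step (Λ x₁) (Λ x₂) (Λ x₃) ⟩
      (1# * Λ x₁ - two * Λ x₂) + three * Λ x₃
        ≈⟨ Λ-combo 1# two three x₁ x₂ x₃ ⟩
      Λ (λ j → (1# * x₁ j - two * x₂ j) + three * x₃ j)
        ≈⟨ Λ-cong (λ j → sym (P-step (x₁ j) (x₂ j) (x₃ j))) ⟩
      Λ (λ j → P N (F j)) ∎
      where
      two   = 1# + 1#
      three = 1# + (1# + 1#)
      x₁ x₂ x₃ : J → Carrier
      x₁ j = H N (at 1 F j)
      x₂ j = H₁ N (at 2 F j)
      x₃ j = H₂ N (at 3 F j)
      P-step : ∀ x y z → (x - two * y) + three * z ≈ (1# * x - two * y) + three * z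
      P-step x y z = +-congʳ (+-congʳ (sym (*-identityˡ x)))

    M-Λ : ∀ N (F : J → List ℕ → Carrier) → M N (λ as → Λ (λ j → F j as)) ≈ Λ (λ j → M N (F j))
    M-Λ N F = trans (+-cong (P-Λ (suc N) (at 1 F)) (-‿cong (P-Λ (suc (suc N)) F)))
                    (sym (trans (Λ-+ _ _) (+-congˡ (Λ-neg _))))

-- Alternating chain sums for complete homogeneous functions and power sums

module PowerSums (𝒲 : Weights) (𝒪 : IntervalOrder) where
  open Polynomials 𝒲
  open Splittings 𝒲
  open IntervalOrder 𝒪
  open Chromatic 𝒲 𝒪
  open Symmetry 𝒲 𝒪

  -- σ C = (-1)^|C| and τ C = (-1)^{|C|-1} |C|.
  σ τ : List V → Carrier
  σ []      = 1#
  σ (w ∷ C) = - σ C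
  τ []      = 0#
  τ (w ∷ C) = σ C - τ C

  -- On sorted lists this turns out to be φ_Q(h_N), N = |Q|; at q = 1 it counts the acyclic
  -- orientations of the incomparability graph.
  a : List V → Carrier
  a []      = 1#
  a (w ∷ R) = [ suc (hit w R) ] * a R

  B : List V → Carrier
  B []              = 1#
  B (w ∷ [])        = 1#
  B (w ∷ R@(_ ∷ _)) = [ hit w R ] * B R

  -- The contribution of `C` to φ_Q(e_j h_{N-j}), j = |C|, with `a R` as the value of the second
  -- factor.
  K : List V → List V → Carrier
  K C R = (isZero (inner C) * q^ up C R) * a R

  -- Two later neighbours of `w` are adjacent by `A-closeʳ`, so a chain contains at most one of
  -- them: `hit w C` is 0 or 1 wherever `K C R` is nonzero.
  clique : ∀ {w C n} → Sorted (w ∷ C) → hit w C ≡ suc (suc n) → ∃ λ m → inner C ≡ suc m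
  clique {w} {x ∷ C} s h with A w x in wx
  clique {w} {x ∷ C} s h | false with ≡.trans (≡.sym h) (hit-none s wx)
  ... | ()
  clique {w} {x ∷ []} s () | true
  clique {w} {x ∷ y ∷ C} s h | true with A w y in wy
  clique {w} {x ∷ y ∷ C} ((_ ∷ w<y ∷ w<C) ∷ (_ ∷ s)) h | true | false
    with ≡.trans (≡.sym (suc-injective h)) (hit-none ((w<y ∷ w<C) ∷ s) wy)
  ... | ()
  clique {w} {x ∷ y ∷ C} ((w<x ∷ _) ∷ (x<y ∷ _) ∷ _) h | true | true
    rewrite A-closeʳ w<x x<y wy = _ , ≡.refl

  module _ {w Q C R} (s : Sorted (w ∷ Q)) (i : Interleaving C R Q) where
    private
      u = hit w Q
      w<C : All (w <_) C
      w<C = proj₁ (All-split i (AllPairs.head s))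
      s∷C : Sorted (w ∷ C)
      s∷C = w<C ∷ proj₁ (AllPairs-split i (AllPairs.tail s))

    -- If `w` has no neighbour in `C`, all `u` of its upper neighbours lie in `R` and become
    -- ascents; otherwise `w ∷ C` is not a chain.
    K-∷ˡ : K (w ∷ C) R ≈ (q^ u * isZero (hit w C)) * K C R
    K-∷ˡ = go (hit w C) ≡.refl
      where
      go : ∀ h → hit w C ≡ h → K (w ∷ C) R ≈ (q^ u * isZero h) * K C R
      go zero h rewrite ≡.trans (cong (ℕ._+ hit w R) (≡.sym h)) (hit-split w i) | h =
        trans (*-congʳ (*-congˡ (q^-+ u (up C R))))
          (solve 4 (λ z x y t → (z :* (x :* y)) :* t := (x :* :1) :* ((z :* y) :* t)) refl
            (isZero (inner C)) (q^ u) (q^ up C R) (a R))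
      go (suc n) h rewrite h = solve 4 (λ x t u k → (:0 :* x) :* t := (u :* :0) :* k) refl
        (q^ (hit w R ℕ.+ up C R)) (a R) (q^ u) (K C R)

    -- The factor of `w` in `a` is [u + 1] = [u] + q^u if the chain `C` avoids the neighbours of
    -- `w`, and [u] if it contains one of them.
    K-∷ʳ : K C (w ∷ R) ≈ ([ u ] + isZero (hit w C) * q^ u) * K C R
    K-∷ʳ = trans (*-congʳ (*-congˡ (≡⇒≈ (cong q^_ (up-below R w<C))))) (go (hit w C) ≡.refl)
      where
      swap : ∀ x y z → x * (y * z) ≈ y * (x * z)
      swap = solve 3 (λ x y z → x :* (y :* z) := y :* (x :* z)) refl
      k = isZero (inner C) * q^ up C R
      go : ∀ h → hit w C ≡ h → k * ([ suc (hit w R) ] * a R) ≈ ([ u ] + isZero h * q^ u) * (k * a R)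
      go zero h rewrite ≡.trans (cong (ℕ._+ hit w R) (≡.sym h)) (hit-split w i) =
        trans (*-congˡ (*-congʳ ([suc] u)))
          (solve 4 (λ k b x t → k :* ((b :+ x) :* t) := (b :+ :1 :* x) :* (k :* t)) refl k [ u ] (q^ u) (a R))
      go (suc zero) h = trans
        (*-congˡ (*-congʳ (≡⇒≈ (cong [_] (≡.trans (cong (ℕ._+ hit w R) (≡.sym h)) (hit-split w i))))))
        (solve 4 (λ k b x t → k :* (b :* t) := (b :+ :0 :* x) :* (k :* t)) refl k [ u ] (q^ u) (a R))
      go (suc (suc n)) h = trans (vanish _) (sym (trans (*-congˡ (vanish _)) (zeroʳ _)))
        where
        vanish : ∀ x → k * x ≈ 0#
        vanish x = trans (*-congʳ (trans (*-congʳ (≡⇒≈ (cong isZero (proj₂ (clique s∷C h))))) (zeroˡ _))) (zeroˡ _)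

  -- With the weight `s` left open, one recursion on the smallest vertex serves `σ`, `τ` and the
  -- restricted sum `U`.
  peel : ∀ {w Q} (s : List V → Carrier) → Sorted (w ∷ Q) →
         Σs (w ∷ Q) (λ C R → s C * K C R) ≈
         Σs Q (λ C R → (s (w ∷ C) * (q^ hit w Q * isZero (hit w C))
                        + s C * ([ hit w Q ] + isZero (hit w C) * q^ hit w Q)) * K C R)
  peel {w} {Q} s Q↑ = trans (sym (Σs-+ Q _ _)) (Σs-cong Q λ {C} {R} i →
    trans (+-cong (*-congˡ (K-∷ˡ Q↑ i)) (*-congˡ (K-∷ʳ Q↑ i)))
      (solve 5 (λ s s′ x y k → s :* (x :* k) :+ s′ :* (y :* k) := (s :* x :+ s′ :* y) :* k) refl
        (s (w ∷ C)) (s C) (q^ hit w Q * isZero (hit w C)) ([ hit w Q ] + isZero (hit w C) * q^ hit w Q) (K C R)))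

  -- This is Σ (-1)^j e_j h_{N-j} = 0 for N > 0, seen through φ_Q. The term with `w` in `C` cancels
  -- the q^u part of the term with `w` in `R`; what is left is [u] times the sum for the tail, and
  -- the last vertex has u = 0.
  Σσ : ∀ Q → Sorted Q → Σs Q (λ C R → σ C * K C R) ≈ isZero (length Q)
  Σσ []      s = solve 0 (:1 :* ((:1 :* :1) :* :1) := :1) refl
  Σσ (w ∷ Q) s@(_ ∷ Q↑) = begin
    Σs (w ∷ Q) (λ C R → σ C * K C R)
      ≈⟨ peel σ s ⟩
    _ ≈⟨ Σs-cong Q (λ {C} {R} _ → solve 5 (λ s x z b k → ((:- s) :* (x :* z) :+ s :* (b :+ z :* x)) :* k := b :* (s :* k)) refl
           (σ C) (q^ hit w Q) (isZero (hit w C)) [ hit w Q ] (K C R)) ⟩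
    Σs Q (λ C R → [ hit w Q ] * (σ C * K C R))     ≈⟨ Σs-* Q _ _ ⟩
    [ hit w Q ] * Σs Q (λ C R → σ C * K C R)       ≈⟨ *-congˡ (Σσ Q Q↑) ⟩
    [ hit w Q ] * isZero (length Q)                ≈⟨ vanish Q ⟩
    0# ∎
    where
    vanish : ∀ Q → [ hit w Q ] * isZero (length Q) ≈ 0#
    vanish []      = zeroˡ _
    vanish (_ ∷ _) = zeroʳ _

  miss : V → List V → ℕ
  miss y []      = 0
  miss y (x ∷ Q) = bit (not (A y x)) ℕ.+ miss y Q

  hit+miss : ∀ y Q → hit y Q ℕ.+ miss y Q ≡ length Q
  hit+miss y []      = ≡.refl
  hit+miss y (x ∷ Q) with A y x
  ... | true  = cong suc (hit+miss y Q)
  ... | false = ≡.trans (+-suc (hit y Q) _) (cong suc (hit+miss y Q))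

  -- The signed sum over chains free of upper neighbours of `y`: the boundary term in the recursion
  -- for `τ`.
  U : V → List V → Carrier
  U y Q = Σs Q (λ C R → (isZero (hit y C) * σ C) * K C R)

  -- By `A-closeʳ` every neighbour of `y` beyond `w` is a neighbour of `w`.
  hit-mono : ∀ {y w C} → Sorted (y ∷ w ∷ C) → hit w C ≡ 0 → A y w ≡ true → hit y C ≡ 0
  hit-mono {C = []} s h yw = ≡.refl
  hit-mono {y} {w} {x ∷ C} ((y<w ∷ y<x ∷ y<C) ∷ (w<x ∷ w<C) ∷ (x<C ∷ C↑)) h yw with A w x in wx | A y x in yx
  ... | true  | _     with () ← h
  ... | false | true  with () ← ≡.trans (≡.sym wx) (A-closeʳ y<w w<x yx)
  ... | false | false = hit-mono ((y<w ∷ y<C) ∷ w<C ∷ C↑) h yw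

  -- If `y` and `w` are not adjacent, `y` has no later neighbour, the restriction is void and `Σσ`
  -- gives 0. Otherwise chains through `w` drop out, and chains avoiding the neighbours of `w` avoid
  -- those of `y` too, so only `U y Q` and `U w Q` remain.
  U-value : ∀ y w Q → Sorted (y ∷ w ∷ Q) →
            U y (w ∷ Q) ≈ (q^ miss y (w ∷ Q) * [ hit y (w ∷ Q) ]) * B (w ∷ Q)
  U-value y w Q s@((y<w ∷ y<Q) ∷ s′@(w<Q ∷ Q↑)) = go (A y w) ≡.refl
    where
    z h : List V → Carrier
    z C = isZero (hit y C)
    h C = isZero (hit w C)

    finish : ∀ Q → Sorted (y ∷ w ∷ Q) → A y w ≡ true → [ hit w Q ] * U y Q + q^ hit w Q * U w Q
             ≈ (q^ miss y Q * [ suc (hit y Q) ]) * B (w ∷ Q)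
    finish [] _ _ = solve 1 (λ x → :0 :* ((:1 :* :1) :* ((:1 :* :1) :* :1)) :+ :1 :* ((:1 :* :1) :* ((:1 :* :1) :* :1))
                    := (:1 :* (:1 :+ x :* :0)) :* :1) refl q
    finish Q@(x ∷ Q′) ((_ ∷ y<Q) ∷ s′@(_ ∷ Q↑)) _ = begin
      [ hit w Q ] * U y Q + q^ hit w Q * U w Q
        ≈⟨ +-cong (*-congˡ (U-value y x Q′ (y<Q ∷ Q↑))) (*-congˡ (U-value w x Q′ s′)) ⟩
      [ hit w Q ] * ((q^ miss y Q * [ hit y Q ]) * B Q) + q^ hit w Q * ((q^ miss w Q * [ hit w Q ]) * B Q)
        ≈⟨ solve 6 (λ c x b k m t → c :* ((k :* m) :* t) :+ b :* ((x :* c) :* t) := (k :* m :+ b :* x) :* (c :* t)) refl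
             [ hit w Q ] (q^ miss w Q) (q^ hit w Q) (q^ miss y Q) [ hit y Q ] (B Q) ⟩
      (q^ miss y Q * [ hit y Q ] + q^ hit w Q * q^ miss w Q) * ([ hit w Q ] * B Q)
        ≈⟨ *-congʳ (+-congˡ total) ⟩
      (q^ miss y Q * [ hit y Q ] + q^ hit y Q * q^ miss y Q) * ([ hit w Q ] * B Q)
        ≈⟨ *-congʳ (trans (solve 3 (λ k m h → k :* m :+ h :* k := k :* (m :+ h)) refl _ _ _) (*-congˡ (sym ([suc] (hit y Q))))) ⟩
      (q^ miss y Q * [ suc (hit y Q) ]) * ([ hit w Q ] * B Q) ∎
      where
      -- Both pairs of exponents add up to the length of `Q`.
      total : q^ hit w Q * q^ miss w Q ≈ q^ hit y Q * q^ miss y Q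
      total = trans (sym (q^-+ (hit w Q) (miss w Q))) (trans (≡⇒≈ (cong q^_
                (≡.trans (hit+miss w Q) (≡.sym (hit+miss y Q))))) (q^-+ (hit y Q) (miss y Q)))

    near : A y w ≡ true → ∀ {C R} → Interleaving C R Q → z C * h C ≈ h C
    near yw {C} i with hit w C in e
    ... | suc _ = zeroʳ _
    ... | zero  = trans (*-congʳ (≡⇒≈ (cong isZero (hit-mono
                    ((y<w ∷ proj₁ (All-split i y<Q)) ∷ proj₁ (All-split i w<Q) ∷ proj₁ (AllPairs-split i Q↑)) e yw)))) (*-identityˡ _)

    go : ∀ b → A y w ≡ b → U y (w ∷ Q) ≈ (q^ miss y (w ∷ Q) * [ hit y (w ∷ Q) ]) * B (w ∷ Q)
    go true yw = begin
      U y (w ∷ Q)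
        ≈⟨ peel (λ C → z C * σ C) s′ ⟩
      Σs Q (λ C R → ((isZero (bit (A y w) ℕ.+ hit y C) * - σ C) * (q^ hit w Q * h C)
                     + (z C * σ C) * ([ hit w Q ] + h C * q^ hit w Q)) * K C R)
        ≈⟨ Σs-cong Q (λ {C} {R} i → trans
             (*-congʳ (+-congʳ (*-congʳ (*-congʳ (≡⇒≈ (cong (λ b → isZero (bit b ℕ.+ hit y C)) yw))))))
             (trans (solve 6 (λ s x b z h k → ((:0 :* (:- s)) :* (x :* h) :+ (z :* s) :* (b :+ h :* x)) :* k
                        := b :* ((z :* s) :* k) :+ x :* (((z :* h) :* s) :* k)) refl
                 (σ C) (q^ hit w Q) [ hit w Q ] (z C) (h C) (K C R))
               (+-congˡ (*-congˡ (*-congʳ (*-congʳ (near yw i))))))) ⟩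
      Σs Q (λ C R → [ hit w Q ] * ((z C * σ C) * K C R) + q^ hit w Q * ((h C * σ C) * K C R))
        ≈⟨ trans (Σs-+ Q _ _) (+-cong (Σs-* Q _ _) (Σs-* Q _ _)) ⟩
      [ hit w Q ] * U y Q + q^ hit w Q * U w Q
        ≈⟨ finish Q s yw ⟩
      (q^ miss y Q * [ suc (hit y Q) ]) * B (w ∷ Q)
        ≈⟨ ≡⇒≈ (cong (λ b → (q^ (bit (not b) ℕ.+ miss y Q) * [ bit b ℕ.+ hit y Q ]) * B (w ∷ Q)) (≡.sym yw)) ⟩
      (q^ miss y (w ∷ Q) * [ hit y (w ∷ Q) ]) * B (w ∷ Q) ∎
    go false yw = begin
      U y (w ∷ Q)
        ≈⟨ Σs-cong (w ∷ Q) (λ {C} {R} i → *-congʳ {K C R} (trans (*-congʳ (≡⇒≈ (cong isZero (hit-0ˡ {y} {C} {R} none i)))) (*-identityˡ (σ C)))) ⟩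
      Σs (w ∷ Q) (λ C R → σ C * K C R)     ≈⟨ Σσ (w ∷ Q) s′ ⟩
      0#                                   ≈⟨ sym (trans (*-congʳ (trans (*-congˡ (≡⇒≈ (cong [_] none))) (zeroʳ _))) (zeroˡ _)) ⟩
      (q^ miss y (w ∷ Q) * [ hit y (w ∷ Q) ]) * B (w ∷ Q) ∎
      where
      none : hit y (w ∷ Q) ≡ 0
      none = cong₂ (λ b n → bit b ℕ.+ n) yw (hit-none s yw)

  -- τ (w ∷ C) = σ C - τ C leaves [u] times the sum for the tail plus q^u times `U w Q`. As u + miss
  -- w Q = |Q|, they combine through [|Q|] + q^|Q| = [|Q| + 1].
  Στ : ∀ w Q → Sorted (w ∷ Q) → Σs (w ∷ Q) (λ C R → τ C * K C R) ≈ [ length (w ∷ Q) ] * B (w ∷ Q)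
  Στ w Q s@(_ ∷ Q↑) = begin
    Σs (w ∷ Q) (λ C R → τ C * K C R)
      ≈⟨ peel τ s ⟩
    _ ≈⟨ Σs-cong Q (λ {C} {R} _ → solve 6 (λ s t x z b k → ((s :- t) :* (x :* z) :+ t :* (b :+ z :* x)) :* k
             := b :* (t :* k) :+ x :* ((z :* s) :* k)) refl
           (σ C) (τ C) (q^ hit w Q) (isZero (hit w C)) [ hit w Q ] (K C R)) ⟩
    Σs Q (λ C R → [ hit w Q ] * (τ C * K C R) + q^ hit w Q * ((isZero (hit w C) * σ C) * K C R))
      ≈⟨ trans (Σs-+ Q _ _) (+-cong (Σs-* Q _ _) (Σs-* Q _ _)) ⟩
    [ hit w Q ] * Σs Q (λ C R → τ C * K C R) + q^ hit w Q * U w Q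
      ≈⟨ finish Q s ⟩
    [ length (w ∷ Q) ] * B (w ∷ Q) ∎
    where
    finish : ∀ Q → Sorted (w ∷ Q) → [ hit w Q ] * Σs Q (λ C R → τ C * K C R) + q^ hit w Q * U w Q
             ≈ [ length (w ∷ Q) ] * B (w ∷ Q)
    finish [] _ = solve 1 (λ x → :0 :* (:0 :* ((:1 :* :1) :* :1)) :+ :1 :* ((:1 :* :1) :* ((:1 :* :1) :* :1))
                    := (:1 :+ x :* :0) :* :1) refl q
    finish Q@(x ∷ Q′) s@(_ ∷ Q↑) = begin
      [ hit w Q ] * Σs Q (λ C R → τ C * K C R) + q^ hit w Q * U w Q
        ≈⟨ +-cong (*-congˡ (Στ x Q′ Q↑)) (*-congˡ (U-value w x Q′ s)) ⟩
      [ hit w Q ] * ([ length Q ] * B Q) + q^ hit w Q * ((q^ miss w Q * [ hit w Q ]) * B Q)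
        ≈⟨ solve 5 (λ c n t x y → c :* (n :* t) :+ x :* ((y :* c) :* t) := (n :+ x :* y) :* (c :* t)) refl
             [ hit w Q ] [ length Q ] (B Q) (q^ hit w Q) (q^ miss w Q) ⟩
      ([ length Q ] + q^ hit w Q * q^ miss w Q) * ([ hit w Q ] * B Q)
        ≈⟨ *-congʳ (+-congˡ (trans (sym (q^-+ (hit w Q) (miss w Q))) (≡⇒≈ (cong q^_ (hit+miss w Q))))) ⟩
      ([ length Q ] + q^ length Q) * ([ hit w Q ] * B Q)
        ≈⟨ *-congʳ (sym ([suc] (length Q))) ⟩
      [ length (w ∷ Q) ] * B (w ∷ Q) ∎

-- Chain sums sorted by size, which is at most three

module ChainLayers (𝒲 : Weights) (𝒪 : IntervalOrder) where
  open Polynomials 𝒲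
  open Splittings 𝒲
  open IntervalOrder 𝒪
  open Chromatic 𝒲 𝒪
  open Functionals 𝒲
  open PowerSums 𝒲 𝒪

  δ-0 : ∀ n → δ 0 n ≈ isZero n
  δ-0 zero    = refl
  δ-0 (suc n) = refl

  -- The weight vanishes off size `k`, so an identity below it may assume |C| = k.
  wt-guard : ∀ k C R {x y} → (length C ≡ k → wt k C R * x ≈ wt k C R * y) → wt k C R * x ≈ wt k C R * y
  wt-guard k C R e with length C ℕ.≟ k
  ... | yes p = e p
  ... | no ¬p = trans (vanish _) (sym (vanish _))
    where
    vanish : ∀ x → wt k C R * x ≈ 0#
    vanish x = trans (*-congʳ (trans (*-congʳ (δ-≢ k _ ¬p)) (zeroˡ _))) (zeroˡ _)

  layer : ℕ → List V → (List V → Carrier) → Carrier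
  layer k Q v = Σs Q (λ C R → wt k C R * v R)

  layer-cong : ∀ k Q {v v′} → Sorted Q → (∀ R → Sorted R → k ℕ.+ length R ≡ length Q → v R ≈ v′ R) →
               layer k Q v ≈ layer k Q v′
  layer-cong k Q s e = Σs-cong Q λ {C} {R} i → wt-guard k C R λ |C|≡k →
    *-congˡ (e R (proj₂ (AllPairs-split i s)) (≡.trans (cong (ℕ._+ length R) (≡.sym |C|≡k)) (length-split i)))

  layer-additive : ∀ k Q → Additive {List V × List V} (λ f → Σs Q (λ C R → wt k C R * f (C , R)))
  layer-additive k Q = record
    { Λ-cong = λ e → Σs-cong Q λ _ → *-congˡ (e _)
    ; Λ-+    = λ f g → trans (Σs-cong Q λ _ → distribˡ _ _ _) (Σs-+ Q _ _)
    ; Λ-*    = λ x f → trans (Σs-cong Q λ {C} {R} _ →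
                 solve 3 (λ w x y → w :* (x :* y) := x :* (w :* y)) refl (wt k C R) x (f (C , R))) (Σs-* Q x _)
    }

  four-inner : ∀ {w x y z C} → Sorted (w ∷ x ∷ y ∷ z ∷ C) → isZero (inner (w ∷ x ∷ y ∷ z ∷ C)) ≈ 0#
  four-inner {w} {x} {y} {z} {C} ((w<x ∷ _) ∷ (x<y ∷ _) ∷ (y<z ∷ _) ∷ _) =
    trans (isZero-+ (hit w (x ∷ y ∷ z ∷ C)) _)
      (trans (*-congˡ (trans (isZero-+ (hit x (y ∷ z ∷ C)) _) (*-congˡ (isZero-+ (hit y (z ∷ C)) _)))) (go (A w x) (A x y) (A y z) ≡.refl ≡.refl ≡.refl))
    where
    nonzero : ∀ {u v} C → A u v ≡ true → isZero (hit u (v ∷ C)) ≈ 0#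
    nonzero {u} {v} C e = ≡⇒≈ (cong (λ b → isZero (bit b ℕ.+ hit u C)) e)
    go : ∀ a b c → A w x ≡ a → A x y ≡ b → A y z ≡ c →
         isZero (hit w (x ∷ y ∷ z ∷ C)) * (isZero (hit x (y ∷ z ∷ C)) * (isZero (hit y (z ∷ C)) * isZero (inner (z ∷ C)))) ≈ 0#
    go true  _     _     e _ _ = trans (*-congʳ (nonzero (y ∷ z ∷ C) e)) (zeroˡ _)
    go false true  _     _ e _ = trans (*-congˡ (trans (*-congʳ (nonzero (z ∷ C) e)) (zeroˡ _))) (zeroʳ _)
    go false false true  _ _ e = trans (*-congˡ (trans (*-congˡ (trans (*-congʳ (nonzero C e)) (zeroˡ _))) (zeroʳ _))) (zeroʳ _)
    go false false false e f g = ⊥-elim (A-height w<x x<y y<z e f g)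

  -- A chain has at most three elements, so on chains the sign is a combination of size indicators,
  -- matching the three terms in the recursion of `H`.
  σ-layers : ∀ C → Sorted C → σ C * isZero (inner C) ≈
             (isZero (length C) - ((δ 1 (length C) - δ 2 (length C)) + δ 3 (length C))) * isZero (inner C)
  σ-layers []              _ = *-congʳ (solve 0 (:1 := :1 :- ((:0 :- :0) :+ :0)) refl)
  σ-layers (_ ∷ [])         _ = *-congʳ (solve 0 (:- :1 := :0 :- ((:1 :- :0) :+ :0)) refl)
  σ-layers (_ ∷ _ ∷ [])     _ = *-congʳ (solve 0 (:- (:- :1) := :0 :- ((:0 :- :1) :+ :0)) refl)
  σ-layers (_ ∷ _ ∷ _ ∷ []) _ = *-congʳ (solve 0 (:- (:- (:- :1)) := :0 :- ((:0 :- :0) :+ :1)) refl)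
  σ-layers C@(_ ∷ _ ∷ _ ∷ _ ∷ _) s = trans (trans (*-congˡ (four-inner s)) (zeroʳ _)) (sym (trans (*-congˡ (four-inner s)) (zeroʳ _)))

  τ-layers : ∀ C → Sorted C → τ C * isZero (inner C) ≈
             ((δ 1 (length C) - (1# + 1#) * δ 2 (length C)) + (1# + (1# + 1#)) * δ 3 (length C)) * isZero (inner C)
  τ-layers []              _ = *-congʳ (solve 0 (:0 := (:0 :- (:1 :+ :1) :* :0) :+ (:1 :+ (:1 :+ :1)) :* :0) refl)
  τ-layers (_ ∷ [])         _ = *-congʳ (solve 0 (:1 :- :0 := (:1 :- (:1 :+ :1) :* :0) :+ (:1 :+ (:1 :+ :1)) :* :0) refl)
  τ-layers (_ ∷ _ ∷ [])     _ = *-congʳ (solve 0 (:- :1 :- (:1 :- :0) := (:0 :- (:1 :+ :1) :* :1) :+ (:1 :+ (:1 :+ :1)) :* :0) refl)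
  τ-layers (_ ∷ _ ∷ _ ∷ []) _ = *-congʳ (solve 0 (:- (:- :1) :- (:- :1 :- (:1 :- :0)) := (:0 :- (:1 :+ :1) :* :0) :+ (:1 :+ (:1 :+ :1)) :* :1) refl)
  τ-layers C@(_ ∷ _ ∷ _ ∷ _ ∷ _) s = trans (trans (*-congˡ (four-inner s)) (zeroʳ _)) (sym (trans (*-congˡ (four-inner s)) (zeroʳ _)))

  private
    layers : ∀ Q x y z → Σs Q (λ C R → (x * (wt 1 C R * a R) - y * (wt 2 C R * a R)) + z * (wt 3 C R * a R))
                         ≈ (x * layer 1 Q a - y * layer 2 Q a) + z * layer 3 Q a
    layers Q x y z = trans (Σs-+ Q _ _) (+-cong (trans (Σs-+ Q _ _)
      (+-cong (Σs-* Q x _) (trans (Σs-neg Q _) (-‿cong (Σs-* Q y _))))) (Σs-* Q z _))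

  a-layers : ∀ w Q → Sorted (w ∷ Q) →
             (layer 1 (w ∷ Q) a - layer 2 (w ∷ Q) a) + layer 3 (w ∷ Q) a ≈ a (w ∷ Q)
  a-layers w Q′ s = begin
    L                               ≈⟨ solve 2 (λ l t → l := t :- (t :- l)) refl L (a Q) ⟩
    a Q - (a Q - L)                 ≈⟨ +-congˡ (-‿cong total) ⟩
    a Q - 0#                        ≈⟨ solve 1 (λ t → t :- :0 := t) refl (a Q) ⟩
    a Q ∎
    where
    Q = w ∷ Q′
    L = (layer 1 Q a - layer 2 Q a) + layer 3 Q a
    combination : List V → List V → Carrier
    combination C R = (1# * (wt 1 C R * a R) - 1# * (wt 2 C R * a R)) + 1# * (wt 3 C R * a R)
    total : a Q - L ≈ 0#
    total = begin
      a Q - L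
        ≈⟨ +-cong (sym (trans (Σs-∅ Q K) (solve 1 (λ t → (:1 :* :1) :* t := t) refl (a Q))))
             (-‿cong (trans (solve 3 (λ x y z → (x :- y) :+ z := (:1 :* x :- :1 :* y) :+ :1 :* z) refl
               (layer 1 Q a) (layer 2 Q a) (layer 3 Q a)) (sym (layers Q 1# 1# 1#)))) ⟩
      Σs Q (λ C R → isZero (length C) * K C R)
        - Σs Q (λ C R → (1# * (wt 1 C R * a R) - 1# * (wt 2 C R * a R)) + 1# * (wt 3 C R * a R))
        ≈⟨ trans (+-congˡ (sym (Σs-neg Q combination))) (sym (Σs-+ Q (λ C R → isZero (length C) * K C R) (λ C R → - combination C R))) ⟩
      Σs Q (λ C R → isZero (length C) * K C R
        - ((1# * (wt 1 C R * a R) - 1# * (wt 2 C R * a R)) + 1# * (wt 3 C R * a R)))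
        ≈⟨ Σs-cong Q (λ {C} {R} i → trans
             (solve 7 (λ z d₁ d₂ d₃ k u t →
                z :* ((k :* u) :* t) :- ((:1 :* ((d₁ :* (k :* u)) :* t) :- :1 :* ((d₂ :* (k :* u)) :* t)) :+ :1 :* ((d₃ :* (k :* u)) :* t))
                := ((z :- ((d₁ :- d₂) :+ d₃)) :* k) :* (u :* t)) refl
                (isZero (length C)) (δ 1 (length C)) (δ 2 (length C)) (δ 3 (length C)) (isZero (inner C)) (q^ up C R) (a R))
             (trans (*-congʳ (sym (σ-layers C (proj₁ (AllPairs-split i s)))))
               (solve 4 (λ x k u t → (x :* k) :* (u :* t) := x :* ((k :* u) :* t)) refl (σ C) (isZero (inner C)) (q^ up C R) (a R)))) ⟩
      Σs Q (λ C R → σ C * K C R)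
        ≈⟨ Σσ Q s ⟩
      0# ∎

  B-layers : ∀ w Q → Sorted (w ∷ Q) →
             (layer 1 (w ∷ Q) a - (1# + 1#) * layer 2 (w ∷ Q) a) + (1# + (1# + 1#)) * layer 3 (w ∷ Q) a
             ≈ [ length (w ∷ Q) ] * B (w ∷ Q)
  B-layers w Q′ s = begin
    (layer 1 Q a - (1# + 1#) * layer 2 Q a) + (1# + (1# + 1#)) * layer 3 Q a
      ≈⟨ trans (+-congʳ (+-congʳ (sym (*-identityˡ _)))) (sym (layers Q 1# (1# + 1#) (1# + (1# + 1#)))) ⟩
    Σs Q (λ C R → (1# * (wt 1 C R * a R) - (1# + 1#) * (wt 2 C R * a R)) + (1# + (1# + 1#)) * (wt 3 C R * a R))
      ≈⟨ Σs-cong Q (λ {C} {R} i → trans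
           (solve 6 (λ d₁ d₂ d₃ k u t →
              (:1 :* ((d₁ :* (k :* u)) :* t) :- (:1 :+ :1) :* ((d₂ :* (k :* u)) :* t)) :+ (:1 :+ (:1 :+ :1)) :* ((d₃ :* (k :* u)) :* t)
              := (((d₁ :- (:1 :+ :1) :* d₂) :+ (:1 :+ (:1 :+ :1)) :* d₃) :* k) :* (u :* t)) refl
              (δ 1 (length C)) (δ 2 (length C)) (δ 3 (length C)) (isZero (inner C)) (q^ up C R) (a R))
           (trans (*-congʳ (sym (τ-layers C (proj₁ (AllPairs-split i s)))))
             (solve 4 (λ x k u t → (x :* k) :* (u :* t) := x :* ((k :* u) :* t)) refl (τ C) (isZero (inner C)) (q^ up C R) (a R)))) ⟩
    Σs Q (λ C R → τ C * K C R)
      ≈⟨ Στ w Q′ s ⟩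
    [ length Q ] * B Q ∎
    where Q = w ∷ Q′

  -- `a-layers` is the recursion h_N = e₁h_{N-1} - e₂h_{N-2} + e₃h_{N-3} that defines `H`.
  H-X  : ∀ N Q → Sorted Q → length Q ≡ N → H N (X Q) ≈ a Q
  H₁-X : ∀ N Q → Sorted Q → suc (length Q) ≡ N → H₁ N (X Q) ≈ a Q
  H₂-X : ∀ N Q → Sorted Q → suc (suc (length Q)) ≡ N → H₂ N (X Q) ≈ a Q
  X-layer₁ : ∀ N Q → Sorted Q → length Q ≡ suc N → H N (X Q ∘ (1 ∷_)) ≈ layer 1 Q a
  X-layer₂ : ∀ N Q → Sorted Q → length Q ≡ suc N → H₁ N (X Q ∘ (2 ∷_)) ≈ layer 2 Q a
  X-layer₃ : ∀ N Q → Sorted Q → length Q ≡ suc N → H₂ N (X Q ∘ (3 ∷_)) ≈ layer 3 Q a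

  X-layer₁ N Q s e = trans (H-Λ (layer-additive 1 Q) N (X ∘ proj₂))
    (layer-cong 1 Q s λ R s′ e′ → H-X N R s′ (suc-injective (≡.trans e′ e)))
  X-layer₂ N Q s e = trans (H₁-Λ (layer-additive 2 Q) N (X ∘ proj₂))
    (layer-cong 2 Q s λ R s′ e′ → H₁-X N R s′ (suc-injective (≡.trans e′ e)))
  X-layer₃ N Q s e = trans (H₂-Λ (layer-additive 3 Q) N (X ∘ proj₂))
    (layer-cong 3 Q s λ R s′ e′ → H₂-X N R s′ (suc-injective (≡.trans e′ e)))

  H-X zero    []        s e = refl
  H-X (suc N) Q@(w ∷ Q′) s e = trans
    (+-cong (+-cong (X-layer₁ N Q s e) (-‿cong (X-layer₂ N Q s e))) (X-layer₃ N Q s e))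
    (a-layers w Q′ s)
  H₁-X (suc N) Q s e = H-X N Q s (suc-injective e)
  H₂-X (suc N) Q s e = H₁-X N Q s (suc-injective e)

  P-X : ∀ N Q → Sorted Q → length Q ≡ suc N → P N (X Q) ≈ [ suc N ] * B Q
  P-X N Q@(w ∷ Q′) s e = trans
    (+-cong (+-cong (X-layer₁ N Q s e) (-‿cong (*-congˡ (X-layer₂ N Q s e)))) (*-congˡ (X-layer₃ N Q s e)))
    (trans (B-layers w Q′ s) (*-congʳ (≡⇒≈ (cong [_] e))))

  -- Single vertices are the chains of size 1, so this is the sum over v of q^{up(v)} B(Q - v).
  W : List V → Carrier
  W Q = layer 1 Q B

  M-X : ∀ N Q → Sorted Q → length Q ≡ suc (suc (suc N)) →
        M N (X Q) ≈ [ suc (suc N) ] * W Q - [ suc (suc (suc N)) ] * B Q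
  M-X N Q s e = +-cong (begin
    P (suc N) (X Q ∘ (1 ∷_))
      ≈⟨ P-Λ (layer-additive 1 Q) (suc N) (X ∘ proj₂) ⟩
    layer 1 Q (λ R → P (suc N) (X R))
      ≈⟨ layer-cong 1 Q s (λ R s′ e′ → P-X (suc N) R s′ (suc-injective (≡.trans e′ e))) ⟩
    layer 1 Q (λ R → [ suc (suc N) ] * B R)
      ≈⟨ Additive.Λ-* (layer-additive 1 Q) [ suc (suc N) ] (B ∘ proj₂) ⟩
    [ suc (suc N) ] * W Q ∎) (-‿cong (P-X (suc (suc N)) Q s e))

-- Nonnegativity of the pairing with m_(N-1,1)

module Hooks (𝒲 : Weights) (𝒪 : IntervalOrder) where
  open Polynomials 𝒲
  open Splittings 𝒲
  open IntervalOrder 𝒪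
  open Chromatic 𝒲 𝒪
  open Symmetry 𝒲 𝒪
  open Functionals 𝒲
  open PowerSums 𝒲 𝒪
  open ChainLayers 𝒲 𝒪

  -- For sorted lists this is connectedness of the incomparability graph; when it fails, some factor
  -- of `B` is [0].
  Connected : List V → Set
  Connected []              = ⊤
  Connected (w ∷ [])        = ⊤
  Connected (w ∷ R@(_ ∷ _)) = (∃ λ u → hit w R ≡ suc u) × Connected R

  connected? : ∀ Q → Connected Q ⊎ B Q ≈ 0#
  connected? []              = inj₁ tt
  connected? (w ∷ [])        = inj₁ tt
  connected? (w ∷ R@(_ ∷ _)) = step (hit w R) ≡.refl (connected? R)
    where
    step : ∀ h → hit w R ≡ h → Connected R ⊎ B R ≈ 0# → Connected (w ∷ R) ⊎ B (w ∷ R) ≈ 0#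
    step zero    e _        = inj₂ (trans (*-congʳ (≡⇒≈ (cong [_] e))) (zeroˡ _))
    step (suc u) e (inj₁ c) = inj₁ ((u , e) , c)
    step (suc u) e (inj₂ z) = inj₂ (trans (*-congˡ z) (zeroʳ _))

  B-Pos : ∀ Q → Pos (B Q)
  B-Pos []              = Pos-1
  B-Pos (w ∷ [])        = Pos-1
  B-Pos (w ∷ R@(_ ∷ _)) = Pos-* (Pos-[] (hit w R)) (B-Pos R)

  W-Pos : ∀ Q → Pos (W Q)
  W-Pos Q = Σs-Pos Q λ {C} {R} _ → Pos-* (wt-Pos 1 C R) (B-Pos R)

  -- For |C| = 1 the factor [hit y C] is 1 or 0, so this is the part of `W Q` that comes from the
  -- upper neighbours of `y`.
  near : V → List V → Carrier
  near y Q = Σs Q (λ C R → [ hit y C ] * (wt 1 C R * B R))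

  private
    [1] : [ 1 ] ≈ 1#
    [1] = solve 1 (λ x → :1 :+ x :* :0 := :1) refl q

    cancel : ∀ {x y z} → x + y ≈ z + y → x ≈ z
    cancel {x} {y} {z} e = trans (solve 2 (λ x y → x := (x :+ y) :- y) refl x y)
                           (trans (+-congʳ e) (solve 2 (λ z y → (z :+ y) :- y := z) refl z y))

    first : ∀ w Q u → hit w Q ≡ u → (f : List V → Carrier) →
            Σs Q (λ C R → f C * (wt 1 (w ∷ C) R * B R)) ≈ f [] * (q^ u * B Q)
    first w Q u e f = trans
      (Σs-cong Q λ {C} {R} _ → trans (*-congˡ (*-congʳ (*-congʳ (δ-0 (length C)))))
        (solve 5 (λ f z k x b → f :* ((z :* (k :* x)) :* b) := z :* (f :* ((k :* x) :* b))) refl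
          (f C) (isZero (length C)) (isZero (inner (w ∷ C))) (q^ up (w ∷ C) R) (B R)))
      (trans (Σs-∅ Q (λ C R → f C * ((isZero (inner (w ∷ C)) * q^ up (w ∷ C) R) * B R)))
        (*-congˡ (*-congʳ (trans (*-identityˡ _) (≡⇒≈ (cong q^_ (≡.trans (ℕₚ.+-identityʳ _) e)))))))

  -- `Q` has at least two elements so that `w` does not become the last vertex, for which `B` has no
  -- factor, when one of them is removed.
  module Peel (w x y : V) (Q″ : List V) (s : Sorted (w ∷ x ∷ y ∷ Q″))
              (u : ℕ) (h : hit w (x ∷ y ∷ Q″) ≡ suc u) where
    private
      Q : List V
      Q = x ∷ y ∷ Q″

    wt-below : ∀ {C R} → Interleaving C R Q → wt 1 C (w ∷ R) ≈ wt 1 C R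
    wt-below {C} {R} i = *-congˡ (*-congˡ (≡⇒≈ (cong q^_ (up-below R (proj₁ (All-split i (AllPairs.head s)))))))

    B-∷ : ∀ {C R} → Interleaving C R Q → length C ≡ 1 → B (w ∷ R) ≈ [ hit w R ] * B R
    B-∷ {C} {[]}    i e with () ← ≡.trans (≡.sym (≡.trans (ℕₚ.+-identityʳ _) e)) (length-split i)
    B-∷ {C} {_ ∷ _} i e = refl

    split-u : ∀ {c R} → Interleaving (c ∷ []) R Q → [ hit w R ] + [ hit w (c ∷ []) ] * q^ u ≈ [ suc u ]
    split-u {c} {R} i with A w c | hit-split w i
    ... | true  | e = trans (+-cong (≡⇒≈ (cong [_] (suc-injective (≡.trans e h)))) (trans (*-congʳ [1]) (*-identityˡ _))) (sym ([suc] u))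
    ... | false | e = trans (+-cong (≡⇒≈ (cong [_] (≡.trans e h))) (zeroˡ _)) (+-identityʳ _)

    -- Removing an upper neighbour of `w` lowers the factor of `w` from [u + 1] to [u]; adding q^u
    -- times `near w Q` restores it. The term q^(u+1) B(Q) removes `w` itself.
    W-peel : W (w ∷ Q) + q^ u * near w Q ≈ q^ suc u * B Q + [ suc u ] * W Q
    W-peel = begin
      (Σs Q (λ C R → wt 1 (w ∷ C) R * B R) + Σs Q (λ C R → wt 1 C (w ∷ R) * B (w ∷ R))) + q^ u * near w Q
        ≈⟨ +-assoc _ _ _ ⟩
      Σs Q (λ C R → wt 1 (w ∷ C) R * B R) + (Σs Q (λ C R → wt 1 C (w ∷ R) * B (w ∷ R)) + q^ u * near w Q)
        ≈⟨ +-cong top rest ⟩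
      q^ suc u * B Q + [ suc u ] * W Q ∎
      where
      top : Σs Q (λ C R → wt 1 (w ∷ C) R * B R) ≈ q^ suc u * B Q
      top = trans (Σs-cong Q {λ C R → wt 1 (w ∷ C) R * B R} λ _ → sym (*-identityˡ _)) (trans (first w Q (suc u) h (λ _ → 1#)) (*-identityˡ _))
      point : ∀ {C R} → Interleaving C R Q → length C ≡ 1 →
              wt 1 C R * (B (w ∷ R) + q^ u * ([ hit w C ] * B R)) ≈ wt 1 C R * ([ suc u ] * B R)
      point {c ∷ []} {R} i e = *-congˡ (begin
        B (w ∷ R) + q^ u * ([ hit w (c ∷ []) ] * B R)            ≈⟨ +-congʳ (B-∷ i e) ⟩
        [ hit w R ] * B R + q^ u * ([ hit w (c ∷ []) ] * B R)
          ≈⟨ solve 4 (λ r x c b → r :* b :+ x :* (c :* b) := (r :+ c :* x) :* b) refl [ hit w R ] (q^ u) [ hit w (c ∷ []) ] (B R) ⟩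
        ([ hit w R ] + [ hit w (c ∷ []) ] * q^ u) * B R          ≈⟨ *-congʳ (split-u i) ⟩
        [ suc u ] * B R ∎)
      rest : Σs Q (λ C R → wt 1 C (w ∷ R) * B (w ∷ R)) + q^ u * near w Q ≈ [ suc u ] * W Q
      rest = begin
        Σs Q (λ C R → wt 1 C (w ∷ R) * B (w ∷ R)) + q^ u * near w Q
          ≈⟨ trans (+-congˡ (sym (Σs-* Q (q^ u) (λ C R → [ hit w C ] * (wt 1 C R * B R))))) (sym (Σs-+ Q (λ C R → wt 1 C (w ∷ R) * B (w ∷ R)) (λ C R → q^ u * ([ hit w C ] * (wt 1 C R * B R))))) ⟩
        Σs Q (λ C R → wt 1 C (w ∷ R) * B (w ∷ R) + q^ u * ([ hit w C ] * (wt 1 C R * B R)))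
          ≈⟨ Σs-cong Q (λ {C} {R} i → trans (+-congʳ (*-congʳ (wt-below i)))
               (trans (solve 5 (λ t b x n c → t :* b :+ x :* (n :* (t :* c)) := t :* (b :+ x :* (n :* c))) refl
                 (wt 1 C R) (B (w ∷ R)) (q^ u) [ hit w C ] (B R))
               (trans (wt-guard 1 C R (point i))
                 (solve 3 (λ t n b → t :* (n :* b) := n :* (t :* b)) refl (wt 1 C R) [ suc u ] (B R))))) ⟩
        Σs Q (λ C R → [ suc u ] * (wt 1 C R * B R))
          ≈⟨ Σs-* Q [ suc u ] (λ C R → wt 1 C R * B R) ⟩
        [ suc u ] * W Q ∎

    -- Upper neighbours of `v` beyond `w` are upper neighbours of `w` as well, so removing any of
    -- them turns the factor of `w` into [u].
    near-peel : ∀ v → Sorted (v ∷ w ∷ Q) → A v w ≡ true → near v (w ∷ Q) ≈ q^ suc u * B Q + [ u ] * near v Q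
    near-peel v ((v<w ∷ v<Q) ∷ _) vw = +-cong
      (trans (first w Q (suc u) h (λ C → [ hit v (w ∷ C) ]))
        (trans (*-congʳ (trans (≡⇒≈ (cong (λ b → [ bit b ℕ.+ 0 ]) vw)) [1])) (*-identityˡ _)))
      (trans (Σs-cong Q λ {C} {R} i → trans (*-congˡ (*-congʳ (wt-below i)))
          (trans (solve 3 (λ n t b → n :* (t :* b) := t :* (n :* b)) refl [ hit v C ] (wt 1 C R) (B (w ∷ R)))
          (trans (wt-guard 1 C R (point i))
            (solve 4 (λ t n m b → t :* (n :* (m :* b)) := n :* (m :* (t :* b))) refl (wt 1 C R) [ u ] [ hit v C ] (B R)))))
        (Σs-* Q [ u ] (λ C R → [ hit v C ] * (wt 1 C R * B R))))
      where
      point : ∀ {C R} → Interleaving C R Q → length C ≡ 1 →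
              wt 1 C R * ([ hit v C ] * B (w ∷ R)) ≈ wt 1 C R * ([ u ] * ([ hit v C ] * B R))
      point {c ∷ []} {R} i e with A v c in vc
      ... | false = *-congˡ (trans (zeroˡ _) (sym (trans (*-congˡ (zeroˡ _)) (zeroʳ _))))
      ... | true  = *-congˡ (trans (*-congˡ (trans (B-∷ i e) (*-congʳ (≡⇒≈ (cong [_] hits)))))
                      (solve 3 (λ o n b → o :* (n :* b) := n :* (o :* b)) refl [ 1 ] [ u ] (B R)))
        where
        wc : A w c ≡ true
        wc = A-closeʳ v<w (All.head (proj₁ (All-split i (AllPairs.head s)))) vc
        hits : hit w R ≡ u
        hits = suc-injective (≡.trans (cong (λ b → (bit b ℕ.+ 0) ℕ.+ hit w R) (≡.sym wc)) (≡.trans (hit-split w i) h))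

  hit≤length : ∀ y Q → hit y Q ≤ length Q
  hit≤length y Q = ≡.subst (hit y Q ℕ.≤_) (hit+miss y Q) (m≤m+n _ _)

  full⇒All : ∀ w Q → hit w Q ≡ length Q → All (λ v → A w v ≡ true) Q
  full⇒All w []      e = []
  full⇒All w (x ∷ Q) e with A w x in wx
  ... | true  = wx ∷ full⇒All w Q (suc-injective e)
  ... | false = ⊥-elim (1+n≰n (≡.subst (ℕ._≤ length Q) e (hit≤length w Q)))

  All⇒full : ∀ w Q → All (λ v → A w v ≡ true) Q → hit w Q ≡ length Q
  All⇒full w []      []       = ≡.refl
  All⇒full w (x ∷ Q) (e ∷ es) = cong₂ (λ b n → bit b ℕ.+ n) e (All⇒full w Q es)

  full-tail : ∀ w x Q → Sorted (w ∷ x ∷ Q) → hit w (x ∷ Q) ≡ suc (length Q) → hit x Q ≡ length Q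
  full-tail w x Q ((w<x ∷ _) ∷ (x<Q ∷ _)) e =
    All⇒full x Q (All.zipWith (λ (x<v , wv) → A-closeʳ w<x x<v wv) (x<Q , All.tail (full⇒All w (x ∷ Q) e)))

  near-all : ∀ w Q → hit w Q ≡ length Q → near w Q ≈ W Q
  near-all w Q e = Σs-cong Q λ {C} {R} i →
    trans (solve 3 (λ n t b → n :* (t :* b) := t :* (n :* b)) refl [ hit w C ] (wt 1 C R) (B R))
          (wt-guard 1 C R λ |C|≡1 → *-congˡ (trans (*-congʳ (trans (≡⇒≈ (cong [_]
            (≡.trans (All⇒full w C (proj₁ (All-split i (full⇒All w Q e)))) |C|≡1))) [1])) (*-identityˡ _)))

  W-pair : ∀ w x → w < x → A w x ≡ true → W (w ∷ x ∷ []) ≈ [ 2 ]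
  W-pair w x w<x wx rewrite wx | A-asym w<x = solve 1 (λ x →
    ((:0 :* (:0 :* :1)) :* :1 :+ (:1 :* (:1 :* (x :* :1))) :* :1)
    :+ ((:1 :* (:1 :* :1)) :* :1 :+ (:0 :* (:1 :* :1)) :* ((:1 :+ x :* :0) :* :1))
    := :1 :+ x :* (:1 :+ x :* :0)) refl q

  -- If `w` is adjacent to all later vertices, the graph is complete. Then `near w Q` is all of
  -- `W Q` and cancels against the q^u part of [u + 1] W Q in `W-peel`.
  W-full : ∀ w Q → Sorted (w ∷ Q) → 1 ≤ length Q → hit w Q ≡ length Q → W (w ∷ Q) ≈ [ suc (length Q) ] * B Q
  W-full w (x ∷ []) ((w<x ∷ _) ∷ _) _ e with full⇒All w (x ∷ []) e
  ... | wx ∷ [] = trans (W-pair w x w<x wx) (sym (*-identityʳ _))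
  W-full w Q@(x ∷ Q′@(y ∷ Q″)) s@(_ ∷ s′) _ e = cancel (begin
    W (w ∷ Q) + q^ u * W Q               ≈⟨ +-congˡ (*-congˡ (sym (near-all w Q e))) ⟩
    W (w ∷ Q) + q^ u * near w Q          ≈⟨ W-peel ⟩
    q^ suc u * B Q + [ suc u ] * W Q     ≈⟨ +-congˡ (*-congʳ ([suc] u)) ⟩
    q^ suc u * B Q + ([ u ] + q^ u) * W Q
      ≈⟨ solve 5 (λ t b n z v → t :* b :+ (n :+ z) :* v := (t :* b :+ n :* v) :+ z :* v) refl (q^ suc u) (B Q) [ u ] (q^ u) (W Q) ⟩
    (q^ suc u * B Q + [ u ] * W Q) + q^ u * W Q
      ≈⟨ +-congʳ (+-congˡ (*-congˡ (W-full x Q′ s′ (s≤s z≤n) e′))) ⟩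
    (q^ suc u * B Q + [ u ] * ([ suc u ] * B Q′)) + q^ u * W Q
      ≈⟨ +-congʳ (+-congˡ (trans (solve 3 (λ a b c → a :* (b :* c) := b :* (a :* c)) refl [ u ] [ suc u ] (B Q′))
           (*-congˡ (*-congʳ (≡⇒≈ (cong [_] (≡.sym e′))))))) ⟩
    (q^ suc u * B Q + [ suc u ] * B Q) + q^ u * W Q
      ≈⟨ +-congʳ (trans (solve 3 (λ t n b → t :* b :+ n :* b := (n :+ t) :* b) refl (q^ suc u) [ suc u ] (B Q)) (*-congʳ (sym ([suc] (suc u))))) ⟩
    [ suc (suc u) ] * B Q + q^ u * W Q ∎)
    where
    u = length Q′
    e′ : hit x Q′ ≡ length Q′
    e′ = full-tail w x Q′ s e
    open Peel w x y Q″ s u e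

  -- Since [u + 1] = [u] + q^u, q times `B (w ∷ R)` splits into two terms that are compared with
  -- those of `near-peel`. The bound fails if `y` is adjacent to all of `Q`: for a single vertex it
  -- would read q ≥ 1.
  near-bound : ∀ y Q → Sorted (y ∷ Q) → Connected Q → hit y Q ℕ.< length Q →
               Σ[ z ∈ Carrier ] Pos z × (q * B Q ≈ near y Q + z)
  near-bound y [] s c ()
  near-bound y (w ∷ Q) s c lt = go Q s c lt (A y w) ≡.refl
    where
    go : ∀ Q → Sorted (y ∷ w ∷ Q) → Connected (w ∷ Q) → hit y (w ∷ Q) ℕ.< suc (length Q) → ∀ b → A y w ≡ b →
         Σ[ z ∈ Carrier ] Pos z × (q * B (w ∷ Q) ≈ near y (w ∷ Q) + z)
    go Q s c lt false yw = q * B (w ∷ Q) , Pos-* Pos-q (B-Pos (w ∷ Q)) ,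
      sym (trans (+-congʳ (Σs-0 (w ∷ Q) {λ C R → [ hit y C ] * (wt 1 C R * B R)} λ {C} i → trans (*-congʳ (≡⇒≈ (cong [_] (hit-0ˡ {y} {C} none i)))) (zeroˡ _))) (+-identityˡ _))
      where
      none : hit y (w ∷ Q) ≡ 0
      none = cong₂ (λ b n → bit b ℕ.+ n) yw (hit-none s yw)
    go [] s c lt true yw = ⊥-elim (ℕₚ.<-irrefl (cong (λ b → bit b ℕ.+ 0) yw) lt)
    -- Of the last two vertices `y` sees only `w`, and removing `w` costs one ascent: both sides
    -- equal q.
    go (x ∷ []) (_ ∷ (w<x ∷ _) ∷ _) c lt true yw = 0# , Pos-0 , pair (A w x) (A y x) ≡.refl ≡.refl
      where
      pair : ∀ b b′ → A w x ≡ b → A y x ≡ b′ → q * B (w ∷ x ∷ []) ≈ near y (w ∷ x ∷ []) + 0#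
      pair false _    wx _ = ⊥-elim (ℕₚ.0≢1+n (≡.trans (cong (λ b → bit b ℕ.+ 0) (≡.sym wx)) (proj₂ (proj₁ c))))
      pair true true  _ yx = ⊥-elim (ℕₚ.<-irrefl (cong₂ (λ b b′ → bit b ℕ.+ (bit b′ ℕ.+ 0)) yw yx) lt)
      pair true false wx yx rewrite yw | wx | yx | A-asym w<x = solve 1 (λ x →
        x :* ((:1 :+ x :* :0) :* :1) :=
        (((:1 :+ x :* :0) :* ((:0 :* (:0 :* :1)) :* :1) :+ (:1 :+ x :* :0) :* ((:1 :* (:1 :* (x :* :1))) :* :1))
         :+ (:0 :* ((:1 :* (:1 :* :1)) :* :1) :+ :0 :* ((:0 :* (:1 :* :1)) :* ((:1 :+ x :* :0) :* :1)))) :+ :0) refl q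
    go (x ∷ x′ ∷ Q) s@((y<w ∷ y<Q) ∷ s′@(w<Q ∷ Q↑)) ((u , e) , c) lt true yw
      with near-bound y (x ∷ x′ ∷ Q) (y<Q ∷ Q↑) c (ℕ.s<s⁻¹ (≡.subst (λ b → bit b ℕ.+ hit y (x ∷ x′ ∷ Q) ℕ.< _) yw lt))
    ... | z , z≥0 , eq = [ u ] * z , Pos-* (Pos-[] u) z≥0 , (begin
      q * ([ hit w R ] * B R)        ≈⟨ *-congˡ (*-congʳ (trans (≡⇒≈ (cong [_] e)) ([suc] u))) ⟩
      q * (([ u ] + q^ u) * B R)
        ≈⟨ solve 4 (λ x n t b → x :* ((n :+ t) :* b) := (x :* t) :* b :+ n :* (x :* b)) refl q [ u ] (q^ u) (B R) ⟩
      q^ suc u * B R + [ u ] * (q * B R)             ≈⟨ +-congˡ (*-congˡ eq) ⟩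
      q^ suc u * B R + [ u ] * (near y R + z)
        ≈⟨ solve 4 (λ t n v z → t :+ n :* (v :+ z) := (t :+ n :* v) :+ n :* z) refl _ [ u ] (near y R) z ⟩
      (q^ suc u * B R + [ u ] * near y R) + [ u ] * z   ≈⟨ +-congʳ (sym (near-peel y s yw)) ⟩
      near y (w ∷ R) + [ u ] * z ∎)
      where
      R = x ∷ x′ ∷ Q
      open Peel w x x′ Q s′ u e

  -- The second bound is the one wanted. The first is carried along because [N + 2] = 1 + q [N + 1]
  -- leaves a bare copy of `W Q` in the induction step. If `w` is adjacent to everything, `W-full`
  -- settles both at once; otherwise `near-bound` makes `W (w ∷ Q)` exceed [u + 1] W Q.
  W-bounds : ∀ N Q → Sorted Q → Connected Q → length Q ≡ suc (suc N) →
             (Σ[ z ∈ Carrier ] Pos z × (W Q ≈ B Q + z)) ×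
             (Σ[ z ∈ Carrier ] Pos z × ([ suc N ] * W Q ≈ [ suc (suc N) ] * B Q + z))
  W-bounds N (w ∷ Q@(x ∷ Q′)) s c e with hit w Q ℕ.≟ length Q
  ... | yes f = (q^ length Q * B Q , Pos-* (Pos-q^ (length Q)) (B-Pos Q) , (begin
      W (w ∷ Q)                                ≈⟨ W-full w Q s (s≤s z≤n) f ⟩
      [ suc (length Q) ] * B Q                 ≈⟨ *-congʳ ([suc] (length Q)) ⟩
      ([ length Q ] + q^ length Q) * B Q       ≈⟨ distribʳ _ _ _ ⟩
      [ length Q ] * B Q + q^ length Q * B Q   ≈⟨ +-congʳ (*-congʳ (≡⇒≈ (cong [_] (≡.sym f)))) ⟩
      B (w ∷ Q) + q^ length Q * B Q ∎))
    , (0# , Pos-0 , (begin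
      [ suc N ] * W (w ∷ Q)                       ≈⟨ *-cong (≡⇒≈ (cong [_] (≡.trans (≡.sym (suc-injective e)) (≡.sym f)))) (W-full w Q s (s≤s z≤n) f) ⟩
      [ hit w Q ] * ([ suc (length Q) ] * B Q)    ≈⟨ *-congˡ (*-congʳ (≡⇒≈ (cong [_] e))) ⟩
      [ hit w Q ] * ([ suc (suc N) ] * B Q)       ≈⟨ solve 3 (λ h n b → h :* (n :* b) := n :* (h :* b) :+ :0) refl [ hit w Q ] [ suc (suc N) ] (B Q) ⟩
      [ suc (suc N) ] * B (w ∷ Q) + 0# ∎))
  -- Two vertices of a connected graph are adjacent, which is the complete case.
  W-bounds zero (w ∷ x ∷ []) s ((u , h) , c) e | no ¬f with A w x
  ... | true  = ⊥-elim (¬f ≡.refl)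
  ... | false with () ← h
  W-bounds (suc N) (w ∷ Q@(x ∷ x′ ∷ Q″)) s@(w<Q ∷ Q↑) c@((u , h) , c′) e | no ¬f
    with near-bound w Q s c′ (ℕₚ.≤∧≢⇒< (hit≤length w Q) ¬f) | W-bounds N Q Q↑ c′ (suc-injective e)
  ... | z , z≥0 , eq | (z₁ , z₁≥0 , eq₁) , (z₂ , z₂≥0 , eq₂) =
    ([ suc u ] * z₁ + q^ u * z , Pos-+ (Pos-* (Pos-[] (suc u)) z₁≥0) excess≥0 , (begin
      W (w ∷ Q)                                          ≈⟨ W-step ⟩
      [ suc u ] * W Q + q^ u * z                         ≈⟨ +-congʳ (*-congˡ eq₁) ⟩
      [ suc u ] * (B Q + z₁) + q^ u * z
        ≈⟨ solve 4 (λ n b z t → n :* (b :+ z) :+ t := n :* b :+ (n :* z :+ t)) refl [ suc u ] (B Q) z₁ _ ⟩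
      [ suc u ] * B Q + ([ suc u ] * z₁ + q^ u * z)      ≈⟨ +-congʳ (*-congʳ (≡⇒≈ (cong [_] (≡.sym h)))) ⟩
      B (w ∷ Q) + ([ suc u ] * z₁ + q^ u * z) ∎))
    , ([ suc u ] * (q * z₂ + z₁) + [ suc (suc N) ] * (q^ u * z)
      , Pos-+ (Pos-* (Pos-[] (suc u)) (Pos-+ (Pos-* Pos-q z₂≥0) z₁≥0)) (Pos-* (Pos-[] (suc (suc N))) excess≥0) , (begin
      [ suc (suc N) ] * W (w ∷ Q)                        ≈⟨ *-congˡ W-step ⟩
      (1# + q * [ suc N ]) * ([ suc u ] * W Q + q^ u * z)
        ≈⟨ solve 5 (λ x n c v t → (:1 :+ x :* n) :* (c :* v :+ t) := c :* (x :* (n :* v) :+ v) :+ (:1 :+ x :* n) :* t) refl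
             q [ suc N ] [ suc u ] (W Q) (q^ u * z) ⟩
      [ suc u ] * (q * ([ suc N ] * W Q) + W Q) + [ suc (suc N) ] * (q^ u * z)
        ≈⟨ +-congʳ (*-congˡ (+-cong (*-congˡ eq₂) eq₁)) ⟩
      [ suc u ] * (q * ([ suc (suc N) ] * B Q + z₂) + (B Q + z₁)) + [ suc (suc N) ] * (q^ u * z)
        ≈⟨ solve 7 (λ c x n b z₂ z₁ t → c :* (x :* (n :* b :+ z₂) :+ (b :+ z₁)) :+ t
              := (:1 :+ x :* n) :* (c :* b) :+ (c :* (x :* z₂ :+ z₁) :+ t)) refl
             [ suc u ] q [ suc (suc N) ] (B Q) z₂ z₁ ([ suc (suc N) ] * (q^ u * z)) ⟩
      [ suc (suc (suc N)) ] * ([ suc u ] * B Q) + ([ suc u ] * (q * z₂ + z₁) + [ suc (suc N) ] * (q^ u * z))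
        ≈⟨ +-congʳ (*-congˡ (*-congʳ (≡⇒≈ (cong [_] (≡.sym h))))) ⟩
      [ suc (suc (suc N)) ] * B (w ∷ Q) + ([ suc u ] * (q * z₂ + z₁) + [ suc (suc N) ] * (q^ u * z)) ∎))
    where
    open Peel w x x′ Q″ s u h
    excess≥0 : Pos (q^ u * z)
    excess≥0 = Pos-* (Pos-q^ u) z≥0
    W-step : W (w ∷ Q) ≈ [ suc u ] * W Q + q^ u * z
    W-step = cancel (begin
      W (w ∷ Q) + q^ u * near w Q                    ≈⟨ W-peel ⟩
      q^ suc u * B Q + [ suc u ] * W Q
        ≈⟨ solve 5 (λ x t b n v → (x :* t) :* b :+ n :* v := t :* (x :* b) :+ n :* v) refl q (q^ u) (B Q) [ suc u ] (W Q) ⟩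
      q^ u * (q * B Q) + [ suc u ] * W Q             ≈⟨ +-congʳ (*-congˡ eq) ⟩
      q^ u * (near w Q + z) + [ suc u ] * W Q
        ≈⟨ solve 4 (λ t v z n → t :* (v :+ z) :+ n := (n :+ t :* z) :+ t :* v) refl (q^ u) (near w Q) z _ ⟩
      ([ suc u ] * W Q + q^ u * z) + q^ u * near w Q ∎)

  -- If the graph is disconnected, `B Q` vanishes and only the positive term of `M-X` is left.
  M-Pos : ∀ N Q → Sorted Q → length Q ≡ suc (suc (suc N)) → Pos (M N (X Q))
  M-Pos N Q s e with connected? Q
  ... | inj₁ c = let z , z≥0 , eq = proj₂ (W-bounds (suc N) Q s c e) in
    Pos-resp (sym (trans (M-X N Q s e) (trans (+-congʳ eq) (solve 2 (λ b z → (b :+ z) :- b := z) refl ([ suc (suc (suc N)) ] * B Q) z)))) z≥0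
  ... | inj₂ B≈0 = Pos-resp
    (sym (trans (M-X N Q s e) (trans (+-congˡ (-‿cong (trans (*-congˡ B≈0) (zeroʳ _)))) (solve 1 (λ x → x :- :0 := x) refl _))))
    (Pos-* (Pos-[] (suc (suc N))) (W-Pos Q))

  -- Each factor e₃ is a sum over chains of size 3 with positive weights, and the complement of such
  -- a chain is a sorted list in the same order with three fewer vertices.
  M-triples-Pos : ∀ l N Q → Sorted Q → length Q ≡ l ℕ.* 3 ℕ.+ suc (suc (suc N)) →
                  Pos (M N (λ as → X Q (replicate l 3 ++ as)))
  M-triples-Pos zero    N Q s e = M-Pos N Q s e
  M-triples-Pos (suc l) N Q s e = Pos-resp
    (sym (M-Λ (layer-additive 3 Q) N (λ j as → X (proj₂ j) (replicate l 3 ++ as))))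
    (Σs-Pos Q λ {C} {R} i → guarded C R (proj₂ (AllPairs-split i s)) (length-split i))
    where
    guarded : ∀ C R → Sorted R → length C ℕ.+ length R ≡ length Q →
              Pos (wt 3 C R * M N (λ as → X R (replicate l 3 ++ as)))
    guarded C R R↑ split with length C ℕ.≟ 3
    ... | yes p = Pos-* (wt-Pos 3 C R) (M-triples-Pos l N R R↑ (ℕₚ.+-cancelˡ-≡ 3 _ _ (≡.trans (≡.trans (cong (ℕ._+ length R) (≡.sym p)) split) e)))
    ... | no ¬p = Pos-resp (sym (trans (*-congʳ (trans (*-congʳ (δ-≢ 3 _ ¬p)) (zeroˡ _))) (zeroˡ _))) Pos-0

-- Triangular expansion in elementary symmetric functions

module Matrices where
  open import Data.Nat using (_+_; _*_; _<_)
  open import Data.Nat.Properties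
  open import Relation.Binary.PropositionalEquality

  -- Σ of k (μ - 1_S) over the a-element sets S of positions of μ with positive entries.
  choose : ℕ → List ℕ → (List ℕ → ℕ) → ℕ
  choose zero    []          k = k []
  choose (suc a) []          k = 0
  choose zero    (x ∷ μ)     k = choose zero μ (k ∘ (x ∷_))
  choose (suc a) (zero ∷ μ)  k = choose (suc a) μ (k ∘ (zero ∷_))
  choose (suc a) (suc x ∷ μ) k = choose (suc a) μ (k ∘ (suc x ∷_)) + choose a μ (k ∘ (x ∷_))

  allZero : List ℕ → ℕ
  allZero []          = 1
  allZero (zero ∷ μ)  = allZero μ
  allZero (suc _ ∷ μ) = 0

  -- Number of 0-1 matrices with row sums μ and column sums as, i.e. the coefficient of x^as in e_μ.
  matrices : List ℕ → List ℕ → ℕ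
  matrices μ []       = allZero μ
  matrices μ (a ∷ as) = choose a μ (λ μ′ → matrices μ′ as)

  choose-cong : ∀ a μ {k k′} →
    (∀ μ′ → length μ′ ≡ length μ → a + sum μ′ ≡ sum μ → k μ′ ≡ k′ μ′) → choose a μ k ≡ choose a μ k′
  choose-cong zero    []          h = h [] refl refl
  choose-cong (suc a) []          h = refl
  choose-cong zero    (x ∷ μ)     h = choose-cong zero μ λ μ′ e e′ → h _ (cong suc e) (cong (x +_) e′)
  choose-cong (suc a) (zero ∷ μ)  h = choose-cong (suc a) μ λ μ′ e e′ → h _ (cong suc e) e′
  choose-cong (suc a) (suc x ∷ μ) h = cong₂ _+_
    (choose-cong (suc a) μ λ μ′ e e′ → h _ (cong suc e) (trans (x∙yz≈y∙xz (suc a) (suc x) _) (cong (suc x +_) e′)))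
    (choose-cong a μ λ μ′ e e′ → h _ (cong suc e) (cong suc (trans (x∙yz≈y∙xz a x _) (cong (x +_) e′))))

  choose-0 : ∀ a μ {k} → (∀ μ′ → length μ′ ≡ length μ → a + sum μ′ ≡ sum μ → k μ′ ≡ 0) → choose a μ k ≡ 0
  choose-0 a μ h = trans (choose-cong a μ h) (go a μ)
    where
    go : ∀ a μ → choose a μ (λ _ → 0) ≡ 0
    go zero    []          = refl
    go (suc a) []          = refl
    go zero    (x ∷ μ)     = go zero μ
    go (suc a) (zero ∷ μ)  = go (suc a) μ
    go (suc a) (suc x ∷ μ) = cong₂ _+_ (go (suc a) μ) (go a μ)

  choose-zero : ∀ μ k → choose 0 μ k ≡ k μ
  choose-zero []      k = refl
  choose-zero (x ∷ μ) k = choose-zero μ (k ∘ (x ∷_))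

  choose-+ : ∀ a μ k k′ → choose a μ (λ ν → k ν + k′ ν) ≡ choose a μ k + choose a μ k′
  choose-+ zero    []          k k′ = refl
  choose-+ (suc a) []          k k′ = refl
  choose-+ zero    (x ∷ μ)     k k′ = choose-+ zero μ _ _
  choose-+ (suc a) (zero ∷ μ)  k k′ = choose-+ (suc a) μ _ _
  choose-+ (suc a) (suc x ∷ μ) k k′ =
    trans (cong₂ _+_ (choose-+ (suc a) μ _ _) (choose-+ a μ _ _))
          (interchange (choose (suc a) μ (k ∘ (suc x ∷_))) _ _ _)

  -- A row with one unit left can serve only one of the two columns, a row with at least two units
  -- can serve both; hence the separate cases.
  choose-swap : ∀ a b μ k → choose a μ (λ ν → choose b ν k) ≡ choose b μ (λ ν → choose a ν k)
  choose-swap zero    zero    μ k = refl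
  choose-swap zero    (suc b) μ k =
    trans (choose-zero μ (λ ν → choose (suc b) ν k)) (sym (choose-cong (suc b) μ λ ν _ _ → choose-zero ν k))
  choose-swap (suc a) zero    μ k =
    trans (choose-cong (suc a) μ λ ν _ _ → choose-zero ν k) (sym (choose-zero μ (λ ν → choose (suc a) ν k)))
  choose-swap (suc a) (suc b) []         k = refl
  choose-swap (suc a) (suc b) (zero ∷ μ) k = choose-swap (suc a) (suc b) μ _
  choose-swap (suc a) (suc b) (suc zero ∷ μ) k = trans
    (cong₂ _+_ (trans (choose-+ (suc a) μ (λ ν → choose (suc b) ν k₁) (λ ν → choose b ν k₀))
                 (cong₂ _+_ (choose-swap (suc a) (suc b) μ k₁) (choose-swap (suc a) b μ k₀)))
               (choose-swap a (suc b) μ k₀))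
    (trans (xy∙z≈xz∙y (choose (suc b) μ (λ ν → choose (suc a) ν k₁)) _ _)
      (cong (_+ choose b μ (λ ν → choose (suc a) ν k₀)) (sym (choose-+ (suc b) μ _ _))))
    where
    k₀ k₁ : List ℕ → ℕ
    k₀ = k ∘ (0 ∷_)
    k₁ = k ∘ (1 ∷_)
  choose-swap (suc a) (suc b) (suc (suc x) ∷ μ) k = trans
    (cong₂ _+_
      (trans (choose-+ (suc a) μ (λ ν → choose (suc b) ν k₂) (λ ν → choose b ν k₁))
        (cong₂ _+_ (choose-swap (suc a) (suc b) μ k₂) (choose-swap (suc a) b μ k₁)))
      (trans (choose-+ a μ (λ ν → choose (suc b) ν k₁) (λ ν → choose b ν k₀))
        (cong₂ _+_ (choose-swap a (suc b) μ k₁) (choose-swap a b μ k₀))))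
    (trans (interchange (choose (suc b) μ (λ ν → choose (suc a) ν k₂)) _ _ _)
      (sym (cong₂ _+_ (choose-+ (suc b) μ _ _) (choose-+ b μ _ _))))
    where
    k₀ k₁ k₂ : List ℕ → ℕ
    k₀ = k ∘ (x ∷_)
    k₁ = k ∘ (suc x ∷_)
    k₂ = k ∘ (suc (suc x) ∷_)

  matrices-↭ : ∀ {as bs} μ → as ↭ bs → matrices μ as ≡ matrices μ bs
  matrices-↭ μ Perm.refl         = refl
  matrices-↭ μ (Perm.prep a p)   = choose-cong a μ λ ν _ _ → matrices-↭ ν p
  matrices-↭ μ (Perm.swap {xs} a b p) = trans (choose-swap a b μ (λ ν → matrices ν xs))
    (choose-cong b μ λ ν _ _ → choose-cong a ν λ ξ _ _ → matrices-↭ ξ p)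
  matrices-↭ μ (Perm.trans p p′) = trans (matrices-↭ μ p) (matrices-↭ μ p′)

  matrices-sum : ∀ μ as → sum as ≢ sum μ → matrices μ as ≡ 0
  matrices-sum []          []       ne = ⊥-elim (ne refl)
  matrices-sum (zero ∷ μ)  []       ne = matrices-sum μ [] ne
  matrices-sum (suc x ∷ μ) []       ne = refl
  matrices-sum μ           (a ∷ as) ne = choose-0 a μ λ ν _ e → matrices-sum ν as λ e′ → ne (trans (cong (a +_) e′) e)

  choose-large : ∀ a μ k → length μ < a → choose a μ k ≡ 0
  choose-large (suc a) []          k lt = refl
  choose-large (suc a) (zero ∷ μ)  k lt = choose-large (suc a) μ _ (<⇒≤ lt)
  choose-large (suc a) (suc x ∷ μ) k (s≤s lt) = cong₂ _+_ (choose-large (suc a) μ _ (<-trans lt (n<1+n a))) (choose-large a μ _ lt)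

  matrices-large : ∀ μ as → Any (length μ <_) as → matrices μ as ≡ 0
  matrices-large μ (a ∷ as) (here lt) = choose-large a μ _ lt
  matrices-large μ (a ∷ as) (there p) = choose-0 a μ λ ν e _ → matrices-large ν as (subst (λ n → Any (n <_) as) (sym e) p)

  -- A row takes at most one unit from each column.
  matrices-row₁ : ∀ i μ as → length as < i → matrices (i ∷ μ) as ≡ 0
  matrices-row₁ (suc i) μ []           lt       = refl
  matrices-row₁ (suc i) μ (zero ∷ as)  lt       = choose-0 0 μ λ ν _ _ → matrices-row₁ (suc i) ν as (<⇒≤ lt)
  matrices-row₁ (suc i) μ (suc a ∷ as) (s≤s lt) = cong₂ _+_
    (choose-0 (suc a) μ λ ν _ _ → matrices-row₁ (suc i) ν as (<-trans lt (n<1+n i)))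
    (choose-0 a μ λ ν _ _ → matrices-row₁ i ν as lt)

  cap₂ : ℕ → ℕ
  cap₂ 0             = 0
  cap₂ 1             = 1
  cap₂ (suc (suc _)) = 2

  -- Two rows together take at most min(a, 2) units from a column of sum a, which is `cap₂ a`.
  matrices-row₂ : ∀ i j μ as → sum (map cap₂ as) < i + j → matrices (i ∷ j ∷ μ) as ≡ 0
  matrices-row₂ zero    (suc j) μ []       lt = refl
  matrices-row₂ (suc i) j       μ []       lt = refl
  matrices-row₂ i       j       μ (0 ∷ as) lt = choose-0 0 μ λ ν _ _ → matrices-row₂ i j ν as lt
  matrices-row₂ zero    (suc j) μ (1 ∷ as) lt = cong₂ _+_
    (choose-0 1 μ λ ν _ _ → matrices-row₂ 0 (suc j) ν as (<⇒≤ lt))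
    (choose-0 0 μ λ ν _ _ → matrices-row₂ 0 j ν as (≤-pred lt))
  matrices-row₂ (suc i) zero    μ (1 ∷ as) lt = cong₂ _+_
    (choose-0 1 μ λ ν _ _ → matrices-row₂ (suc i) 0 ν as (<⇒≤ lt))
    (choose-0 0 μ λ ν _ _ → matrices-row₂ i 0 ν as (≤-pred lt))
  matrices-row₂ (suc i) (suc j) μ (1 ∷ as) lt = cong₂ _+_
    (cong₂ _+_ (choose-0 1 μ λ ν _ _ → matrices-row₂ (suc i) (suc j) ν as (<⇒≤ lt))
               (choose-0 0 μ λ ν _ _ → matrices-row₂ (suc i) j ν as (subst (sum (map cap₂ as) <_) (+-suc i j) (≤-pred lt))))
    (choose-0 0 μ λ ν _ _ → matrices-row₂ i (suc j) ν as (≤-pred lt))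
  matrices-row₂ zero    (suc j) μ (suc (suc a) ∷ as) lt = cong₂ _+_
    (choose-0 (suc (suc a)) μ λ ν _ _ → matrices-row₂ 0 (suc j) ν as (<⇒≤ (<⇒≤ lt)))
    (choose-0 (suc a) μ λ ν _ _ → matrices-row₂ 0 j ν as (<⇒≤ (≤-pred lt)))
  matrices-row₂ (suc i) zero    μ (suc (suc a) ∷ as) lt = cong₂ _+_
    (choose-0 (suc (suc a)) μ λ ν _ _ → matrices-row₂ (suc i) 0 ν as (<⇒≤ (<⇒≤ lt)))
    (choose-0 (suc a) μ λ ν _ _ → matrices-row₂ i 0 ν as (<⇒≤ (≤-pred lt)))
  matrices-row₂ (suc i) (suc j) μ (suc (suc a) ∷ as) lt = cong₂ _+_
    (cong₂ _+_ (choose-0 (suc (suc a)) μ λ ν _ _ → matrices-row₂ (suc i) (suc j) ν as (<⇒≤ (<⇒≤ lt)))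
               (choose-0 (suc a) μ λ ν _ _ → matrices-row₂ (suc i) j ν as (<⇒≤ lt′)))
    (cong₂ _+_ (choose-0 (suc a) μ λ ν _ _ → matrices-row₂ i (suc j) ν as (subst (sum (map cap₂ as) <_) (sym (+-suc i j)) (<⇒≤ lt′)))
               (choose-0 a μ λ ν _ _ → matrices-row₂ i j ν as (≤-pred lt′)))
    where
    lt′ : suc (sum (map cap₂ as)) < suc (i + j)
    lt′ = subst (suc (sum (map cap₂ as)) <_) (+-suc i j) (≤-pred lt)

  matrices-snoc-0 : ∀ μ as → matrices (μ ++ 0 ∷ []) as ≡ matrices μ as
  matrices-snoc-0 μ [] = go μ
    where
    go : ∀ μ → allZero (μ ++ 0 ∷ []) ≡ allZero μ
    go []          = refl
    go (zero ∷ μ)  = go μ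
    go (suc x ∷ μ) = refl
  matrices-snoc-0 μ (a ∷ as) = trans (go a μ (λ ν → matrices ν as)) (choose-cong a μ λ ν _ _ → matrices-snoc-0 ν as)
    where
    go : ∀ a μ k → choose a (μ ++ 0 ∷ []) k ≡ choose a μ (λ ν → k (ν ++ 0 ∷ []))
    go zero    []          k = refl
    go (suc a) []          k = refl
    go zero    (x ∷ μ)     k = go zero μ _
    go (suc a) (zero ∷ μ)  k = go (suc a) μ _
    go (suc a) (suc x ∷ μ) k = cong₂ _+_ (go (suc a) μ _) (go a μ _)

  -- The conjugate of the partition (r+s+t, s+t, t).
  columns : ℕ → ℕ → ℕ → List ℕ
  columns r s t = replicate t 3 ++ replicate s 2 ++ replicate r 1

  -- The columns come in decreasing order, and each must take every row that is still nonzero, so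
  -- the matrix is forced.
  matrices-columns : ∀ r s t → matrices (t + (s + r) ∷ t + s ∷ t ∷ []) (columns r s t) ≡ 1
  matrices-columns r       s       (suc t) = matrices-columns r s t
  matrices-columns r       (suc s) zero    = matrices-columns r s zero
  matrices-columns (suc r) zero    zero    = matrices-columns r zero zero
  matrices-columns zero    zero    zero    = refl

  length-columns : ∀ r s t → length (columns r s t) ≡ t + (s + r)
  length-columns r       s       (suc t) = cong suc (length-columns r s t)
  length-columns r       (suc s) zero    = cong suc (length-columns r s zero)
  length-columns (suc r) zero    zero    = cong suc (length-columns r zero zero)
  length-columns zero    zero    zero    = refl

  cap₂-columns : ∀ r s t → sum (map cap₂ (columns r s t)) ≡ (t + (s + r)) + (t + s)
  cap₂-columns r       s       (suc t) = cong suc (trans (cong suc (cap₂-columns r s t)) (sym (+-suc (t + (s + r)) (t + s))))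
  cap₂-columns r       (suc s) zero    = cong suc (trans (cong suc (cap₂-columns r s zero)) (sym (+-suc (s + r) s)))
  cap₂-columns (suc r) zero    zero    = cong suc (cap₂-columns r zero zero)
  cap₂-columns zero    zero    zero    = refl

  sum-columns : ∀ r s t → sum (columns r s t) ≡ (t + (s + r)) + ((t + s) + t)
  sum-columns r s (suc t) = cong suc (trans (cong (λ n → suc (suc n)) (sum-columns r s t))
    (sym (trans (+-suc (t + (s + r)) _) (cong suc (trans (cong ((t + (s + r)) +_) (+-suc (t + s) t)) (+-suc (t + (s + r)) _))))))
  sum-columns r (suc s) zero = cong suc (trans (cong suc (sum-columns r s zero)) (sym (+-suc (s + r) (s + 0))))
  sum-columns (suc r) zero zero = cong suc (sum-columns r zero zero)
  sum-columns zero zero zero = refl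

open Matrices

-- Pairing with monomial symmetric functions in three variables

module Evaluation (𝒲 : Weights) where
  open Polynomials 𝒲
  open Functionals 𝒲

  ι-+ : ∀ m n → ι (m ℕ.+ n) ≈ ι m + ι n
  ι-+ zero    n = sym (+-identityˡ _)
  ι-+ (suc m) n = trans (+-congˡ (ι-+ m n)) (sym (+-assoc _ _ _))

  ι-1 : ι 1 ≈ 1#
  ι-1 = +-identityʳ 1#

  -- Linearity in the form used later: `L` passes through weighted sums indexed by lists, in
  -- particular through the sum over partitions in the e-expansion.
  record Linear (L : (List ℕ → Carrier) → Carrier) : Set where
    field
      L-cong : ∀ {F G} → (∀ as → F as ≈ G as) → L F ≈ L G
      L-Λ    : ∀ {Λ : (List ℕ → Carrier) → Carrier} → Additive Λ → ∀ (F : List ℕ → List ℕ → Carrier) →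
               L (λ as → Λ (λ j → F j as)) ≈ Λ (λ j → L (F j))

  value : ((List ℕ → Carrier) → Carrier) → (List ℕ → ℕ) → Carrier
  value L f = L (λ as → ι (f as))

  module _ {L} (linear : Linear L) where
    open Linear linear

    value-0 : value L (λ _ → 0) ≈ 0#
    value-0 = L-Λ {λ _ → 0#} (record { Λ-cong = λ _ → refl ; Λ-+ = λ _ _ → sym (+-identityˡ 0#) ; Λ-* = λ x _ → sym (zeroʳ x) }) (λ _ _ → 0#)

    value-+ : ∀ f g → value L (λ as → f as ℕ.+ g as) ≈ value L f + value L g
    value-+ f g = trans (L-cong (λ as → ι-+ (f as) (g as)))
      -- Indices of `Λ` are lists here, so two arbitrary lists label the summands `f` and `g`.
      (L-Λ {λ h → h (0 ∷ []) + h (1 ∷ [])}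
        (record { Λ-cong = λ e → +-cong (e _) (e _)
                ; Λ-+ = λ h h′ → solve 4 (λ a b c d → (a :+ b) :+ (c :+ d) := (a :+ c) :+ (b :+ d)) refl
                                   (h (0 ∷ [])) (h′ (0 ∷ [])) (h (1 ∷ [])) (h′ (1 ∷ []))
                ; Λ-* = λ x h → sym (distribˡ x _ _) })
        F)
      where
      F : List ℕ → List ℕ → Carrier
      F (0 ∷ []) as = ι (f as)
      F _        as = ι (g as)

  evaluate-linear : ∀ as → Linear (λ F → F as)
  evaluate-linear as = record { L-cong = λ e → e as ; L-Λ = λ _ _ → refl }

  prefix-linear : ∀ {L} a → Linear L → Linear (λ F → L (F ∘ (a ∷_)))
  prefix-linear a linear = record
    { L-cong = λ e → Linear.L-cong linear (λ as → e (a ∷ as))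
    ; L-Λ    = λ additive F → Linear.L-Λ linear additive (λ j as → F j (a ∷ as)) }

  H-linear : ∀ N → Linear (H N)
  H-linear N = record { L-cong = H-cong N ; L-Λ = λ additive → H-Λ additive N }

  H₁-linear : ∀ N → Linear (H₁ N)
  H₁-linear N = record { L-cong = H₁-cong N ; L-Λ = λ additive → H₁-Λ additive N }

  H₂-linear : ∀ N → Linear (H₂ N)
  H₂-linear N = record { L-cong = H₂-cong N ; L-Λ = λ additive → H₂-Λ additive N }

  P-linear : ∀ N → Linear (P N)
  P-linear N = record { L-cong = P-cong N ; L-Λ = λ additive → P-Λ additive N }

  M-linear : ∀ N → Linear (M N)
  M-linear N = record { L-cong = M-cong N ; L-Λ = λ additive → M-Λ additive N }

  -- By transposition, `mat i j k` is the functional on ℤ[e₁,e₂,e₃] that extracts the coefficient of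
  -- u^i v^j w^k.
  mat : ℕ → ℕ → ℕ → List ℕ → ℕ
  mat i j k = matrices (i ∷ j ∷ k ∷ [])

  supp : ℕ → ℕ
  supp zero    = 0
  supp (suc _) = 1

  support : ℕ → ℕ → ℕ → ℕ
  support i j k = supp i ℕ.+ (supp j ℕ.+ supp k)

  -- Binomial coefficients of n ≤ 3.
  c₁ c₂ c₃ : ℕ → Carrier
  c₁ 0 = 0#
  c₁ 1 = 1#
  c₁ 2 = 1# + 1#
  c₁ _ = (1# + 1#) + 1#
  c₂ 0 = 0#
  c₂ 1 = 0#
  c₂ 2 = 1#
  c₂ _ = (1# + 1#) + 1#
  c₃ 0 = 0#
  c₃ 1 = 0#
  c₃ 2 = 0#
  c₃ _ = 1#

  private
    δ-at : ∀ N {s t} → s ≡ t → δ N s ≈ δ N t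
    δ-at N e = ≡⇒≈ (cong (δ N) e)

    once : ∀ {x d} → x ≈ d → x ≈ 1# * d
    once e = trans e (sym (*-identityˡ _))

    twice : ∀ {x y d} → x ≈ d → y ≈ d → x + y ≈ (1# + 1#) * d
    twice {d = d} e e′ = trans (+-cong e e′) (solve 1 (λ d → d :+ d := (:1 :+ :1) :* d) refl d)

    thrice : ∀ {x y z d} → x ≈ d → y ≈ d → z ≈ d → (x + y) + z ≈ ((1# + 1#) + 1#) * d
    thrice {d = d} e e′ e″ = trans (+-cong (+-cong e e′) e″) (solve 1 (λ d → (d :+ d) :+ d := ((:1 :+ :1) :+ :1) :* d) refl d)

    none : ∀ {x} d → x ≈ 0# → x ≈ 0# * d
    none d e = trans e (sym (zeroˡ d))

    s-j : ∀ i j k → suc i ℕ.+ (j ℕ.+ k) ≡ i ℕ.+ (suc j ℕ.+ k)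
    s-j i j k = ≡.sym (+-suc i (j ℕ.+ k))

    s-k : ∀ i j k → suc i ℕ.+ (j ℕ.+ k) ≡ i ℕ.+ (j ℕ.+ suc k)
    s-k i j k = ≡.trans (≡.sym (+-suc i (j ℕ.+ k))) (cong (i ℕ.+_) (≡.sym (+-suc j k)))

  -- Every monomial of degree N occurs once in h_N(u,v,w). The lemmas `layer₁` to `layer₃` give the
  -- coefficients in e_r h_{N+1-r}: the r variables contributed by e_r are chosen among those
  -- present in the monomial.
  H-value  : ∀ N i j k → value (H N) (mat i j k) ≈ δ N (i ℕ.+ (j ℕ.+ k))
  H₁-value : ∀ N i j k → value (H₁ N) (mat i j k) ≈ δ N (suc (i ℕ.+ (j ℕ.+ k)))
  H₂-value : ∀ N i j k → value (H₂ N) (mat i j k) ≈ δ N (suc (suc (i ℕ.+ (j ℕ.+ k))))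
  layer₁ : ∀ N i j k → value (H N) (mat i j k ∘ (1 ∷_)) ≈ c₁ (support i j k) * δ (suc N) (i ℕ.+ (j ℕ.+ k))
  layer₂ : ∀ N i j k → value (H₁ N) (mat i j k ∘ (2 ∷_)) ≈ c₂ (support i j k) * δ (suc N) (i ℕ.+ (j ℕ.+ k))
  layer₃ : ∀ N i j k → value (H₂ N) (mat i j k ∘ (3 ∷_)) ≈ c₃ (support i j k) * δ (suc N) (i ℕ.+ (j ℕ.+ k))

  layer₁ N zero    zero    zero    = none _ (value-0 (H-linear N))
  layer₁ N (suc i) zero    zero    = once (H-value N i 0 0)
  layer₁ N zero    (suc j) zero    = once (H-value N 0 j 0)
  layer₁ N zero    zero    (suc k) = once (H-value N 0 0 k)
  layer₁ N (suc i) (suc j) zero    = trans (value-+ (H-linear N) (mat (suc i) j 0) (mat i (suc j) 0))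
    (twice (trans (H-value N (suc i) j 0) (δ-at N (s-j i j 0))) (H-value N i (suc j) 0))
  layer₁ N (suc i) zero    (suc k) = trans (value-+ (H-linear N) (mat (suc i) 0 k) (mat i 0 (suc k)))
    (twice (trans (H-value N (suc i) 0 k) (δ-at N (s-k i 0 k))) (H-value N i 0 (suc k)))
  layer₁ N zero    (suc j) (suc k) = trans (value-+ (H-linear N) (mat 0 (suc j) k) (mat 0 j (suc k)))
    (twice (trans (H-value N 0 (suc j) k) (δ-at N (≡.sym (+-suc j k)))) (H-value N 0 j (suc k)))
  layer₁ N (suc i) (suc j) (suc k) = trans
    (trans (value-+ (H-linear N) (λ as → mat (suc i) (suc j) k as ℕ.+ mat (suc i) j (suc k) as) (mat i (suc j) (suc k)))
      (+-congʳ (value-+ (H-linear N) (mat (suc i) (suc j) k) (mat (suc i) j (suc k)))))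
    (thrice (trans (H-value N (suc i) (suc j) k) (δ-at N (s-k i (suc j) k)))
            (trans (H-value N (suc i) j (suc k)) (δ-at N (s-j i j (suc k))))
            (H-value N i (suc j) (suc k)))

  layer₂ N zero    zero    zero    = none _ (value-0 (H₁-linear N))
  layer₂ N (suc i) zero    zero    = none _ (value-0 (H₁-linear N))
  layer₂ N zero    (suc j) zero    = none _ (value-0 (H₁-linear N))
  layer₂ N zero    zero    (suc k) = none _ (value-0 (H₁-linear N))
  layer₂ N (suc i) (suc j) zero    = once (trans (H₁-value N i j 0) (δ-at N (s-j i j 0)))
  layer₂ N (suc i) zero    (suc k) = once (trans (H₁-value N i 0 k) (δ-at N (s-k i 0 k)))
  layer₂ N zero    (suc j) (suc k) = once (trans (H₁-value N 0 j k) (δ-at N (≡.sym (+-suc j k))))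
  layer₂ N (suc i) (suc j) (suc k) = trans
    (trans (value-+ (H₁-linear N) (mat (suc i) j k) (λ as → mat i (suc j) k as ℕ.+ mat i j (suc k) as))
      (trans (+-congˡ (value-+ (H₁-linear N) (mat i (suc j) k) (mat i j (suc k)))) (sym (+-assoc _ _ _))))
    (thrice (trans (H₁-value N (suc i) j k) (δ-at N (≡.trans (cong suc (s-j i j k)) (s-k i (suc j) k))))
            (trans (H₁-value N i (suc j) k) (δ-at N (s-k i (suc j) k)))
            (trans (H₁-value N i j (suc k)) (δ-at N (s-j i j (suc k)))))

  layer₃ N zero    zero    zero    = none _ (value-0 (H₂-linear N))
  layer₃ N (suc i) zero    zero    = none _ (value-0 (H₂-linear N))
  layer₃ N zero    (suc j) zero    = none _ (value-0 (H₂-linear N))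
  layer₃ N zero    zero    (suc k) = none _ (value-0 (H₂-linear N))
  layer₃ N (suc i) (suc j) zero    = none _ (value-0 (H₂-linear N))
  layer₃ N (suc i) zero    (suc k) = none _ (value-0 (H₂-linear N))
  layer₃ N zero    (suc j) (suc k) = none _ (value-0 (H₂-linear N))
  layer₃ N (suc i) (suc j) (suc k) = once (trans (H₂-value N i j k) (δ-at N (≡.trans (cong suc (s-j i j k)) (s-k i (suc j) k))))

  private
    positive-support : ∀ n d → 1 ≤ n → (c₁ n * d - c₂ n * d) + c₃ n * d ≈ d
    positive-support 1 d _ = solve 1 (λ d → (:1 :* d :- :0 :* d) :+ :0 :* d := d) refl d
    positive-support 2 d _ = solve 1 (λ d → ((:1 :+ :1) :* d :- :1 :* d) :+ :0 :* d := d) refl d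
    positive-support (suc (suc (suc _))) d _ =
      solve 1 (λ d → (((:1 :+ :1) :+ :1) :* d :- ((:1 :+ :1) :+ :1) :* d) :+ :1 :* d := d) refl d

    H-value-step : ∀ N i j k → (c₁ (support i j k) * δ (suc N) (i ℕ.+ (j ℕ.+ k)) - c₂ (support i j k) * δ (suc N) (i ℕ.+ (j ℕ.+ k)))
                   + c₃ (support i j k) * δ (suc N) (i ℕ.+ (j ℕ.+ k)) ≈ δ (suc N) (i ℕ.+ (j ℕ.+ k))
    H-value-step N zero    zero    zero    = solve 0 ((:0 :* :0 :- :0 :* :0) :+ :0 :* :0 := :0) refl
    H-value-step N zero    zero    (suc k) = positive-support 1 _ (s≤s z≤n)
    H-value-step N zero    (suc j) k       = positive-support (suc (supp k)) _ (s≤s z≤n)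
    H-value-step N (suc i) j       k       = positive-support (suc (supp j ℕ.+ supp k)) _ (s≤s z≤n)

  H-value zero zero    zero    zero    = ι-1
  H-value zero zero    zero    (suc k) = refl
  H-value zero zero    (suc j) k       = refl
  H-value zero (suc i) j       k       = refl
  H-value (suc N) i j k = trans (+-cong (+-cong (layer₁ N i j k) (-‿cong (layer₂ N i j k))) (layer₃ N i j k)) (H-value-step N i j k)
  H₁-value zero    i j k = refl
  H₁-value (suc N) i j k = H-value N i j k
  H₂-value zero    i j k = refl
  H₂-value (suc N) i j k = H₁-value N i j k

  single : ℕ → Carrier
  single 1 = 1#
  single _ = 0#

  -- A power sum contains only pure powers: for n variables present, n - 2 C(n,2) + 3 C(n,3) is 1
  -- for n = 1 and 0 for n = 0, 2, 3.
  P-value : ∀ N i j k → value (P N) (mat i j k) ≈ single (support i j k) * δ (suc N) (i ℕ.+ (j ℕ.+ k))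
  P-value N i j k = trans (+-cong (+-cong (layer₁ N i j k) (-‿cong (*-congˡ (layer₂ N i j k)))) (*-congˡ (layer₃ N i j k)))
    (step (support i j k) _ (ℕₚ.+-mono-≤ (supp≤1 i) (ℕₚ.+-mono-≤ (supp≤1 j) (supp≤1 k))))
    where
    supp≤1 : ∀ n → supp n ≤ 1
    supp≤1 zero    = z≤n
    supp≤1 (suc n) = s≤s z≤n
    step : ∀ n d → n ≤ 3 → (c₁ n * d - (1# + 1#) * (c₂ n * d)) + (1# + (1# + 1#)) * (c₃ n * d) ≈ single n * d
    step 0 d _ = solve 1 (λ d → (:0 :* d :- (:1 :+ :1) :* (:0 :* d)) :+ (:1 :+ (:1 :+ :1)) :* (:0 :* d) := :0 :* d) refl d
    step 1 d _ = solve 1 (λ d → (:1 :* d :- (:1 :+ :1) :* (:0 :* d)) :+ (:1 :+ (:1 :+ :1)) :* (:0 :* d) := :1 :* d) refl d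
    step 2 d _ = solve 1 (λ d → ((:1 :+ :1) :* d :- (:1 :+ :1) :* (:1 :* d)) :+ (:1 :+ (:1 :+ :1)) :* (:0 :* d) := :0 :* d) refl d
    step 3 d _ = solve 1 (λ d → (((:1 :+ :1) :+ :1) :* d :- (:1 :+ :1) :* (((:1 :+ :1) :+ :1) :* d)) :+ (:1 :+ (:1 :+ :1)) :* (:1 :* d) := :0 :* d) refl d
    step (suc (suc (suc (suc _)))) d (s≤s (s≤s (s≤s ())))

  -- L is the coordinate functional of m_μ among the monomial symmetric functions in three variables.
  record Selects (L : (List ℕ → Carrier) → Carrier) (μ : List ℕ) : Set where
    field
      linear : Linear L
      hit    : ∀ {i j k} → k ≤ j → j ≤ i → i ∷ j ∷ k ∷ [] ≡ μ → value L (mat i j k) ≈ 1#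
      miss   : ∀ {i j k} → k ≤ j → j ≤ i → i ∷ j ∷ k ∷ [] ≢ μ → value L (mat i j k) ≈ 0#

  -- e₁ and e₂ are themselves monomial symmetric functions, m_(1) and m_(1,1).
  selects-e₁ : Selects (λ F → F (1 ∷ [])) (1 ∷ 0 ∷ 0 ∷ [])
  selects-e₁ = record { linear = evaluate-linear _ ; hit = λ { _ _ ≡.refl → ι-1 } ; miss = λ {i} {j} {k} → miss i j k }
    where
    miss : ∀ i j k → k ≤ j → j ≤ i → i ∷ j ∷ k ∷ [] ≢ 1 ∷ 0 ∷ 0 ∷ [] → ι (mat i j k (1 ∷ [])) ≈ 0#
    miss zero          zero    zero    _ _ ne = refl
    miss 1             zero    zero    _ _ ne = ⊥-elim (ne ≡.refl)
    miss 1             (suc j) k       _ _ ne = ≡⇒≈ (cong ι (matrices-sum (1 ∷ suc j ∷ k ∷ []) (1 ∷ []) λ ()))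
    miss (suc (suc i)) j       k       _ _ ne = ≡⇒≈ (cong ι (matrices-sum (suc (suc i) ∷ j ∷ k ∷ []) (1 ∷ []) λ ()))

  selects-e₂ : Selects (λ F → F (2 ∷ [])) (1 ∷ 1 ∷ 0 ∷ [])
  selects-e₂ = record { linear = evaluate-linear _ ; hit = λ { _ _ ≡.refl → ι-1 } ; miss = λ {i} {j} {k} → miss i j k }
    where
    miss : ∀ i j k → k ≤ j → j ≤ i → i ∷ j ∷ k ∷ [] ≢ 1 ∷ 1 ∷ 0 ∷ [] → ι (mat i j k (2 ∷ [])) ≈ 0#
    miss zero          zero          zero    _ _ ne = refl
    miss 1             zero          zero    _ _ ne = refl
    miss 1             1             zero    _ _ ne = ⊥-elim (ne ≡.refl)
    miss 1             1             (suc k) _ _ ne = ≡⇒≈ (cong ι (matrices-sum (1 ∷ 1 ∷ suc k ∷ []) (2 ∷ []) λ ()))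
    miss 1             (suc (suc j)) k       _ (s≤s ()) ne
    miss (suc (suc i)) j             k       _ _ ne = ≡⇒≈ (cong ι (matrices-row₁ (suc (suc i)) (j ∷ k ∷ []) (2 ∷ []) (s≤s (s≤s z≤n))))

  selects-M : ∀ N → Selects (M N) (suc (suc N) ∷ 1 ∷ 0 ∷ [])
  selects-M N = record
    { linear = M-linear N
    ; hit    = λ { _ _ ≡.refl → trans (hook N) (trans (δ-at N (ℕₚ.+-identityʳ N)) (δ-refl N)) }
    ; miss   = λ {i} {j} {k} → miss i j k }
    where
    not-single : ∀ i j k {d} → 2 ≤ support i j k → single (support i j k) * d ≈ 0#
    not-single i j k 2≤ = trans (*-congʳ (≡⇒≈ (go (support i j k) 2≤))) (zeroˡ _)
      where
      go : ∀ n → 2 ≤ n → single n ≡ 0#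
      go (suc (suc n)) _         = ≡.refl
      go (suc zero)    (s≤s ())

    vanish : ∀ i j k → 2 ≤ support i j k → ∀ N → value (P N) (mat i j k) ≈ 0#
    vanish i j k 2≤ N = trans (P-value N i j k) (not-single i j k 2≤)

    -- In p_{N+2} e₁ the monomial u^(i+2) v arises only with v taken from e₁, and p_{N+3} has no
    -- mixed monomials.
    hook : ∀ i → value (M N) (mat (suc (suc i)) 1 0) ≈ δ N (i ℕ.+ 0)
    hook i = trans
      (+-cong (trans (value-+ (P-linear (suc N)) (mat (suc (suc i)) 0 0) (mat (suc i) 1 0))
                (+-cong (trans (P-value (suc N) (suc (suc i)) 0 0) (*-identityˡ _)) (vanish (suc i) 1 0 (s≤s (s≤s z≤n)) (suc N))))
              (-‿cong (vanish (suc (suc i)) 1 0 (s≤s (s≤s z≤n)) (suc (suc N)))))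
      (solve 1 (λ d → (d :+ :0) :- :0 := d) refl _)

    2≤-ik : ∀ j → 2 ≤ 1 ℕ.+ (j ℕ.+ 1)
    2≤-ik j = s≤s (m≤n+m 1 j)

    miss : ∀ i j k → k ≤ j → j ≤ i → i ∷ j ∷ k ∷ [] ≢ suc (suc N) ∷ 1 ∷ 0 ∷ [] → value (M N) (mat i j k) ≈ 0#
    miss zero zero zero _ _ ne = trans (+-cong (value-0 (P-linear (suc N))) (-‿cong (trans (P-value (suc (suc N)) 0 0 0) (zeroˡ _))))
      (solve 0 (:0 :- :0 := :0) refl)
    miss 1 zero zero _ _ ne = trans (+-cong (trans (P-value (suc N) 0 0 0) (zeroˡ _)) (-‿cong (trans (P-value (suc (suc N)) 1 0 0) (zeroʳ _))))
      (solve 0 (:0 :- :0 := :0) refl)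
    -- The pure powers in p_{N+2} e₁ cancel against p_{N+3}.
    miss (suc (suc i)) zero zero _ _ ne = trans
      (+-cong (P-value (suc N) (suc i) 0 0) (-‿cong (P-value (suc (suc N)) (suc (suc i)) 0 0))) (-‿inverseʳ _)
    miss 1 1 zero _ _ ne = trans
      (+-cong (trans (value-+ (P-linear (suc N)) (mat 1 0 0) (mat 0 1 0))
                (+-cong (trans (P-value (suc N) 1 0 0) (zeroʳ _)) (trans (P-value (suc N) 0 1 0) (zeroʳ _))))
              (-‿cong (vanish 1 1 0 (s≤s (s≤s z≤n)) (suc (suc N)))))
      (solve 0 ((:0 :+ :0) :- :0 := :0) refl)
    miss (suc (suc i)) 1 zero _ _ ne = trans (hook i)
      (δ-≢ N (i ℕ.+ 0) λ e → ne (cong (λ n → suc (suc n) ∷ 1 ∷ 0 ∷ []) (≡.trans (≡.sym (ℕₚ.+-identityʳ i)) e)))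
    miss 1 (suc (suc j)) zero _ (s≤s ()) ne
    miss (suc (suc i)) (suc (suc j)) zero _ _ ne = trans
      (+-cong (trans (value-+ (P-linear (suc N)) (mat (suc (suc i)) (suc j) 0) (mat (suc i) (suc (suc j)) 0))
                (+-cong (vanish (suc (suc i)) (suc j) 0 2≤ (suc N)) (vanish (suc i) (suc (suc j)) 0 2≤ (suc N))))
              (-‿cong (vanish (suc (suc i)) (suc (suc j)) 0 2≤ (suc (suc N)))))
      (solve 0 ((:0 :+ :0) :- :0 := :0) refl)
      where
      2≤ : 2 ≤ 2
      2≤ = s≤s (s≤s z≤n)
    miss (suc i) (suc j) (suc k) _ _ ne = trans
      (+-cong (trans
          (trans (value-+ (P-linear (suc N)) (λ as → mat (suc i) (suc j) k as ℕ.+ mat (suc i) j (suc k) as) (mat i (suc j) (suc k)))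
            (+-congʳ (value-+ (P-linear (suc N)) (mat (suc i) (suc j) k) (mat (suc i) j (suc k)))))
          (+-cong (+-cong (vanish (suc i) (suc j) k (s≤s (s≤s z≤n)) (suc N))
                          (vanish (suc i) j (suc k) (2≤-ik (supp j)) (suc N)))
                  (vanish i (suc j) (suc k) (m≤n+m 2 (supp i)) (suc N))))
        (-‿cong (vanish (suc i) (suc j) (suc k) (s≤s (s≤s z≤n)) (suc (suc N)))))
      (solve 0 (((:0 :+ :0) :+ :0) :- :0 := :0) refl)

  -- Multiplication by e₃ = uvw raises all three exponents by one and leaves no monomial with a zero
  -- exponent.
  selects-e₃ : ∀ {L i j k} → Selects L (i ∷ j ∷ k ∷ []) → Selects (λ F → L (F ∘ (3 ∷_))) (suc i ∷ suc j ∷ suc k ∷ [])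
  selects-e₃ {L} {i} {j} {k} S = record
    { linear = prefix-linear 3 (Selects.linear S)
    ; hit    = λ { (s≤s p) (s≤s p′) ≡.refl → Selects.hit S p p′ ≡.refl }
    ; miss   = λ {a} {b} {c} → miss a b c }
    where
    miss : ∀ a b c → c ≤ b → b ≤ a → a ∷ b ∷ c ∷ [] ≢ suc i ∷ suc j ∷ suc k ∷ [] → value (λ F → L (F ∘ (3 ∷_))) (mat a b c) ≈ 0#
    miss zero    zero    zero    _ _ _ = value-0 (Selects.linear S)
    miss (suc a) zero    zero    _ _ _ = value-0 (Selects.linear S)
    miss (suc a) (suc b) zero    _ _ _ = value-0 (Selects.linear S)
    miss (suc a) (suc b) (suc c) (s≤s p) (s≤s p′) ne = Selects.miss S p p′ λ { ≡.refl → ne ≡.refl }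

  selects-e₃^ : ∀ l {L i j k} → Selects L (i ∷ j ∷ k ∷ []) →
                Selects (λ F → L (λ as → F (replicate l 3 ++ as))) (l ℕ.+ i ∷ l ℕ.+ j ∷ l ℕ.+ k ∷ [])
  selects-e₃^ zero    S = S
  selects-e₃^ (suc l) S = selects-e₃ (selects-e₃^ l S)

-- Partitions, conjugates and unitriangularity

module PartitionLists where
  open import Data.Nat using (_+_; _<_)
  open import Data.Nat.Properties
  open import Relation.Binary.PropositionalEquality

  infix 4 _⋖_

  -- Lexicographic order by the first differing part. Prefixes stay incomparable, as distinct
  -- partitions of one number are never prefixes of each other.
  data _⋖_ : List ℕ → List ℕ → Set where
    here  : ∀ {r s p t} → r < s → r ∷ p ⋖ s ∷ t
    there : ∀ {r p t} → p ⋖ t → r ∷ p ⋖ r ∷ t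

  ⋖-irrefl : ∀ {p t} → p ⋖ t → t ≢ p
  ⋖-irrefl (here r<s) refl = <-irrefl refl r<s
  ⋖-irrefl (there l)  refl = ⋖-irrefl l refl

  data Partition (m : ℕ) : List ℕ → Set where
    []  : Partition m []
    add : ∀ {r p} → 1 ≤ r → r ≤ m → Partition r p → Partition m (r ∷ p)

  filterB-All : ∀ {A : Set} {P : A → Set} (p : A → Bool) xs → All P xs → All P (filterB p xs)
  filterB-All p []       []         = []
  filterB-All p (x ∷ xs) (px ∷ pxs) with p x
  ... | true  = px ∷ filterB-All p xs pxs
  ... | false = filterB-All p xs pxs

  filterB-holds : ∀ {A : Set} (p : A → Bool) xs → All (λ x → p x ≡ true) (filterB p xs)
  filterB-holds p []       = []
  filterB-holds p (x ∷ xs) with p x in e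
  ... | true  = e ∷ filterB-holds p xs
  ... | false = filterB-holds p xs

  filterB-AllPairs : ∀ {A : Set} {R : A → A → Set} (p : A → Bool) xs → AllPairs R xs → AllPairs R (filterB p xs)
  filterB-AllPairs p []       []         = []
  filterB-AllPairs p (x ∷ xs) (rx ∷ rxs) with p x
  ... | true  = filterB-All p xs rx ∷ filterB-AllPairs p xs rxs
  ... | false = filterB-AllPairs p xs rxs

  ∈-filterB : ∀ {A : Set} (p : A → Bool) {x} xs → x ∈ xs → p x ≡ true → x ∈ filterB p xs
  ∈-filterB p (x ∷ xs) (here refl) e rewrite e = here refl
  ∈-filterB p (y ∷ xs) (there x∈)  e with p y
  ... | true  = there (∈-filterB p xs x∈ e)
  ... | false = ∈-filterB p xs x∈ e

  -- First parts are tried in increasing order. This yields both the distinctness of the listed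
  -- partitions and the triangularity of the linear system.
  partsLE-increasing : ∀ fuel m k → AllPairs _⋖_ (partsLE fuel m k)
  partsLE-increasing fuel       m zero    = [] ∷ []
  partsLE-increasing zero       m (suc k) = []
  partsLE-increasing (suc fuel) m (suc k) = AllPairsₚ.concat⁺
    (Allₚ.map⁺ (All.universal (λ r → AllPairsₚ.map⁺ (AllPairs.map there (partsLE-increasing fuel r (suc k ∸ r)))) _))
    (AllPairsₚ.map⁺ (AllPairs.map
      (λ {r} {s} r<s → Allₚ.map⁺ (All.universal (λ _ → Allₚ.map⁺ (All.universal (λ _ → here r<s) _)) _))
      (filterB-AllPairs (_≤ᵇ m) (map suc (upTo (suc k))) (AllPairsₚ.map⁺ (AllPairsₚ.applyUpTo⁺₁ _ (suc k) (λ i<j _ → s≤s i<j))))))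

  partsLE-partitions : ∀ fuel m k → All (λ μ → Partition m μ × sum μ ≡ k) (partsLE fuel m k)
  partsLE-partitions fuel       m zero    = ([] , refl) ∷ []
  partsLE-partitions zero       m (suc k) = []
  partsLE-partitions (suc fuel) m (suc k) = Allₚ.concat⁺ (Allₚ.map⁺ (All.zipWith
    (λ {r} (e , (1≤r , r≤k)) → Allₚ.map⁺ (All.map
      (λ (P , s) → add 1≤r (≤ᵇ⇒≤ r m (Equivalence.from T-≡ e)) P , trans (cong (r +_) s) (m+[n∸m]≡n r≤k))
      (partsLE-partitions fuel r (suc k ∸ r))))
    (filterB-holds (_≤ᵇ m) rs , filterB-All {P = λ r → 1 ≤ r × r ≤ suc k} (_≤ᵇ m) rs (Allₚ.map⁺ {f = suc} (Allₚ.applyUpTo⁺₁ _ (suc k) (λ i<k → s≤s z≤n , i<k))))))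
    where
    rs : List ℕ
    rs = map suc (upTo (suc k))

  ∈-partsLE : ∀ fuel {m k μ} → Partition m μ → sum μ ≡ k → k ≤ fuel → μ ∈ partsLE fuel m k
  ∈-partsLE fuel [] refl _ = here refl
  ∈-partsLE (suc fuel) {m} {suc k} (add {suc r} {p} _ r≤m P) e (s≤s k≤f) =
    ∈-concatMap⁺ _ (lose
      (∈-filterB (_≤ᵇ m) (map suc (upTo (suc k))) (∈-map⁺ suc (∈-upTo⁺ (s≤s r≤k))) (Equivalence.to T-≡ (≤⇒≤ᵇ r≤m)))
      (∈-map⁺ (suc r ∷_) (∈-partsLE fuel P sum-p (≤-trans (m∸n≤m k r) k≤f))))
    where
    e′ : r + sum p ≡ k
    e′ = suc-injective e
    r≤k : r ≤ k
    r≤k = subst (r ≤_) e′ (m≤m+n r (sum p))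
    sum-p : sum p ≡ k ∸ r
    sum-p = trans (sym (m+n∸m≡n r (sum p))) (cong (_∸ r) e′)

  Short : List ℕ → Set
  Short μ = length μ ≤ 3

  pad₃ : List ℕ → List ℕ
  pad₃ []              = 0 ∷ 0 ∷ 0 ∷ []
  pad₃ (i ∷ [])         = i ∷ 0 ∷ 0 ∷ []
  pad₃ (i ∷ j ∷ [])     = i ∷ j ∷ 0 ∷ []
  pad₃ (i ∷ j ∷ k ∷ _)  = i ∷ j ∷ k ∷ []

  matrices-pad₃ : ∀ μ as → Short μ → matrices (pad₃ μ) as ≡ matrices μ as
  matrices-pad₃ []               as s = trans (matrices-snoc-0 (0 ∷ 0 ∷ []) as) (trans (matrices-snoc-0 (0 ∷ []) as) (matrices-snoc-0 [] as))
  matrices-pad₃ (i ∷ [])         as s = trans (matrices-snoc-0 (i ∷ 0 ∷ []) as) (matrices-snoc-0 (i ∷ []) as)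
  matrices-pad₃ (i ∷ j ∷ [])     as s = matrices-snoc-0 (i ∷ j ∷ []) as
  matrices-pad₃ (i ∷ j ∷ k ∷ []) as s = refl
  matrices-pad₃ (_ ∷ _ ∷ _ ∷ _ ∷ _) as (s≤s (s≤s (s≤s ())))

  -- Correct for at most three parts only; further parts are ignored.
  conjugate : List ℕ → List ℕ
  conjugate []              = []
  conjugate (i ∷ [])         = columns i 0 0
  conjugate (i ∷ j ∷ [])     = columns (i ∸ j) j 0
  conjugate (i ∷ j ∷ k ∷ _)  = columns (i ∸ j) (j ∸ k) k

  private
    peel₁ : ∀ {i j k} → k ≤ j → j ≤ i → k + ((j ∸ k) + (i ∸ j)) ≡ i
    peel₁ {i} {j} {k} k≤j j≤i = trans (sym (+-assoc k _ _)) (trans (cong (_+ (i ∸ j)) (m+[n∸m]≡n k≤j)) (m+[n∸m]≡n j≤i))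

  matrices-conjugate : ∀ {m} μ → Partition m μ → Short μ → matrices μ (conjugate μ) ≡ 1
  matrices-conjugate []         P s = refl
  matrices-conjugate (i ∷ [])   P s = trans (sym (matrices-pad₃ (i ∷ []) (conjugate (i ∷ [])) s)) (matrices-columns i 0 0)
  matrices-conjugate (i ∷ j ∷ []) (add _ _ (add _ j≤i _)) s =
    trans (sym (matrices-pad₃ (i ∷ j ∷ []) (conjugate (i ∷ j ∷ [])) s))
      (subst (λ n → matrices (n ∷ j ∷ 0 ∷ []) (columns (i ∸ j) j 0) ≡ 1) (m+[n∸m]≡n j≤i) (matrices-columns (i ∸ j) j 0))
  matrices-conjugate (i ∷ j ∷ k ∷ []) (add _ _ (add _ j≤i (add _ k≤j _))) s =
    ≡.subst₂ (λ n n′ → matrices (n ∷ n′ ∷ k ∷ []) (columns (i ∸ j) (j ∸ k) k) ≡ 1)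
      (peel₁ k≤j j≤i) (m+[n∸m]≡n k≤j) (matrices-columns (i ∸ j) (j ∸ k) k)
  matrices-conjugate (_ ∷ _ ∷ _ ∷ _ ∷ _) P (s≤s (s≤s (s≤s ())))

  length-conjugate : ∀ {m} i μ → Partition m (i ∷ μ) → length (conjugate (i ∷ μ)) ≡ i
  length-conjugate i []          P = length-columns i 0 0
  length-conjugate i (j ∷ [])    (add _ _ (add _ j≤i _)) = trans (length-columns (i ∸ j) j 0) (m+[n∸m]≡n j≤i)
  length-conjugate i (j ∷ k ∷ μ) (add _ _ (add _ j≤i (add _ k≤j _))) = trans (length-columns (i ∸ j) (j ∸ k) k) (peel₁ k≤j j≤i)

  cap₂-conjugate : ∀ {m} i j μ → Partition m (i ∷ j ∷ μ) → sum (map cap₂ (conjugate (i ∷ j ∷ μ))) ≡ i + j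
  cap₂-conjugate i j []      (add _ _ (add _ j≤i _)) = trans (cap₂-columns (i ∸ j) j 0) (cong (_+ j) (m+[n∸m]≡n j≤i))
  cap₂-conjugate i j (k ∷ μ) (add _ _ (add _ j≤i (add _ k≤j _))) =
    trans (cap₂-columns (i ∸ j) (j ∸ k) k) (cong₂ _+_ (peel₁ k≤j j≤i) (m+[n∸m]≡n k≤j))

  -- A larger first part of `ν` exceeds the number i of columns; a larger second part exceeds the
  -- capacity i + j that the columns offer to two rows; equal sums exclude a first difference in the
  -- third part.
  matrices-triangular : ∀ {m μ ν} → Partition m μ → Short μ → Short ν → sum μ ≡ sum ν → μ ⋖ ν →
                        matrices ν (conjugate μ) ≡ 0
  matrices-triangular {μ = i ∷ μ} {ν = i′ ∷ ν} P _ _ _ (here i<i′) =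
    matrices-row₁ i′ ν (conjugate (i ∷ μ)) (subst (_< i′) (sym (length-conjugate i μ P)) i<i′)
  matrices-triangular {μ = i ∷ j ∷ μ} {ν = i ∷ j′ ∷ ν} P _ _ _ (there (here j<j′)) =
    matrices-row₂ i j′ ν (conjugate (i ∷ j ∷ μ)) (subst (_< i + j′) (sym (cap₂-conjugate i j μ P)) (+-monoʳ-< i j<j′))
  matrices-triangular {μ = i ∷ j ∷ k ∷ []} {ν = i ∷ j ∷ k′ ∷ []} P _ _ e (there (there (here k<k′))) =
    ⊥-elim (<-irrefl (+-cancelʳ-≡ 0 k k′ (+-cancelˡ-≡ j _ _ (+-cancelˡ-≡ i _ _ e))) k<k′)
  matrices-triangular {μ = _ ∷ _ ∷ _ ∷ []} {ν = _ ∷ _ ∷ _ ∷ _ ∷ _} P _ (s≤s (s≤s (s≤s ()))) e (there (there (here _)))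
  matrices-triangular {μ = _ ∷ _ ∷ _ ∷ _ ∷ _} P (s≤s (s≤s (s≤s ()))) _ e (there (there (here _)))
  matrices-triangular {μ = _ ∷ _ ∷ _ ∷ _ ∷ _} P (s≤s (s≤s (s≤s ()))) _ e (there (there (there _)))

open PartitionLists

-- The partition whose conjugate has t parts 3, s parts 2 and r parts 1.
rowsOf : ℕ → ℕ → ℕ → List ℕ
rowsOf r       s       (suc t) = suc t ℕ.+ (s ℕ.+ r) ∷ suc t ℕ.+ s ∷ suc t ∷ []
rowsOf r       (suc s) zero    = suc s ℕ.+ r ∷ suc s ∷ []
rowsOf (suc r) zero    zero    = suc r ∷ []
rowsOf zero    zero    zero    = []

rowsOf-short : ∀ r s t → Short (rowsOf r s t)
rowsOf-short zero    zero    zero    = z≤n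
rowsOf-short (suc r) zero    zero    = s≤s z≤n
rowsOf-short r       (suc s) zero    = s≤s (s≤s z≤n)
rowsOf-short r       s       (suc t) = s≤s (s≤s (s≤s z≤n))

rowsOf-sum : ∀ r s t → sum (rowsOf r s t) ≡ sum (columns r s t)
rowsOf-sum zero    zero    zero    = ≡.refl
rowsOf-sum (suc r) zero    zero    = ≡.sym (sum-columns (suc r) 0 0)
rowsOf-sum r       (suc s) zero    = ≡.sym (sum-columns r (suc s) 0)
rowsOf-sum r       s       (suc t) = ≡.trans
  (cong (λ n → (suc t ℕ.+ (s ℕ.+ r)) ℕ.+ ((suc t ℕ.+ s) ℕ.+ n)) (ℕₚ.+-identityʳ (suc t))) (≡.sym (sum-columns r s (suc t)))

rowsOf-partition : ∀ r s t {n} → sum (rowsOf r s t) ≡ n → Partition n (rowsOf r s t)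
rowsOf-partition zero    zero    zero    e = []
rowsOf-partition (suc r) zero    zero    ≡.refl = add (s≤s z≤n) (m≤m+n _ _) []
rowsOf-partition r       (suc s) zero    ≡.refl = add (s≤s z≤n) (m≤m+n _ _) (add (s≤s z≤n) (m≤m+n _ _) [])
rowsOf-partition r       s       (suc t) ≡.refl = add (s≤s z≤n) (m≤m+n _ _)
  (add (s≤s z≤n) (ℕₚ.+-monoʳ-≤ (suc t) (m≤m+n s r)) (add (s≤s z≤n) (m≤m+n _ _) []))

rowsOf-conjugate : ∀ r s t → conjugate (rowsOf r s t) ≡ columns r s t
rowsOf-conjugate zero    zero    zero    = ≡.refl
rowsOf-conjugate (suc r) zero    zero    = ≡.refl
rowsOf-conjugate r       (suc s) zero    = cong (λ n → columns n (suc s) 0) (m+n∸m≡n s r)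
rowsOf-conjugate r       s       (suc t) = cong₂ (λ m n → columns m n (suc t))
  (≡.trans (ℕₚ.[m+n]∸[m+o]≡n∸o t (s ℕ.+ r) s) (m+n∸m≡n s r)) (m+n∸m≡n t s)

insert : ∀ {X : Set} {v : X} xs {ys zs} → v ∷ ys ↭ zs → v ∷ xs ++ ys ↭ xs ++ zs
insert {v = v} xs {ys} p = Perm.trans (Perm.↭-sym (shift v xs ys)) (++⁺ˡ xs p)

-- Up to rearrangement and zeros, exponents at most 3 form the conjugate of a partition with at most
-- three parts; symmetry thus reduces all coefficients of `X` to these.
columns-form : ∀ as → All (ℕ._≤ 3) as → ∃ λ z → ∃ λ r → ∃ λ s → ∃ λ t → as ↭ replicate z 0 ++ columns r s t
columns-form []       []       = 0 , 0 , 0 , 0 , Perm.refl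
columns-form (a ∷ as) (p ∷ ps) with columns-form as ps
columns-form (0 ∷ as) _ | z , r , s , t , e = suc z , r , s , t , Perm.prep 0 e
columns-form (1 ∷ as) _ | z , r , s , t , e = z , suc r , s , t ,
  Perm.trans (Perm.prep 1 e) (insert (replicate z 0) (insert (replicate t 3) (insert (replicate s 2) Perm.refl)))
columns-form (2 ∷ as) _ | z , r , s , t , e = z , r , suc s , t ,
  Perm.trans (Perm.prep 2 e) (insert (replicate z 0) (insert (replicate t 3) Perm.refl))
columns-form (3 ∷ as) _ | z , r , s , t , e = z , r , s , suc t ,
  Perm.trans (Perm.prep 3 e) (insert (replicate z 0) Perm.refl)
columns-form (suc (suc (suc (suc a))) ∷ as) (s≤s (s≤s (s≤s ())) ∷ _) | _

dropZeros-pad₃ : ∀ {m} μ → Partition m μ → Short μ → dropZeros (pad₃ μ) ≡ μ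
dropZeros-pad₃ []                  P s = ≡.refl
dropZeros-pad₃ (suc i ∷ [])         P s = ≡.refl
dropZeros-pad₃ (suc i ∷ suc j ∷ []) P s = ≡.refl
dropZeros-pad₃ (suc i ∷ suc j ∷ suc k ∷ []) P s = ≡.refl
dropZeros-pad₃ (zero ∷ _)               (add () _ _) s
dropZeros-pad₃ (suc i ∷ zero ∷ _)       (add _ _ (add () _ _)) s
dropZeros-pad₃ (suc i ∷ suc j ∷ zero ∷ _) (add _ _ (add _ _ (add () _ _))) s
dropZeros-pad₃ (suc i ∷ suc j ∷ suc k ∷ _ ∷ _) P (s≤s (s≤s (s≤s ())))

-- Expansion in elementary symmetric functions

module Expansion (𝒲 : Weights) (𝒪 : IntervalOrder) where
  open Polynomials 𝒲
  open Splittings 𝒲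
  open Chromatic 𝒲 𝒪
  open IntervalOrder 𝒪 using (V)
  open Symmetry 𝒲 𝒪
  open Functionals 𝒲
  open ChainLayers 𝒲 𝒪
  open Evaluation 𝒲

  module _ {Y : Set} where
    ΣL-select : ∀ (xs : List Y) {τ f} → AllPairs (λ x y → y ≢ x) xs → τ ∈ xs →
                (∀ x → x ∈ xs → x ≢ τ → f x ≈ 0#) → ΣL xs f ≈ f τ
    ΣL-select (x ∷ xs) (ne ∷ _) (here ≡.refl) z = trans
      (+-congˡ (ΣL-0 xs (All.tabulate λ {y} y∈ → z y (there y∈) (All.lookup ne y∈)))) (+-identityʳ _)
    ΣL-select (x ∷ xs) (ne ∷ nes) (there τ∈) z = trans
      (+-cong (z x (here ≡.refl) λ { ≡.refl → All.lookup ne τ∈ ≡.refl }) (ΣL-select xs nes τ∈ (λ y y∈ → z y (there y∈))))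
      (+-identityˡ _)

  _≟ˡ_ = ≡-dec ℕ._≟_

  -- In the equation of the first index `x` all later short unknowns have coefficient 0, so its
  -- unknown equals `N x`; its contribution is then moved to the right-hand sides of the other
  -- equations. Unknowns with more than three parts are set to 0.
  triangular-solve : (E : List ℕ → List ℕ → Carrier) (xs : List (List ℕ)) (N : List ℕ → Carrier) →
    AllPairs (λ x y → y ≢ x × (Short x → Short y → E y x ≈ 0#)) xs → All (λ x → Short x → E x x ≈ 1#) xs →
    Σ[ c ∈ (List ℕ → Carrier) ] (∀ y → ¬ Short y → c y ≈ 0#) ×
      (∀ z → z ∈ xs → Short z → ΣL xs (λ y → c y * E y z) ≈ N z)
  triangular-solve E []       N tri diag = (λ _ → 0#) , (λ _ _ → refl) , λ _ ()
  triangular-solve E (x ∷ xs) N (x-xs ∷ tri) (diag-x ∷ diag) with length x ℕ.≤? 3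
  ... | no long = let c , c-long , c-eq = triangular-solve E xs N tri diag in
    c , c-long , λ { z (here ≡.refl) s → ⊥-elim (long s)
                   ; z (there z∈) s → trans (+-cong (trans (*-congʳ (c-long x long)) (zeroˡ _)) (c-eq z z∈ s)) (+-identityˡ _) }
  ... | yes short = c′ , c′-long , c′-eq
    where
    rec = triangular-solve E xs (λ z → N z - N x * E x z) tri diag
    c = proj₁ rec
    c-long = proj₁ (proj₂ rec)
    c-eq = proj₂ (proj₂ rec)
    c′ : List ℕ → Carrier
    c′ y with y ≟ˡ x
    ... | yes _ = N x
    ... | no _  = c y
    c′-x : c′ x ≈ N x
    c′-x with x ≟ˡ x
    ... | yes _ = refl
    ... | no ne = ⊥-elim (ne ≡.refl)
    c′-other : ∀ y → y ≢ x → c′ y ≈ c y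
    c′-other y ne with y ≟ˡ x
    ... | yes e = ⊥-elim (ne e)
    ... | no _  = refl
    c′-long : ∀ y → ¬ Short y → c′ y ≈ 0#
    c′-long y long with y ≟ˡ x
    ... | yes ≡.refl = ⊥-elim (long short)
    ... | no _       = c-long y long
    tail : ∀ z → ΣL xs (λ y → c′ y * E y z) ≈ ΣL xs (λ y → c y * E y z)
    tail z = ΣL-cong xs (All.map (λ {y} (ne , _) → *-congʳ (c′-other y ne)) x-xs)
    c′-eq : ∀ z → z ∈ x ∷ xs → Short z → ΣL (x ∷ xs) (λ y → c′ y * E y z) ≈ N z
    c′-eq z (here ≡.refl) s = trans
      (+-cong (trans (*-cong c′-x (diag-x s)) (*-identityʳ _)) (trans (tail x) (ΣL-0 xs (All.map later x-xs)))) (+-identityʳ _)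
      where
      later : ∀ {y} → y ≢ x × (Short x → Short y → E y x ≈ 0#) → c y * E y x ≈ 0#
      later {y} (_ , zero-E) with length y ℕ.≤? 3
      ... | yes s′   = trans (*-congˡ (zero-E s s′)) (zeroʳ _)
      ... | no long′ = trans (*-congʳ (c-long y long′)) (zeroˡ _)
    c′-eq z (there z∈) s = trans (+-cong (*-congʳ c′-x) (trans (tail z) (c-eq z z∈ s)))
      (solve 2 (λ a b → a :+ (b :- a) := b) refl (N x * E x z) (N z))

  X-large : ∀ Q as → Sorted Q → Any (3 ℕ.<_) as → X Q as ≈ 0#
  X-large Q (a ∷ as) s (here 3<a) = Σs-0 Q λ {C} {R} i → trans (*-congʳ (go a 3<a C (proj₁ (AllPairs-split i s)))) (zeroˡ _)
    where
    go : ∀ a → 3 ℕ.< a → ∀ C → Sorted C → ∀ {R} → wt a C R ≈ 0#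
    go (suc (suc (suc (suc a)))) _ []             _ = zeroˡ _
    go (suc (suc (suc (suc a)))) _ (_ ∷ [])         _ = zeroˡ _
    go (suc (suc (suc (suc a)))) _ (_ ∷ _ ∷ [])     _ = zeroˡ _
    go (suc (suc (suc (suc a)))) _ (_ ∷ _ ∷ _ ∷ []) _ = zeroˡ _
    go a _ (_ ∷ _ ∷ _ ∷ _ ∷ _) s = trans (*-congˡ (trans (*-congʳ (four-inner s)) (zeroˡ _))) (zeroʳ _)
    go (suc zero) (s≤s ()) _ _
    go (suc (suc zero)) (s≤s (s≤s ())) _ _
    go (suc (suc (suc zero))) (s≤s (s≤s (s≤s ()))) _ _
  X-large Q (a ∷ as) s (there p) = Σs-0 Q λ {C} {R} i → trans (*-congˡ (X-large R as (proj₂ (AllPairs-split i s)) p)) (zeroʳ _)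

  X-sum : ∀ Q as → sum as ≢ length Q → X Q as ≈ 0#
  X-sum []      []       ne = ⊥-elim (ne ≡.refl)
  X-sum (_ ∷ _) []       ne = refl
  X-sum Q       (a ∷ as) ne = Σs-0 Q λ {C} {R} i → trans
    (wt-guard a C R λ |C|≡a → *-congˡ (X-sum R as λ e → ne (≡.trans (cong₂ ℕ._+_ (≡.sym |C|≡a) e) (length-split i)))) (zeroʳ _)

  X-zeros : ∀ Q z as → X Q (replicate z 0 ++ as) ≈ X Q as
  X-zeros Q zero    as = refl
  X-zeros Q (suc z) as = trans (X-0 Q (replicate z 0 ++ as)) (X-zeros Q z as)

  matrices-zeros : ∀ μ z as → matrices μ (replicate z 0 ++ as) ≡ matrices μ as
  matrices-zeros μ zero    as = ≡.refl
  matrices-zeros μ (suc z) as = ≡.trans (choose-zero μ _) (matrices-zeros μ z as)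

  module _ (Q : List V) (Q↑ : Sorted Q) where
    private
      n = length Q
      ps = partitions n
      ps-partitions : All (λ μ → Partition n μ × sum μ ≡ n) ps
      ps-partitions = partsLE-partitions n n n
      E : List ℕ → List ℕ → Carrier
      E y x = ι (matrices y (conjugate x))

      tri : ∀ {xs} → AllPairs _⋖_ xs → All (λ μ → Partition n μ × sum μ ≡ n) xs →
            AllPairs (λ x y → y ≢ x × (Short x → Short y → E y x ≈ 0#)) xs
      tri []           []               = []
      tri (x⋖xs ∷ inc) ((Px , sx) ∷ Ps) = All.zipWith
        (λ (x⋖y , (Py , sy)) → ⋖-irrefl x⋖y , λ short-x short-y →
          ≡⇒≈ (cong ι (matrices-triangular Px short-x short-y (≡.trans sx (≡.sym sy)) x⋖y))) (x⋖xs , Ps) ∷ tri inc Ps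

      solution : Σ[ c ∈ (List ℕ → Carrier) ] (∀ y → ¬ Short y → c y ≈ 0#) ×
                   (∀ z → z ∈ ps → Short z → ΣL ps (λ y → c y * E y z) ≈ X Q (conjugate z))
      solution = triangular-solve E ps (λ z → X Q (conjugate z)) (tri (partsLE-increasing n n n) ps-partitions)
        (All.map (λ {μ} (P , _) short → trans (≡⇒≈ (cong ι (matrices-conjugate μ P short))) ι-1) ps-partitions)

    coefficient : List ℕ → Carrier
    coefficient = proj₁ solution

    coefficient-long : ∀ y → ¬ Short y → coefficient y ≈ 0#
    coefficient-long = proj₁ (proj₂ solution)

    -- The system is solved only at the exponents `conjugate μ`. An entry above 3 or a wrong total
    -- makes both sides vanish, and all other exponents are rearrangements of solved ones padded
    -- with zeros.
    e-expansion : ∀ as → X Q as ≈ ΣL ps (λ μ → coefficient μ * ι (matrices μ as))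
    e-expansion as with any? (3 ℕ.<?_) as
    ... | yes large = trans (X-large Q as Q↑ large) (sym (ΣL-0 ps (All.universal vanish ps)))
      where
      vanish : ∀ μ → coefficient μ * ι (matrices μ as) ≈ 0#
      vanish μ with length μ ℕ.≤? 3
      ... | yes s   = trans (*-congˡ (≡⇒≈ (cong ι (matrices-large μ as (Any.map (ℕₚ.≤-<-trans s) large))))) (zeroʳ _)
      ... | no long = trans (*-congʳ (coefficient-long μ long)) (zeroˡ _)
    ... | no ¬large with sum as ℕ.≟ n
    ...   | no ne = trans (X-sum Q as ne) (sym (ΣL-0 ps (All.map
              (λ {μ} (_ , s) → trans (*-congˡ (≡⇒≈ (cong ι (matrices-sum μ as λ e → ne (≡.trans e s))))) (zeroʳ _)) ps-partitions)))
    ...   | yes e with columns-form as (All.map (λ ¬lt → ℕₚ.≮⇒≥ ¬lt) (Allₚ.¬Any⇒All¬ as ¬large))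
    ...     | z , r , s , t , p = begin
      X Q as                                          ≈⟨ X-↭ Q Q↑ p ⟩
      X Q (replicate z 0 ++ columns r s t)            ≈⟨ X-zeros Q z _ ⟩
      X Q (columns r s t)                             ≈⟨ ≡⇒≈ (cong (X Q) (≡.sym (rowsOf-conjugate r s t))) ⟩
      X Q (conjugate (rowsOf r s t))
        ≈⟨ sym (proj₂ (proj₂ solution) (rowsOf r s t) (∈-partsLE n (rowsOf-partition r s t total) total ≤-refl) (rowsOf-short r s t)) ⟩
      ΣL ps (λ μ → coefficient μ * ι (matrices μ (conjugate (rowsOf r s t))))
        ≈⟨ ΣL-cong ps (All.universal (λ μ → *-congˡ (≡⇒≈ (cong ι (≡.trans (cong (matrices μ) (rowsOf-conjugate r s t))
             (≡.trans (≡.sym (matrices-zeros μ z (columns r s t))) (≡.sym (matrices-↭ μ p))))))) ps) ⟩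
      ΣL ps (λ μ → coefficient μ * ι (matrices μ as)) ∎
      where
      zeros-sum : ∀ z → sum (replicate z 0 ++ columns r s t) ≡ sum (columns r s t)
      zeros-sum zero    = ≡.refl
      zeros-sum (suc z) = zeros-sum z
      total : sum (rowsOf r s t) ≡ n
      total = ≡.trans (rowsOf-sum r s t) (≡.trans (≡.sym (zeros-sum z)) (≡.trans (≡.sym (sum-↭ p)) e))

    -- `L` is the pairing with m_τ, and its value at `matrices μ` is the coefficient of the monomial
    -- with exponents μ: 1 for μ = τ and 0 for other partitions with at most three parts.
    coefficient-functional : ∀ {L} τ → Partition n τ → Short τ → sum τ ≡ n → Selects L (pad₃ τ) → L (X Q) ≈ coefficient τ
    coefficient-functional {L} τ Pτ short-τ sum-τ S = begin
      L (X Q)                                                          ≈⟨ Linear.L-cong linear e-expansion ⟩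
      L (λ as → ΣL ps (λ μ → coefficient μ * ι (matrices μ as)))       ≈⟨ Linear.L-Λ linear additive (λ μ as → ι (matrices μ as)) ⟩
      ΣL ps (λ μ → coefficient μ * value L (matrices μ))
        ≈⟨ ΣL-select ps (AllPairs.map ⋖-irrefl (partsLE-increasing n n n)) (∈-partsLE n Pτ sum-τ ≤-refl) other ⟩
      coefficient τ * value L (matrices τ)                             ≈⟨ *-congˡ (trans (padded τ short-τ) (selected τ Pτ short-τ ≡.refl)) ⟩
      coefficient τ * 1#                                               ≈⟨ *-identityʳ _ ⟩
      coefficient τ ∎
      where
      linear = Selects.linear S
      additive : Additive (λ f → ΣL ps (λ μ → coefficient μ * f μ))
      additive = record
        { Λ-cong = λ e → ΣL-cong ps (All.universal (λ μ → *-congˡ (e μ)) ps)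
        ; Λ-+ = λ f g → trans (ΣL-cong ps (All.universal (λ μ → distribˡ _ _ _) ps)) (ΣL-+ ps _ _)
        ; Λ-* = λ x f → trans (ΣL-cong ps (All.universal (λ μ → solve 3 (λ c x f → c :* (x :* f) := x :* (c :* f)) refl (coefficient μ) x (f μ)) ps))
                              (ΣL-* ps x (λ μ → coefficient μ * f μ)) }
      padded : ∀ μ → Short μ → value L (matrices μ) ≈ value L (matrices (pad₃ μ))
      padded μ s = Linear.L-cong linear (λ as → ≡⇒≈ (cong ι (≡.sym (matrices-pad₃ μ as s))))
      selected : ∀ {m} μ → Partition m μ → Short μ → pad₃ μ ≡ pad₃ τ → value L (matrices (pad₃ μ)) ≈ 1#
      selected []               P _ e = Selects.hit S z≤n z≤n e
      selected (i ∷ [])         P _ e = Selects.hit S z≤n z≤n e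
      selected (i ∷ j ∷ [])     (add _ _ (add _ j≤i _)) _ e = Selects.hit S z≤n j≤i e
      selected (i ∷ j ∷ k ∷ _)  (add _ _ (add _ j≤i (add _ k≤j _))) _ e = Selects.hit S k≤j j≤i e
      missed : ∀ {m} μ → Partition m μ → Short μ → pad₃ μ ≢ pad₃ τ → value L (matrices (pad₃ μ)) ≈ 0#
      missed []               P _ e = Selects.miss S z≤n z≤n e
      missed (i ∷ [])         P _ e = Selects.miss S z≤n z≤n e
      missed (i ∷ j ∷ [])     (add _ _ (add _ j≤i _)) _ e = Selects.miss S z≤n j≤i e
      missed (i ∷ j ∷ k ∷ _)  (add _ _ (add _ j≤i (add _ k≤j _))) _ e = Selects.miss S k≤j j≤i e
      other : ∀ μ → μ ∈ ps → μ ≢ τ → coefficient μ * value L (matrices μ) ≈ 0#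
      other μ μ∈ ne with length μ ℕ.≤? 3
      ... | no long = trans (*-congʳ (coefficient-long μ long)) (zeroˡ _)
      ... | yes s   = trans (*-congˡ (trans (padded μ s) (missed μ Pμ s λ e → ne (≡.trans (≡.sym (dropZeros-pad₃ μ Pμ s))
                        (≡.trans (cong dropZeros e) (dropZeros-pad₃ τ Pτ short-τ)))))) (zeroʳ _)
        where Pμ = proj₁ (All.lookup ps-partitions μ∈)

-- Translation of the definitions

module DyckOrders where
  open import Data.Nat using (_<_)
  open import Data.Nat.Properties
  open import Data.Bool using (T)
  open import Data.Bool.Properties using (¬-not)
  open import Data.Fin.Properties using (toℕ<n)
  open import Relation.Binary.PropositionalEquality

  private
    T⇒≡ : ∀ {b} → T b → b ≡ true
    T⇒≡ = Equivalence.to T-≡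

    ≡⇒T : ∀ {b} → b ≡ true → T b
    ≡⇒T = Equivalence.from T-≡

    ¬T⇒≡ : ∀ {b} → ¬ T b → b ≡ false
    ¬T⇒≡ ¬t = ¬-not λ e → ¬t (≡⇒T e)

    true≢false : true ≡ false → ⊥
    true≢false ()

  <ᵇ-true : ∀ {m n} → m < n → (m <ᵇ n) ≡ true
  <ᵇ-true m<n = T⇒≡ (<⇒<ᵇ m<n)

  <ᵇ-false : ∀ {m n} → n ≤ m → (m <ᵇ n) ≡ false
  <ᵇ-false n≤m = ¬T⇒≡ λ t → <⇒≱ (<ᵇ⇒< _ _ t) n≤m

  ≡ᵇ-false : ∀ {m n} → m ≢ n → (m ≡ᵇ n) ≡ false
  ≡ᵇ-false m≢n = ¬T⇒≡ λ t → m≢n (≡ᵇ⇒≡ _ _ t)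

  adjacent : ∀ {n} → (ℕ → ℕ) → Fin n → Fin n → Bool
  adjacent {n} d u v = (toℕ u <ᵇ toℕ v) ∧ edge n d u v

  module DyckOrder {n : ℕ} {d : ℕ → ℕ} (dyck : IsDyck n d) (bounce : Bounce3 n d) where

    d-mono : ∀ {i j} → 1 ≤ i → i ≤ j → j < n → d i ≤ d j
    d-mono {i} 1≤i i≤j j<n = go (≤⇒≤′ i≤j) j<n
      where
      go : ∀ {j} → i ℕ.≤′ j → j < n → d i ≤ d j
      go (ℕ.≤′-reflexive refl) _   = ≤-refl
      go (ℕ.≤′-step i≤j)       j<n = ≤-trans (go i≤j (<-trans (n<1+n _) j<n))
        (proj₂ dyck _ (≤-trans 1≤i (≤′⇒≤ i≤j)) j<n)

    lab≤n : (v : Fin n) → lab v ≤ n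
    lab≤n = toℕ<n

    lab<n : ∀ {u v : Fin n} → toℕ u < toℕ v → lab u < n
    lab<n {v = v} u<v = ≤-<-trans u<v (toℕ<n v)

    prec-up : ∀ {u v : Fin n} → toℕ u < toℕ v → prec n d (lab u) (lab v) ≡ (d (lab u) <ᵇ lab v)
    prec-up {u} {v} u<v rewrite <ᵇ-true (lab<n {u} {v} u<v) | T⇒≡ (≤⇒≤ᵇ (lab≤n v)) with d (lab u) <ᵇ lab v
    ... | true  = refl
    ... | false = refl

    prec-down : ∀ {u v : Fin n} → toℕ u < toℕ v → prec n d (lab v) (lab u) ≡ false
    prec-down {u} {v} u<v with lab v <ᵇ n in e
    ... | false = refl
    ... | true rewrite <ᵇ-false {d (lab v)} {lab u} (≤-trans (<⇒≤ (s≤s u<v)) (proj₁ (proj₁ dyck (lab v) (s≤s z≤n) (<ᵇ⇒< _ _ (≡⇒T e))))) = refl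

    adjacent-up : ∀ {u v : Fin n} → toℕ u < toℕ v → adjacent d u v ≡ not (d (lab u) <ᵇ lab v)
    adjacent-up {u} {v} u<v rewrite <ᵇ-true u<v | ≡ᵇ-false (<⇒≢ u<v) | prec-up {u} {v} u<v | prec-down {u} {v} u<v
      with d (lab u) <ᵇ lab v
    ... | true  = refl
    ... | false = refl

    adjacent⇒ : ∀ {u v : Fin n} → toℕ u < toℕ v → adjacent d u v ≡ true → lab v ≤ d (lab u)
    adjacent⇒ {u} {v} u<v e = ≮⇒≥ λ lt → true≢false (trans (sym e) (trans (adjacent-up u<v) (cong not (<ᵇ-true lt))))

    ⇒adjacent : ∀ {u v : Fin n} → toℕ u < toℕ v → lab v ≤ d (lab u) → adjacent d u v ≡ true
    ⇒adjacent {u} {v} u<v le = trans (adjacent-up u<v) (cong not (<ᵇ-false le))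

    ¬adjacent⇒ : ∀ {u v : Fin n} → toℕ u < toℕ v → adjacent d u v ≡ false → d (lab u) < lab v
    ¬adjacent⇒ {u} {v} u<v e = ≰⇒> λ le → true≢false (trans (sym (⇒adjacent u<v le)) e)

    order : IntervalOrder
    order = record
      { V        = Fin n
      ; _<_      = λ u v → toℕ u < toℕ v
      ; A        = adjacent d
      ; A-irrefl = λ u → cong (_∧ edge n d u u) (<ᵇ-false {toℕ u} ≤-refl)
      ; A-asym   = λ {u} {v} u<v → cong (_∧ edge n d v u) (<ᵇ-false (<⇒≤ u<v))
      ; A-closeˡ = λ {x} {y} {z} x<y y<z xz → ⇒adjacent {x} {y} x<y
          (≤-trans (<⇒≤ (s≤s y<z)) (adjacent⇒ {x} {z} (<-trans x<y y<z) xz))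
      ; A-closeʳ = λ {x} {y} {z} x<y y<z xz → ⇒adjacent {y} {z} y<z
          (≤-trans (adjacent⇒ {x} {z} (<-trans x<y y<z) xz) (d-mono (s≤s z≤n) (<⇒≤ (s≤s x<y)) (lab<n {y} {z} y<z)))
      ; A-height = λ {w} {x} {y} {z} → height w x y z
      }
      where
      dd-inside : ∀ {i} → i < n → dd n d i ≡ d i
      dd-inside i<n rewrite <ᵇ-true i<n = refl

      -- A chain w, x, y, z overtakes the bounce path: m₀ = d 1 ≤ d w < x, hence m₁ ≤ d x < y, hence
      -- m₂ ≤ d y < z ≤ n, against m₂ = n.
      height : ∀ w x y z → toℕ w < toℕ x → toℕ x < toℕ y → toℕ y < toℕ z →
               adjacent d w x ≡ false → adjacent d x y ≡ false → adjacent d y z ≡ false → ⊥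
      height w x y z w<x x<y y<z wx xy yz = <⇒≱ (<-≤-trans m₂<z (lab≤n z)) (≤-reflexive (sym (proj₂ (proj₂ bounce))))
        where
        m₀<x : bm0 n d < lab x
        m₀<x = ≤-<-trans (d-mono ≤-refl (s≤s z≤n) (lab<n {w} {x} w<x)) (¬adjacent⇒ {w} {x} w<x wx)
        m₁<y : bm1 n d < lab y
        m₁<y = ≤-<-trans (≤-trans (≤-reflexive (dd-inside (≤-<-trans m₀<x (lab<n {x} {y} x<y))))
                 (d-mono (s≤s z≤n) m₀<x (lab<n {x} {y} x<y))) (¬adjacent⇒ {x} {y} x<y xy)
        m₂<z : bm2 n d < lab z
        m₂<z = ≤-<-trans (≤-trans (≤-reflexive (dd-inside (≤-<-trans m₁<y (lab<n {y} {z} y<z))))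
                 (d-mono (s≤s z≤n) m₁<y (lab<n {y} {z} y<z))) (¬adjacent⇒ {y} {z} y<z yz)

open DyckOrders

-- Coefficients of e_μ as numbers of 0-1 matrices

module ElementaryCoefficients where
  open import Data.Nat using (_+_; _*_)
  open import Data.Nat.Properties
  open import Relation.Binary.PropositionalEquality

  Σℕ : ∀ {X : Set} → List X → (X → ℕ) → ℕ
  Σℕ []       f = 0
  Σℕ (x ∷ xs) f = f x + Σℕ xs f

  module _ {X : Set} where
    Σℕ-cong : ∀ (xs : List X) {f g} → (∀ x → f x ≡ g x) → Σℕ xs f ≡ Σℕ xs g
    Σℕ-cong []       e = refl
    Σℕ-cong (x ∷ xs) e = cong₂ _+_ (e x) (Σℕ-cong xs e)

    Σℕ-0 : ∀ (xs : List X) → Σℕ xs (λ _ → 0) ≡ 0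
    Σℕ-0 []       = refl
    Σℕ-0 (x ∷ xs) = Σℕ-0 xs

    Σℕ-+ : ∀ (xs : List X) f g → Σℕ xs (λ x → f x + g x) ≡ Σℕ xs f + Σℕ xs g
    Σℕ-+ []       f g = refl
    Σℕ-+ (x ∷ xs) f g = trans (cong (f x + g x +_) (Σℕ-+ xs f g)) (interchange (f x) (g x) _ _)

    Σℕ-++ : ∀ (xs ys : List X) f → Σℕ (xs ++ ys) f ≡ Σℕ xs f + Σℕ ys f
    Σℕ-++ []       ys f = refl
    Σℕ-++ (x ∷ xs) ys f = trans (cong (f x +_) (Σℕ-++ xs ys f)) (sym (+-assoc (f x) _ _))

    Σℕ-map : ∀ {Y : Set} (h : Y → X) ys f → Σℕ (map h ys) f ≡ Σℕ ys (f ∘ h)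
    Σℕ-map h []       f = refl
    Σℕ-map h (y ∷ ys) f = cong (f (h y) +_) (Σℕ-map h ys f)

    Σℕ-concatMap : ∀ {Y : Set} (h : Y → List X) ys f → Σℕ (concatMap h ys) f ≡ Σℕ ys (λ y → Σℕ (h y) f)
    Σℕ-concatMap h []       f = refl
    Σℕ-concatMap h (y ∷ ys) f = trans (Σℕ-++ (h y) _ f) (cong (Σℕ (h y) f +_) (Σℕ-concatMap h ys f))

    Σℕ-filterB : ∀ p (xs : List X) f → Σℕ (filterB p xs) f ≡ Σℕ xs (λ x → bit (p x) * f x)
    Σℕ-filterB p []       f = refl
    Σℕ-filterB p (x ∷ xs) f with p x
    ... | true  = cong₂ _+_ (sym (+-identityʳ (f x))) (Σℕ-filterB p xs f)
    ... | false = Σℕ-filterB p xs f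

    count-Σℕ : ∀ p (xs : List X) → count p xs ≡ Σℕ xs (bit ∘ p)
    count-Σℕ p []       = refl
    count-Σℕ p (x ∷ xs) with p x
    ... | true  = cong suc (count-Σℕ p xs)
    ... | false = count-Σℕ p xs

  Σℕ-tabulate : ∀ n {X : Set} (h : Fin n → X) f → Σℕ (tabulate h) f ≡ Σℕ (allFin n) (f ∘ h)
  Σℕ-tabulate zero    h f = refl
  Σℕ-tabulate (suc n) h f = cong (f (h Fin.zero) +_)
    (trans (Σℕ-tabulate n (h ∘ Fin.suc) f) (sym (Σℕ-tabulate n Fin.suc (f ∘ h))))

  allB-tabulate : ∀ n {X : Set} (h : Fin n → X) p → allB p (tabulate h) ≡ allB (p ∘ h) (allFin n)
  allB-tabulate zero    h p = refl
  allB-tabulate (suc n) h p = cong (p (h Fin.zero) ∧_)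
    (trans (allB-tabulate n (h ∘ Fin.suc) p) (sym (allB-tabulate n Fin.suc (p ∘ h))))

  allB-cong : ∀ {X : Set} (xs : List X) {p p′} → (∀ x → p x ≡ p′ x) → allB p xs ≡ allB p′ xs
  allB-cong []       e = refl
  allB-cong (x ∷ xs) e = cong₂ _∧_ (e x) (allB-cong xs e)

  bit-∧ : ∀ a b → bit (a ∧ b) ≡ bit a * bit b
  bit-∧ true  b = sym (+-identityʳ _)
  bit-∧ false b = refl

  choose-* : ∀ a μ c k → choose a μ (λ ν → c * k ν) ≡ c * choose a μ k
  choose-* zero    []          c k = refl
  choose-* (suc a) []          c k = sym (*-zeroʳ c)
  choose-* zero    (x ∷ μ)     c k = choose-* zero μ c _
  choose-* (suc a) (zero ∷ μ)  c k = choose-* (suc a) μ c _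
  choose-* (suc a) (suc x ∷ μ) c k = trans (cong₂ _+_ (choose-* (suc a) μ c _) (choose-* a μ c _)) (sym (*-distribˡ-+ c _ _))

  choose-Σℕ : ∀ {X : Set} a μ (xs : List X) (w : X → ℕ) (K : X → List ℕ → ℕ) →
              choose a μ (λ ν → Σℕ xs (λ x → w x * K x ν)) ≡ Σℕ xs (λ x → w x * choose a μ (K x))
  choose-Σℕ a μ []       w K = choose-0 a μ λ _ _ _ → refl
  choose-Σℕ a μ (x ∷ xs) w K = trans (choose-+ a μ _ _) (cong₂ _+_ (choose-* a μ (w x) (K x)) (choose-Σℕ a μ xs w K))

  size-∷ : ∀ {n} b (S : Vec Bool n) → size (b ∷ᵥ S) ≡ bit b + size S
  size-∷ {n} b S = trans (count-Σℕ (lookup (b ∷ᵥ S)) (allFin (suc n))) (cong (bit b +_)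
    (trans (Σℕ-tabulate n Fin.suc (bit ∘ lookup (b ∷ᵥ S))) (sym (count-Σℕ (lookup S) (allFin n)))))

  Σ-tuples-∷ : ∀ n r μ h → Σℕ (tuples n (r ∷ μ)) h ≡
               Σℕ (subsets n) (λ S → bit (size S ≡ᵇ r) * Σℕ (tuples n μ) (h ∘ (S ∷_)))
  Σ-tuples-∷ n r μ h = trans (Σℕ-concatMap _ (filterB (λ S → size S ≡ᵇ r) (subsets n)) h)
    (trans (Σℕ-filterB (λ S → size S ≡ᵇ r) (subsets n) _)
      (Σℕ-cong (subsets n) λ S → cong (bit (size S ≡ᵇ r) *_) (Σℕ-map (S ∷_) (tuples n μ) h)))

  Σ-subsets-suc : ∀ n f → Σℕ (subsets (suc n)) f ≡ Σℕ (subsets n) (λ S → f (true ∷ᵥ S) + f (false ∷ᵥ S))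
  Σ-subsets-suc n f = trans (Σℕ-concatMap _ (subsets n) f)
    (Σℕ-cong (subsets n) λ S → cong (f (true ∷ᵥ S) +_) (+-identityʳ _))

  mult-tail : ∀ {n} (ts : List (Vec Bool (suc n))) j → mult ts (Fin.suc j) ≡ mult (map tailᵥ ts) j
  mult-tail []                  j = refl
  mult-tail ((b ∷ᵥ S) ∷ ts) j with lookup S j
  ... | true  = cong suc (mult-tail ts j)
  ... | false = mult-tail ts j

  -- A tuple of subsets is a 0-1 matrix with the subsets as rows. Deleting the first column lowers
  -- the sums of the a rows that meet it, which is the selection made by `choose`.
  first-column : ∀ n a μ (g : List (Vec Bool n) → ℕ) →
    Σℕ (tuples (suc n) μ) (λ ts → bit (mult ts Fin.zero ≡ᵇ a) * g (map tailᵥ ts)) ≡ choose a μ (λ ν → Σℕ (tuples n ν) g)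
  first-column n zero    []      g = cong (_+ 0) (+-identityʳ (g []))
  first-column n (suc a) []      g = refl
  first-column n a       (r ∷ μ) g = trans (Σ-tuples-∷ (suc n) r μ _) (trans (Σ-subsets-suc n _)
    (trans (Σℕ-+ (subsets n) _ _) (trans (cong₂ _+_ (inside a r) outside) (combine a r))))
    where
    K : Vec Bool n → List ℕ → ℕ
    K S ν = Σℕ (tuples n ν) (g ∘ (S ∷_))

    outside : Σℕ (subsets n) (λ S → bit (size (false ∷ᵥ S) ≡ᵇ r) *
                Σℕ (tuples (suc n) μ) (λ ts → bit (mult ts Fin.zero ≡ᵇ a) * g (S ∷ map tailᵥ ts)))
              ≡ Σℕ (subsets n) (λ S → bit (size S ≡ᵇ r) * choose a μ (K S))
    outside = Σℕ-cong (subsets n) λ S → cong₂ _*_ (cong (λ m → bit (m ≡ᵇ r)) (size-∷ false S)) (first-column n a μ (g ∘ (S ∷_)))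

    -- The case where the first row meets the first column: impossible for a = 0 or r = 0.
    drop : ℕ → ℕ → ℕ
    drop zero    r       = 0
    drop (suc a) zero    = 0
    drop (suc a) (suc r) = Σℕ (subsets n) (λ S → bit (size S ≡ᵇ r) * choose a μ (K S))

    inside : ∀ a r → Σℕ (subsets n) (λ S → bit (size (true ∷ᵥ S) ≡ᵇ r) *
                Σℕ (tuples (suc n) μ) (λ ts → bit (suc (mult ts Fin.zero) ≡ᵇ a) * g (S ∷ map tailᵥ ts))) ≡ drop a r
    inside zero    r       = trans (Σℕ-cong (subsets n) λ S →
      trans (cong (bit (size (true ∷ᵥ S) ≡ᵇ r) *_) (Σℕ-0 (tuples (suc n) μ))) (*-zeroʳ (bit (size (true ∷ᵥ S) ≡ᵇ r)))) (Σℕ-0 (subsets n))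
    inside (suc a) zero    = trans (Σℕ-cong (subsets n) λ S → cong (λ m → bit (m ≡ᵇ 0) * Σℕ (tuples (suc n) μ) (λ ts → bit (mult ts Fin.zero ≡ᵇ a) * g (S ∷ map tailᵥ ts))) (size-∷ true S)) (Σℕ-0 (subsets n))
    inside (suc a) (suc r) = Σℕ-cong (subsets n) λ S → cong₂ _*_ (cong (λ m → bit (m ≡ᵇ suc r)) (size-∷ true S)) (first-column n a μ (g ∘ (S ∷_)))

    unfold : ∀ r a → Σℕ (subsets n) (λ S → bit (size S ≡ᵇ r) * choose a μ (K S)) ≡ choose a μ (λ ν → Σℕ (tuples n (r ∷ ν)) g)
    unfold r a = trans (sym (choose-Σℕ a μ (subsets n) (λ S → bit (size S ≡ᵇ r)) K))
      (choose-cong a μ λ ν _ _ → sym (Σ-tuples-∷ n r ν g))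

    combine : ∀ a r → drop a r + Σℕ (subsets n) (λ S → bit (size S ≡ᵇ r) * choose a μ (K S)) ≡ choose a (r ∷ μ) (λ ν → Σℕ (tuples n ν) g)
    combine zero    r       = unfold r 0
    combine (suc a) zero    = unfold 0 (suc a)
    combine (suc a) (suc r) = trans (cong₂ _+_ (unfold r a) (unfold (suc r) (suc a))) (+-comm (choose a μ _) _)

  ecoef-matrices : ∀ n μ (α : Fin n → ℕ) → ecoef n μ α ≡ matrices μ (tabulate α)
  ecoef-matrices n μ α = trans (count-Σℕ _ (tuples n μ)) (go n μ α)
    where
    base : ∀ μ → Σℕ (tuples 0 μ) (λ _ → 1) ≡ allZero μ
    base []          = refl
    base (zero ∷ μ)  = trans (Σ-tuples-∷ 0 0 μ (λ _ → 1)) (trans (+-identityʳ _) (trans (+-identityʳ _) (base μ)))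
    base (suc r ∷ μ) = Σ-tuples-∷ 0 (suc r) μ (λ _ → 1)
    go : ∀ n μ (α : Fin n → ℕ) → Σℕ (tuples n μ) (λ ts → bit (allB (λ j → mult ts j ≡ᵇ α j) (allFin n))) ≡ matrices μ (tabulate α)
    go zero    μ α = base μ
    go (suc n) μ α = trans
      (Σℕ-cong (tuples (suc n) μ) λ ts → trans (bit-∧ (mult ts Fin.zero ≡ᵇ α Fin.zero) _)
        (cong (bit (mult ts Fin.zero ≡ᵇ α Fin.zero) *_) (cong bit
          (trans (allB-tabulate n Fin.suc (λ j → mult ts j ≡ᵇ α j))
            (allB-cong (allFin n) λ j → cong (_≡ᵇ α (Fin.suc j)) (mult-tail ts j))))))
      (trans (first-column n (α Fin.zero) μ (λ ts → bit (allB (λ j → mult ts j ≡ᵇ α (Fin.suc j)) (allFin n))))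
        (choose-cong (α Fin.zero) μ λ ν _ _ → go n ν (α ∘ Fin.suc)))

open ElementaryCoefficients

-- Colourings as iterated splittings

module Colourings (𝒲 : Weights) (𝒪 : IntervalOrder) where
  open Polynomials 𝒲
  open Splittings 𝒲
  open IntervalOrder 𝒪
  open Chromatic 𝒲 𝒪

  Coloured : Set
  Coloured = List (V × ℕ)

  firstClass : Coloured → List V
  firstClass []                = []
  firstClass ((v , zero) ∷ L)  = v ∷ firstClass L
  firstClass ((v , suc c) ∷ L) = firstClass L

  -- Colours are lowered by one, so that the next class has colour 0 again.
  otherClasses : Coloured → Coloured
  otherClasses []                = []
  otherClasses ((v , zero) ∷ L)  = otherClasses L
  otherClasses ((v , suc c) ∷ L) = (v , c) ∷ otherClasses L

  -- The sum of h over the colourings of Q with m colours.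
  Σc : ℕ → List V → (Coloured → Carrier) → Carrier
  Σc m []      h = h []
  Σc m (w ∷ Q) h = Σc m Q (λ L → ΣL (allFin m) (λ c → h ((w , toℕ c) ∷ L)))

  Σc-cong : ∀ m Q {h h′} → (∀ L → map proj₁ L ≡ Q → h L ≈ h′ L) → Σc m Q h ≈ Σc m Q h′
  Σc-cong m []      e = e [] ≡.refl
  Σc-cong m (w ∷ Q) e = Σc-cong m Q λ L p → ΣL-cong (allFin m) (All.universal (λ c → e _ (cong (w ∷_) p)) _)

  Σc-+ : ∀ m Q (h h′ : Coloured → Carrier) → Σc m Q (λ L → h L + h′ L) ≈ Σc m Q h + Σc m Q h′
  Σc-+ m []      h h′ = refl
  Σc-+ m (w ∷ Q) h h′ = trans (Σc-cong m Q λ L _ → ΣL-+ (allFin m) _ _) (Σc-+ m Q _ _)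

  Σc-* : ∀ m Q x (h : Coloured → Carrier) → Σc m Q (λ L → x * h L) ≈ x * Σc m Q h
  Σc-* m []      x h = refl
  Σc-* m (w ∷ Q) x h = trans (Σc-cong m Q λ L _ → ΣL-* (allFin m) x _) (Σc-* m Q x _)

  ΣL-allFin-suc : ∀ m (f : Fin (suc m) → Carrier) → ΣL (allFin (suc m)) f ≈ f Fin.zero + ΣL (allFin m) (f ∘ Fin.suc)
  ΣL-allFin-suc m f = +-congˡ (trans (≡⇒≈ (cong (λ xs → ΣL xs f) (≡.sym (map-tabulate id Fin.suc)))) (ΣL-map Fin.suc (allFin m) f))

  -- A colouring with m + 1 colours is a first class together with a colouring of its complement by
  -- m colours.
  Σc-suc : ∀ m Q (h : List V → Coloured → Carrier) →
           Σc (suc m) Q (λ L → h (firstClass L) (otherClasses L)) ≈ Σs Q (λ C R → Σc m R (h C))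
  Σc-suc m []      h = refl
  Σc-suc m (w ∷ Q) h = trans (Σc-cong (suc m) Q λ L _ → ΣL-allFin-suc m _) (trans (Σc-+ (suc m) Q _ _)
    (+-cong (Σc-suc m Q (λ C L → h (w ∷ C) L)) (Σc-suc m Q (λ C L → ΣL (allFin m) (λ c → h C ((w , toℕ c) ∷ L))))))

  pairs : Coloured → (V → ℕ → V → ℕ → Bool) → ℕ
  pairs L p = Σℕ L (λ (u , c) → Σℕ L (λ (v , c′) → bit (p u c v c′)))

  clashes ascents : Coloured → ℕ
  clashes L = pairs L (λ u c v c′ → A u v ∧ (c ≡ᵇ c′))
  ascents L = pairs L (λ u c v c′ → A u v ∧ (c <ᵇ c′))

  classSize : ℕ → Coloured → ℕ
  classSize j L = Σℕ L (λ (_ , c) → bit (c ≡ᵇ j))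

  content : ∀ m → (Fin m → ℕ) → Coloured → Bool
  content m α L = allB (λ j → classSize (toℕ j) L ≡ᵇ α j) (allFin m)

  colouringWeight : ∀ m → (Fin m → ℕ) → Coloured → Carrier
  colouringWeight m α L = isZero (clashes L) * (ind (content m α L) * q^ ascents L)

  Σℕ-classes : ∀ L (g : V × ℕ → ℕ) → Σℕ L g ≡ Σℕ (firstClass L) (λ v → g (v , 0)) ℕ.+ Σℕ (otherClasses L) (λ (v , c) → g (v , suc c))
  Σℕ-classes []                g = ≡.refl
  Σℕ-classes ((v , zero) ∷ L)  g = ≡.trans (cong (g (v , 0) ℕ.+_) (Σℕ-classes L g)) (≡.sym (ℕₚ.+-assoc (g (v , 0)) _ _))
  Σℕ-classes ((v , suc c) ∷ L) g = ≡.trans (cong (g (v , suc c) ℕ.+_) (Σℕ-classes L g)) (x∙yz≈y∙xz (g (v , suc c)) (Σℕ (firstClass L) _) _)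

  hit-Σℕ : ∀ w C → hit w C ≡ Σℕ C (λ v → bit (A w v))
  hit-Σℕ w []      = ≡.refl
  hit-Σℕ w (x ∷ C) = cong (bit (A w x) ℕ.+_) (hit-Σℕ w C)

  up-Σℕ : ∀ C R → up C R ≡ Σℕ C (λ u → hit u R)
  up-Σℕ []      R = ≡.refl
  up-Σℕ (u ∷ C) R = cong (hit u R ℕ.+_) (up-Σℕ C R)

  private
    Σ-none : ∀ {Y : Set} (xs : List Y) {f} → (∀ x → f x ≡ 0) → Σℕ xs f ≡ 0
    Σ-none xs e = ≡.trans (Σℕ-cong xs e) (Σℕ-0 xs)

    ∧-false : ∀ b → bit (b ∧ false) ≡ 0
    ∧-false b = cong bit (∧-zeroʳ b)

    hit-true : ∀ w C → Σℕ C (λ v → bit (A w v ∧ true)) ≡ hit w C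
    hit-true w C = ≡.trans (Σℕ-cong C λ v → cong bit (∧-identityʳ (A w v))) (≡.sym (hit-Σℕ w C))

    hit-verts : ∀ w (L : Coloured) → Σℕ L (λ (v , _) → bit (A w v ∧ true)) ≡ hit w (map proj₁ L)
    hit-verts w []            = ≡.refl
    hit-verts w ((v , c) ∷ L) = cong₂ ℕ._+_ (cong bit (∧-identityʳ (A w v))) (hit-verts w L)

  clashes-classes : ∀ L → clashes L ≡ up (firstClass L) (firstClass L) ℕ.+ clashes (otherClasses L)
  clashes-classes L = ≡.trans (Σℕ-classes L _) (cong₂ ℕ._+_
    (≡.trans (Σℕ-cong C λ u → ≡.trans (Σℕ-classes L _)
      (≡.trans (cong₂ ℕ._+_ (hit-true u C) (Σ-none (otherClasses L) λ (v , _) → ∧-false (A u v))) (ℕₚ.+-identityʳ _)))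
      (≡.sym (up-Σℕ C C)))
    (Σℕ-cong (otherClasses L) λ (u , c) → ≡.trans (Σℕ-classes L _)
      (cong (ℕ._+ Σℕ (otherClasses L) (λ (v , c′) → bit (A u v ∧ (c ≡ᵇ c′)))) (Σ-none C λ v → ∧-false (A u v)))))
    where C = firstClass L

  ascents-classes : ∀ L → ascents L ≡ up (firstClass L) (map proj₁ (otherClasses L)) ℕ.+ ascents (otherClasses L)
  ascents-classes L = ≡.trans (Σℕ-classes L _) (cong₂ ℕ._+_
    (≡.trans (Σℕ-cong C λ u → ≡.trans (Σℕ-classes L _)
      (cong₂ ℕ._+_ (Σ-none C λ v → ∧-false (A u v)) (hit-verts u (otherClasses L))))
      (≡.sym (up-Σℕ C _)))
    (Σℕ-cong (otherClasses L) λ (u , c) → ≡.trans (Σℕ-classes L _)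
      (cong (ℕ._+ Σℕ (otherClasses L) (λ (v , c′) → bit (A u v ∧ (c <ᵇ c′)))) (Σ-none C λ v → ∧-false (A u v)))))
    where C = firstClass L

  classSize-zero : ∀ L → classSize 0 L ≡ length (firstClass L)
  classSize-zero []                = ≡.refl
  classSize-zero ((v , zero) ∷ L)  = cong suc (classSize-zero L)
  classSize-zero ((v , suc c) ∷ L) = classSize-zero L

  classSize-suc : ∀ j L → classSize (suc j) L ≡ classSize j (otherClasses L)
  classSize-suc j []                = ≡.refl
  classSize-suc j ((v , zero) ∷ L)  = classSize-suc j L
  classSize-suc j ((v , suc c) ∷ L) = cong (bit (c ≡ᵇ j) ℕ.+_) (classSize-suc j L)

  up-inner : ∀ C → Sorted C → up C C ≡ inner C
  up-inner []      []        = ≡.refl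
  up-inner (w ∷ C) (w<C ∷ s) rewrite A-irrefl w = cong (hit w C ℕ.+_) (≡.trans (up-below C w<C) (up-inner C s))

  ind-∧ : ∀ a b → ind (a ∧ b) ≈ ind a * ind b
  ind-∧ true  b = sym (*-identityˡ _)
  ind-∧ false b = sym (zeroˡ _)

  ind-δ : ∀ m n → ind (m ≡ᵇ n) ≈ δ n m
  ind-δ zero    zero    = refl
  ind-δ zero    (suc n) = refl
  ind-δ (suc m) zero    = refl
  ind-δ (suc m) (suc n) = ind-δ m n

  -- Clashes, ascents and content each split into a part that involves the first class and the same
  -- statistic for the other colours, which is the recursion of `X`.
  X-colourings : ∀ m Q (α : Fin m → ℕ) → Sorted Q → Σc m Q (colouringWeight m α) ≈ X Q (tabulate α)
  X-colourings zero    []      α s = solve 0 (:1 :* (:1 :* :1) := :1) refl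
  X-colourings zero    (w ∷ Q) α s = no-colours Q
    where
    no-colours : ∀ Q → Σc 0 Q (λ _ → 0#) ≈ 0#
    no-colours []      = refl
    no-colours (_ ∷ Q) = no-colours Q
  X-colourings (suc m) Q       α s = begin
    Σc (suc m) Q (colouringWeight (suc m) α)
      ≈⟨ Σc-cong (suc m) Q (λ L _ → factor L) ⟩
    Σc (suc m) Q (λ L → h (firstClass L) (otherClasses L))
      ≈⟨ Σc-suc m Q h ⟩
    Σs Q (λ C R → Σc m R (h C))
      ≈⟨ Σs-cong Q (λ {C} {R} i → let C↑ , R↑ = AllPairs-split i s in trans
           (Σc-cong m R λ L p → *-congʳ (*-congˡ (*-cong (≡⇒≈ (cong isZero (up-inner C C↑))) (≡⇒≈ (cong (λ S → q^ up C S) p)))))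
           (trans (Σc-* m R _ _) (*-congˡ (X-colourings m R (α ∘ Fin.suc) R↑)))) ⟩
    X Q (tabulate α) ∎
    where
    h : List V → Coloured → Carrier
    h C L = (δ (α Fin.zero) (length C) * (isZero (up C C) * q^ up C (map proj₁ L))) * colouringWeight m (α ∘ Fin.suc) L
    content-suc : ∀ L → content (suc m) α L ≡ (length (firstClass L) ≡ᵇ α Fin.zero) ∧ content m (α ∘ Fin.suc) (otherClasses L)
    content-suc L = cong₂ _∧_ (cong (_≡ᵇ α Fin.zero) (classSize-zero L))
      (≡.trans (allB-tabulate m Fin.suc _) (allB-cong (allFin m) λ j → cong (_≡ᵇ α (Fin.suc j)) (classSize-suc (toℕ j) L)))
    factor : ∀ L → colouringWeight (suc m) α L ≈ h (firstClass L) (otherClasses L)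
    factor L = trans
      (*-cong (trans (≡⇒≈ (cong isZero (clashes-classes L))) (isZero-+ (up C C) (clashes L′)))
        (*-cong (trans (≡⇒≈ (cong ind (content-suc L))) (trans (ind-∧ (length C ≡ᵇ α Fin.zero) (content m (α ∘ Fin.suc) L′)) (*-congʳ (ind-δ (length C) (α Fin.zero)))))
                (trans (≡⇒≈ (cong q^_ (ascents-classes L))) (q^-+ (up C (map proj₁ L′)) (ascents L′)))))
      (solve 6 (λ z z′ d i x x′ → (z :* z′) :* ((d :* i) :* (x :* x′)) := (d :* (z :* x)) :* (z′ :* (i :* x′))) refl
        (isZero (up C C)) (isZero (clashes L′)) (δ (α Fin.zero) (length C)) (ind (content m (α ∘ Fin.suc) L′))
        (q^ up C (map proj₁ L′)) (q^ ascents L′))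
      where
      C = firstClass L
      L′ = otherClasses L

  Σc-vecs : ∀ m k (vs : Fin k → V) (h : Coloured → Carrier) →
            ΣL (vecs (allFin m) k) (λ κ → h (tabulate (λ i → vs i , toℕ (lookup κ i)))) ≈ Σc m (tabulate vs) h
  Σc-vecs m zero    vs h = +-identityʳ _
  Σc-vecs m (suc k) vs h = trans (ΣL-concatMap _ (vecs (allFin m) k) _)
    (trans (ΣL-cong (vecs (allFin m) k) (All.universal (λ κ → ΣL-map (_∷ᵥ κ) (allFin m) _) _))
      (Σc-vecs m k (vs ∘ Fin.suc) (λ L → ΣL (allFin m) (λ c → h ((vs Fin.zero , toℕ c) ∷ L)))))

private
  allB-true : ∀ {X : Set} p (xs : List X) → (∀ x → p x ≡ true) → allB p xs ≡ true
  allB-true p []       e = ≡.refl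
  allB-true p (x ∷ xs) e rewrite e x = allB-true p xs e

  allB-holds : ∀ {X : Set} p (xs : List X) → allB p xs ≡ true → ∀ {x} → x ∈ xs → p x ≡ true
  allB-holds p (x ∷ xs) e x∈ with p x in px
  allB-holds p (x ∷ xs) e (here ≡.refl) | true = px
  allB-holds p (x ∷ xs) e (there x∈)    | true = allB-holds p xs e x∈

  Σℕ-vanishes : ∀ {X : Set} f (xs : List X) → Σℕ xs f ≡ 0 → ∀ {x} → x ∈ xs → f x ≡ 0
  Σℕ-vanishes f (x ∷ xs) e (here ≡.refl) = ℕₚ.m+n≡0⇒m≡0 (f x) e
  Σℕ-vanishes f (x ∷ xs) e (there x∈)    = Σℕ-vanishes f xs (ℕₚ.m+n≡0⇒n≡0 (f x) e) x∈

  ≡ᵇ-sym : ∀ a b → (a ≡ᵇ b) ≡ (b ≡ᵇ a)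
  ≡ᵇ-sym zero    zero    = ≡.refl
  ≡ᵇ-sym zero    (suc b) = ≡.refl
  ≡ᵇ-sym (suc a) zero    = ≡.refl
  ≡ᵇ-sym (suc a) (suc b) = ≡ᵇ-sym a b

  bit-zero : ∀ b → bit b ≡ 0 → b ≡ false
  bit-zero false _ = ≡.refl

-- Identification with the chromatic function of the Dyck path

module ChromaticCoefficients (𝒲 : Weights) {n : ℕ} {d : ℕ → ℕ} (dyck : IsDyck n d) (bounce : Bounce3 n d) where
  open Polynomials 𝒲
  open Splittings 𝒲
  open DyckOrder dyck bounce using (order)
  open Chromatic 𝒲 order
  open Colourings 𝒲 order

  allFin-sorted : Sorted (allFin n)
  allFin-sorted = go n id (λ i<j → i<j)
    where
    go : ∀ m (f : Fin m → Fin n) → (∀ {i j} → toℕ i ℕ.< toℕ j → toℕ (f i) ℕ.< toℕ (f j)) → Sorted (tabulate f)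
    go zero    f mono = []
    go (suc m) f mono = Allₚ.tabulate⁺ (λ i → mono (s≤s z≤n)) ∷ go m (f ∘ Fin.suc) (λ i<j → mono (s≤s i<j))

  coloured : (Fin n → Fin n) → Coloured
  coloured κ = tabulate (λ v → v , toℕ (κ v))

  pairs-coloured : ∀ κ p → pairs (coloured κ) p ≡ Σℕ (allFin n) (λ u → Σℕ (allFin n) (λ v → bit (p u (toℕ (κ u)) v (toℕ (κ v)))))
  pairs-coloured κ p = ≡.trans (Σℕ-tabulate n (λ v → v , toℕ (κ v)) _) (Σℕ-cong (allFin n) λ u → Σℕ-tabulate n (λ v → v , toℕ (κ v)) _)

  asc-ascents : ∀ κ → asc n d κ ≡ ascents (coloured κ)
  asc-ascents κ = ≡.trans (go (allFin n)) (≡.sym (pairs-coloured κ _))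
    where
    go : ∀ us → foldr ℕ._+_ 0 (map (λ u → count (λ v →
           (toℕ u <ᵇ toℕ v) ∧ (edge n d u v ∧ (toℕ (κ u) <ᵇ toℕ (κ v)))) (allFin n)) us)
         ≡ Σℕ us (λ u → Σℕ (allFin n) (λ v → bit (adjacent d u v ∧ (toℕ (κ u) <ᵇ toℕ (κ v)))))
    go []       = ≡.refl
    go (u ∷ us) = cong₂ ℕ._+_ (≡.trans (count-Σℕ _ (allFin n)) (Σℕ-cong (allFin n) λ v →
      cong bit (≡.sym (∧-assoc (toℕ u <ᵇ toℕ v) (edge n d u v) _)))) (go us)

  hasContent-content : ∀ κ α → hasContent n κ α ≡ content n α (coloured κ)
  hasContent-content κ α = allB-cong (allFin n) λ j → cong (_≡ᵇ α j)
    (≡.trans (count-Σℕ _ (allFin n)) (≡.sym (Σℕ-tabulate n (λ v → v , toℕ (κ v)) _)))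

  edge-sym : ∀ (u v : Fin n) → edge n d u v ≡ edge n d v u
  edge-sym u v = cong₂ _∧_ (cong not (≡ᵇ-sym (lab u) (lab v))) (∧-comm (not (prec n d (lab u) (lab v))) _)

  -- `clashes` looks at pairs u < v only, properness at all ordered pairs; `edge-sym` covers the
  -- reversed ones.
  clash-free⇒proper : ∀ κ → clashes (coloured κ) ≡ 0 → proper n d κ ≡ true
  clash-free⇒proper κ e = allB-true _ (allFin n) λ u → allB-true _ (allFin n) λ v → go u v
    where
    free : ∀ u v → adjacent d u v ∧ (toℕ (κ u) ≡ᵇ toℕ (κ v)) ≡ false
    free u v = bit-zero _ (Σℕ-vanishes _ (allFin n) (Σℕ-vanishes _ (allFin n)
      (≡.trans (≡.sym (pairs-coloured κ _)) e) (∈-allFin u)) (∈-allFin v))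
    go : ∀ u v → not (edge n d u v) ∨ not (toℕ (κ u) ≡ᵇ toℕ (κ v)) ≡ true
    go u v with edge n d u v in uv | toℕ (κ u) ≡ᵇ toℕ (κ v) in same
    ... | false | _     = ≡.refl
    ... | true  | false = ≡.refl
    ... | true  | true with ℕₚ.<-cmp (toℕ u) (toℕ v)
    ...   | tri< u<v _ _ with () ← ≡.trans (≡.sym (free u v))
                (cong₂ _∧_ (cong₂ _∧_ (Equivalence.to T-≡ (ℕₚ.<⇒<ᵇ u<v)) uv) same)
    ...   | tri> _ _ v<u with () ← ≡.trans (≡.sym (free v u))
                (cong₂ _∧_ (cong₂ _∧_ (Equivalence.to T-≡ (ℕₚ.<⇒<ᵇ v<u)) (≡.trans (edge-sym v u) uv))
                  (≡.trans (≡ᵇ-sym (toℕ (κ v)) (toℕ (κ u))) same))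
    ...   | tri≈ _ u≡v _ with () ← ≡.trans (≡.sym uv) (cong (λ b → not b ∧ (not (prec n d (lab u) (lab v)) ∧ not (prec n d (lab v) (lab u)))) (Equivalence.to T-≡ (ℕₚ.≡⇒≡ᵇ (lab u) (lab v) (cong suc u≡v))))

  proper⇒clash-free : ∀ κ → proper n d κ ≡ true → clashes (coloured κ) ≡ 0
  proper⇒clash-free κ e = ≡.trans (pairs-coloured κ _) (≡.trans (Σℕ-cong (allFin n) λ u →
    ≡.trans (Σℕ-cong (allFin n) λ v → cong bit (free u v (allB-holds _ (allFin n) (allB-holds _ (allFin n) e (∈-allFin u)) (∈-allFin v)))) (Σℕ-0 (allFin n)))
    (Σℕ-0 (allFin n)))
    where
    free : ∀ u v → not (edge n d u v) ∨ not (toℕ (κ u) ≡ᵇ toℕ (κ v)) ≡ true → adjacent d u v ∧ (toℕ (κ u) ≡ᵇ toℕ (κ v)) ≡ false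
    free u v ok with edge n d u v | toℕ (κ u) ≡ᵇ toℕ (κ v)
    ... | false | _     = cong (_∧ _) (∧-zeroʳ (toℕ u <ᵇ toℕ v))
    ... | true  | false = ∧-zeroʳ _

  ind-proper : ∀ κ → ind (proper n d κ) ≈ isZero (clashes (coloured κ))
  ind-proper κ with proper n d κ in e
  ... | true  = ≡⇒≈ (cong isZero (≡.sym (proper⇒clash-free κ e)))
  ... | false with clashes (coloured κ) in f
  ...   | suc _ = refl
  ...   | zero with () ← ≡.trans (≡.sym e) (clash-free⇒proper κ f)

  X-coefficient : ∀ (α : Fin n → ℕ) →
    ΣL (colorings n) (λ κ → ind (proper n d κ) * (ind (hasContent n κ α) * q^ asc n d κ)) ≈ X (allFin n) (tabulate α)
  X-coefficient α = begin
    ΣL (colorings n) (λ κ → ind (proper n d κ) * (ind (hasContent n κ α) * q^ asc n d κ))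
      ≈⟨ ΣL-cong (colorings n) (All.universal (λ κ → *-cong (ind-proper κ)
           (*-cong (≡⇒≈ (cong ind (hasContent-content κ α))) (≡⇒≈ (cong q^_ (asc-ascents κ))))) _) ⟩
    ΣL (colorings n) (λ κ → colouringWeight n α (coloured κ))
      ≈⟨ ΣL-map lookup (vecs (allFin n) n) _ ⟩
    ΣL (vecs (allFin n) n) (λ κ → colouringWeight n α (coloured (lookup κ)))
      ≈⟨ Σc-vecs n n id (colouringWeight n α) ⟩
    Σc n (allFin n) (colouringWeight n α)
      ≈⟨ X-colourings n (allFin n) α allFin-sorted ⟩
    X (allFin n) (tabulate α) ∎

-- Integer power series as coefficient ring

module PowerSeries where
  open import Data.Integer using (+_; _+_; _*_; -_; +≤+)
  open import Data.Integer.Solver using (module +-*-Solver)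
  open import Relation.Binary.PropositionalEquality
  open +-*-Solver using (solve; _:=_; _:+_; _:*_; con)

  -- The theorem compares q-coefficients one power at a time, so coefficient sequences with the
  -- Cauchy product can serve as the ring.
  Series : Set
  Series = ℕ → ℤ

  infixl 7 _⊛_
  _⊛_ : Series → Series → Series
  (f ⊛ g) zero    = f 0 * g 0
  (f ⊛ g) (suc n) = f 0 * g (suc n) + ((f ∘ suc) ⊛ g) n

  constant : ℤ → Series
  constant z zero    = z
  constant z (suc n) = + 0

  ⊛-cong : ∀ {f f′ g g′} → f ≗ f′ → g ≗ g′ → f ⊛ g ≗ f′ ⊛ g′
  ⊛-cong p r zero    = cong₂ _*_ (p 0) (r 0)
  ⊛-cong p r (suc n) = cong₂ _+_ (cong₂ _*_ (p 0) (r (suc n))) (⊛-cong (p ∘ suc) r n)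

  ⊛-distribʳ : ∀ g f f′ → (λ k → f k + f′ k) ⊛ g ≗ (λ k → (f ⊛ g) k + (f′ ⊛ g) k)
  ⊛-distribʳ g f f′ zero    = ℤₚ.*-distribʳ-+ (g 0) (f 0) (f′ 0)
  ⊛-distribʳ g f f′ (suc n) = trans (cong (_+_ ((f 0 + f′ 0) * g (suc n))) (⊛-distribʳ g (f ∘ suc) (f′ ∘ suc) n))
    (solve 5 (λ a b c x y → (a :+ b) :* c :+ (x :+ y) := (a :* c :+ x) :+ (b :* c :+ y)) refl (f 0) (f′ 0) (g (suc n)) _ _)

  ⊛-scale : ∀ c f g → (λ k → c * f k) ⊛ g ≗ (λ k → c * (f ⊛ g) k)
  ⊛-scale c f g zero    = ℤₚ.*-assoc c (f 0) (g 0)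
  ⊛-scale c f g (suc n) = trans (cong (_+_ ((c * f 0) * g (suc n))) (⊛-scale c (f ∘ suc) g n))
    (solve 4 (λ c a b x → (c :* a) :* b :+ c :* x := c :* (a :* b :+ x)) refl c (f 0) (g (suc n)) _)

  -- The defining recursion peels the left factor; this mirror image peels the right one and gives
  -- commutativity.
  ⊛-sucʳ : ∀ f g n → (f ⊛ g) (suc n) ≡ (f ⊛ (g ∘ suc)) n + f (suc n) * g 0
  ⊛-sucʳ f g zero    = refl
  ⊛-sucʳ f g (suc n) = trans (cong (_+_ (f 0 * g (suc (suc n)))) (⊛-sucʳ (f ∘ suc) g n)) (sym (ℤₚ.+-assoc (f 0 * g (suc (suc n))) _ _))

  ⊛-comm : ∀ f g → f ⊛ g ≗ g ⊛ f
  ⊛-comm f g zero    = ℤₚ.*-comm (f 0) (g 0)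
  ⊛-comm f g (suc n) = trans (cong (_+_ (f 0 * g (suc n))) (⊛-comm (f ∘ suc) g n))
    (trans (solve 3 (λ a b x → a :* b :+ x := x :+ b :* a) refl (f 0) (g (suc n)) _) (sym (⊛-sucʳ g f n)))

  ⊛-assoc : ∀ f g h → (f ⊛ g) ⊛ h ≗ f ⊛ (g ⊛ h)
  ⊛-assoc f g h zero    = ℤₚ.*-assoc (f 0) (g 0) (h 0)
  ⊛-assoc f g h (suc n) = trans
    (cong (_+_ ((f 0 * g 0) * h (suc n))) (trans (⊛-distribʳ h (λ k → f 0 * g (suc k)) ((f ∘ suc) ⊛ g) n)
      (cong₂ _+_ (⊛-scale (f 0) (g ∘ suc) h n) (⊛-assoc (f ∘ suc) g h n))))
    (solve 5 (λ a b c x y → (a :* b) :* c :+ (a :* x :+ y) := a :* (b :* c :+ x) :+ y) refl (f 0) (g 0) (h (suc n)) _ _)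

  ⊛-zeroˡ : ∀ g → (λ _ → + 0) ⊛ g ≗ (λ _ → + 0)
  ⊛-zeroˡ g zero    = refl
  ⊛-zeroˡ g (suc n) = trans (ℤₚ.+-identityˡ _) (⊛-zeroˡ g n)

  ⊛-constant : ∀ c g n → (constant c ⊛ g) n ≡ c * g n
  ⊛-constant c g zero    = refl
  ⊛-constant c g (suc n) = trans (cong (_+_ (c * g (suc n))) (⊛-zeroˡ g n)) (ℤₚ.+-identityʳ _)

  ⊛-identityˡ : ∀ g → constant (+ 1) ⊛ g ≗ g
  ⊛-identityˡ g n = trans (⊛-constant (+ 1) g n) (ℤₚ.*-identityˡ (g n))

  seriesRing : CommutativeRing 0ℓ 0ℓ
  seriesRing = record
    { Carrier = Series
    ; _≈_ = _≗_
    ; _+_ = λ f g k → f k + g k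
    ; _*_ = _⊛_
    ; -_  = λ f k → - f k
    ; 0#  = λ _ → + 0
    ; 1#  = constant (+ 1)
    ; isCommutativeRing = record
      { isRing = record
        { +-isAbelianGroup = record
          { isGroup = record
            { isMonoid = record
              { isSemigroup = record
                { isMagma = record
                  { isEquivalence = record { refl = λ _ → refl ; sym = λ e k → sym (e k) ; trans = λ e e′ k → trans (e k) (e′ k) }
                  ; ∙-cong = λ e e′ k → cong₂ _+_ (e k) (e′ k) }
                ; assoc = λ f g h k → ℤₚ.+-assoc (f k) (g k) (h k) }
              ; identity = (λ f k → ℤₚ.+-identityˡ (f k)) , (λ f k → ℤₚ.+-identityʳ (f k)) }
            ; inverse = (λ f k → ℤₚ.+-inverseˡ (f k)) , (λ f k → ℤₚ.+-inverseʳ (f k))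
            ; ⁻¹-cong = λ e k → cong -_ (e k) }
          ; comm = λ f g k → ℤₚ.+-comm (f k) (g k) }
        ; *-cong = ⊛-cong
        ; *-assoc = ⊛-assoc
        ; *-identity = ⊛-identityˡ , (λ g k → trans (⊛-comm g (constant (+ 1)) k) (⊛-identityˡ g k))
        ; distrib = (λ g f f′ k → trans (⊛-comm g _ k) (trans (⊛-distribʳ g f f′ k) (cong₂ _+_ (⊛-comm f g k) (⊛-comm f′ g k)))) , ⊛-distribʳ }
      ; *-comm = ⊛-comm } }

  indeterminate : Series
  indeterminate 1 = + 1
  indeterminate _ = + 0

  indeterminate-suc : ∀ f k → (indeterminate ⊛ f) (suc k) ≡ f k
  indeterminate-suc f k = trans (ℤₚ.+-identityˡ _) (trans (⊛-cong shifted (λ _ → refl) k) (⊛-identityˡ f k))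
    where
    shifted : indeterminate ∘ suc ≗ constant (+ 1)
    shifted zero    = refl
    shifted (suc n) = refl

  NonNegative : Series → Set
  NonNegative f = ∀ k → + 0 ≤ℤ f k

  *-nonNegative : ∀ {a b} → + 0 ≤ℤ a → + 0 ≤ℤ b → + 0 ≤ℤ a * b
  *-nonNegative {+ m} {+ n} _ _ = subst (_≤ℤ_ (+ 0)) (ℤₚ.pos-* m n) (+≤+ z≤n)

  ⊛-nonNegative : ∀ {f g} → NonNegative f → NonNegative g → NonNegative (f ⊛ g)
  ⊛-nonNegative p r zero    = *-nonNegative (p 0) (r 0)
  ⊛-nonNegative p r (suc n) = ℤₚ.+-mono-≤ (*-nonNegative (p 0) (r (suc n))) (⊛-nonNegative (p ∘ suc) r n)

  constant-nonNegative : ∀ n → NonNegative (constant (+ n))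
  constant-nonNegative n zero    = +≤+ z≤n
  constant-nonNegative n (suc k) = +≤+ z≤n

  seriesWeights : Weights
  seriesWeights = record
    { commRing = seriesRing
    ; q        = indeterminate
    ; fromℤ    = record
      { ⟦_⟧    = constant
      ; +-homo = λ { a b zero → refl ; a b (suc k) → refl }
      ; *-homo = λ { a b zero → refl ; a b (suc k) → sym (trans (⊛-constant a (constant b) (suc k)) (ℤₚ.*-zeroʳ a)) }
      ; -‿homo = λ { a zero → refl ; a (suc k) → refl }
      ; 0-homo = λ { zero → refl ; (suc k) → refl }
      ; 1-homo = λ _ → refl }
    ; Pos      = NonNegative
    ; Pos-resp = λ e p k → subst (_≤ℤ_ (+ 0)) (e k) (p k)
    ; Pos-0    = λ _ → +≤+ z≤n
    ; Pos-1    = constant-nonNegative 1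
    ; Pos-q    = λ { zero → +≤+ z≤n ; 1 → +≤+ z≤n ; (suc (suc k)) → +≤+ z≤n }
    ; Pos-+    = λ p r k → ℤₚ.+-mono-≤ (p k) (r k)
    ; Pos-*    = ⊛-nonNegative }

open PowerSeries

open import Data.Integer using (+_; _+_; _*_)
open import Relation.Binary.PropositionalEquality

-- Sorting the target partition

module TargetPartition where

  insertDesc-≥ : ∀ {x y} ys → y ≤ x → insertDesc x (y ∷ ys) ≡ x ∷ y ∷ ys
  insertDesc-≥ {x} {y} ys y≤x rewrite Equivalence.to T-≡ (ℕₚ.≤⇒≤ᵇ y≤x) = refl

  insertDesc-< : ∀ {x y} ys → x ℕ.< y → insertDesc x (y ∷ ys) ≡ y ∷ insertDesc x ys
  insertDesc-< {x} {y} ys x<y with y ≤ᵇ x in e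
  ... | false = refl
  ... | true  = ⊥-elim (ℕₚ.<⇒≱ x<y (ℕₚ.≤ᵇ⇒≤ y x (Equivalence.from T-≡ e)))

  pad₃-dropZeros : ∀ {i j k} → k ≤ j → j ≤ i → pad₃ (dropZeros (i ∷ j ∷ k ∷ [])) ≡ i ∷ j ∷ k ∷ []
  pad₃-dropZeros {zero}  {zero}  {zero}  _ _ = refl
  pad₃-dropZeros {suc i} {zero}  {zero}  _ _ = refl
  pad₃-dropZeros {suc i} {suc j} {zero}  _ _ = refl
  pad₃-dropZeros {suc i} {suc j} {suc k} _ _ = refl

  dropZeros-partition : ∀ {i j k m} → k ≤ j → j ≤ i → i ≤ m → Partition m (dropZeros (i ∷ j ∷ k ∷ []))
  dropZeros-partition {zero}  {zero}  {zero}  _   _   _   = []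
  dropZeros-partition {suc i} {zero}  {zero}  _   _   i≤m = add (s≤s z≤n) i≤m []
  dropZeros-partition {suc i} {suc j} {zero}  _   j≤i i≤m = add (s≤s z≤n) i≤m (add (s≤s z≤n) j≤i [])
  dropZeros-partition {suc i} {suc j} {suc k} k≤j j≤i i≤m =
    add (s≤s z≤n) i≤m (add (s≤s z≤n) j≤i (add (s≤s z≤n) k≤j []))

  dropZeros-short : ∀ i j k → Short (dropZeros (i ∷ j ∷ k ∷ []))
  dropZeros-short zero    zero    zero    = z≤n
  dropZeros-short zero    zero    (suc k) = s≤s z≤n
  dropZeros-short zero    (suc j) zero    = s≤s z≤n
  dropZeros-short zero    (suc j) (suc k) = s≤s (s≤s z≤n)
  dropZeros-short (suc i) zero    zero    = s≤s z≤n
  dropZeros-short (suc i) zero    (suc k) = s≤s (s≤s z≤n)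
  dropZeros-short (suc i) (suc j) zero    = s≤s (s≤s z≤n)
  dropZeros-short (suc i) (suc j) (suc k) = s≤s (s≤s (s≤s z≤n))

  sum-dropZeros : ∀ μ → sum (dropZeros μ) ≡ sum μ
  sum-dropZeros []          = refl
  sum-dropZeros (zero ∷ μ)  = sum-dropZeros μ
  sum-dropZeros (suc x ∷ μ) = cong (suc x ℕ.+_) (sum-dropZeros μ)

  arrange : ℕ → ℕ → List ℕ
  arrange x l = sortDesc (dropZeros (x ∷ suc l ∷ l ∷ []))

  arrange-below : ∀ l → arrange l (suc l) ≡ dropZeros (suc (suc l) ∷ suc l ∷ l ∷ [])
  arrange-below zero    = refl
  arrange-below (suc m) = trans (cong (insertDesc (suc m)) (insertDesc-≥ {suc (suc (suc m))} [] (n≤1+n _)))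
    (trans (insertDesc-< {suc m} (suc (suc m) ∷ []) (ℕₚ.m<n⇒m<1+n (ℕₚ.n<1+n _)))
      (cong (suc (suc (suc m)) ∷_) (insertDesc-< {suc m} [] (ℕₚ.n<1+n _))))

  arrange-equal : ∀ l → arrange l l ≡ dropZeros (suc l ∷ l ∷ l ∷ [])
  arrange-equal zero    = refl
  arrange-equal (suc m) = trans (cong (insertDesc (suc m)) (insertDesc-≥ {suc (suc m)} [] (n≤1+n _)))
    (trans (insertDesc-< {suc m} (suc m ∷ []) (ℕₚ.n<1+n _)) (cong (suc (suc m) ∷_) (insertDesc-≥ {suc m} [] ≤-refl)))

  arrange-above : ∀ x l → suc l ≤ x → arrange x l ≡ dropZeros (x ∷ suc l ∷ l ∷ [])
  arrange-above (suc x) zero    l<x = insertDesc-≥ [] l<x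
  arrange-above (suc x) (suc m) l<x = trans (cong (insertDesc (suc x)) (insertDesc-≥ {suc (suc m)} [] (n≤1+n _)))
    (insertDesc-≥ (suc m ∷ []) l<x)

  -- For n = 3l + N the part n - 2l - 1 is l + N - 1, with truncated subtraction, so its place among
  -- l + 1 and l is decided by N.
  targetPart-arrange : ∀ l N → targetPart (l ℕ.* 3 ℕ.+ N) l ≡ arrange ((l ℕ.+ N) ∸ 1) l
  targetPart-arrange l N = cong (λ x → arrange (x ∸ 1) l)
    (trans (cong (_∸ (l ℕ.+ l)) (ℕ-Solver.solve 2 (λ l N → l :* con 3 :+ N := (l :+ l) :+ (l :+ N)) refl l N)) (m+n∸m≡n (l ℕ.+ l) (l ℕ.+ N)))
    where open ℕ-Solver using (_:*_; _:+_; _:=_; con)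

open TargetPartition

-- The coefficient at the target partition

module Target {n : ℕ} {d : ℕ → ℕ} (dyck : IsDyck n d) (bounce : Bounce3 n d) where
  open Weights seriesWeights using (Carrier; Pos; Pos-resp)
  open DyckOrder dyck bounce using (order)
  open Chromatic seriesWeights order
  open ChromaticCoefficients seriesWeights dyck bounce using (allFin-sorted; X-coefficient)
  open Evaluation seriesWeights
  open Hooks seriesWeights order using (M-triples-Pos)
  open Expansion seriesWeights order

  private
    length-allFin : length (allFin n) ≡ n
    length-allFin = length-tabulate {n = n} id

  coeff : List ℕ → Carrier
  coeff = coefficient (allFin n) allFin-sorted

  coeff-Pos : ∀ {L} i j k → k ≤ j → j ≤ i → i ℕ.+ (j ℕ.+ k) ≡ n → Selects L (i ∷ j ∷ k ∷ []) →
              Pos (L (X (allFin n))) → Pos (coeff (dropZeros (i ∷ j ∷ k ∷ [])))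
  coeff-Pos {L} i j k k≤j j≤i e S p = Pos-resp
    (coefficient-functional (allFin n) allFin-sorted (dropZeros (i ∷ j ∷ k ∷ []))
      (dropZeros-partition k≤j j≤i (subst (i ℕ.≤_) (trans e (sym length-allFin)) (m≤m+n i (j ℕ.+ k))))
      (dropZeros-short i j k)
      (trans (sum-dropZeros (i ∷ j ∷ k ∷ [])) (trans (cong (λ m → i ℕ.+ (j ℕ.+ m)) (ℕₚ.+-identityʳ k)) (trans e (sym length-allFin))))
      (subst (Selects L) (sym (pad₃-dropZeros k≤j j≤i)) S))
    p

  -- Taking one unit from each part l times leaves (1), (1,1) or (N - 1, 1) for N = 1, N = 2 or N ≥
  -- 3. For N = 0 the sorted partition is (l + 1, l, l - 1), which leaves (2,1) after l - 1 times.
  target-Pos : ∀ l N → n ≡ l ℕ.* 3 ℕ.+ N → 1 ≤ n → Pos (coeff (targetPart n l))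
  target-Pos l N e 1≤n = subst (λ μ → Pos (coeff μ))
    (sym (trans (cong (λ m → targetPart m l) e) (targetPart-arrange l N))) (go l N e)
    where
    open ℕ-Solver using (solve; _:*_; _:+_; _:=_; con)
    go : ∀ l N → n ≡ l ℕ.* 3 ℕ.+ N → Pos (coeff (arrange ((l ℕ.+ N) ∸ 1) l))
    go zero    0 e = ⊥-elim (<⇒≢ 1≤n (sym e))
    go (suc l) 0 e = subst (λ μ → Pos (coeff μ)) (sym (trans (cong (λ x → arrange x (suc l)) (ℕₚ.+-identityʳ l)) (arrange-below l)))
      (coeff-Pos (suc (suc l)) (suc l) l (n≤1+n l) (n≤1+n (suc l))
        (trans (solve 1 (λ l → (con 2 :+ l) :+ ((con 1 :+ l) :+ l) := (con 1 :+ l) :* con 3 :+ con 0) refl l) (sym e))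
        (subst (Selects _) (cong₂ (λ i j → i ∷ j) (ℕₚ.+-comm l 2) (cong₂ (λ i j → i ∷ j ∷ []) (ℕₚ.+-comm l 1) (ℕₚ.+-identityʳ l)))
          (selects-e₃^ l (selects-M 0)))
        (M-triples-Pos l 0 (allFin n) allFin-sorted (trans length-allFin (trans e
          (solve 1 (λ l → (con 1 :+ l) :* con 3 :+ con 0 := l :* con 3 :+ con 3) refl l)))))
    go l 1 e = subst (λ μ → Pos (coeff μ)) (sym (trans (cong (λ x → arrange (x ∸ 1) l) (ℕₚ.+-comm l 1)) (arrange-equal l)))
      (coeff-Pos (suc l) l l ≤-refl (n≤1+n l)
        (trans (solve 1 (λ l → (con 1 :+ l) :+ (l :+ l) := l :* con 3 :+ con 1) refl l) (sym e))
        (subst (Selects _) (cong₂ (λ i j → i ∷ j ∷ j ∷ []) (ℕₚ.+-comm l 1) (ℕₚ.+-identityʳ l)) (selects-e₃^ l selects-e₁))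
        (X-Pos (allFin n) (replicate l 3 ++ 1 ∷ [])))
    go l 2 e = subst (λ μ → Pos (coeff μ)) (sym (trans (cong (λ x → arrange (x ∸ 1) l) (ℕₚ.+-comm l 2)) (arrange-above (suc l) l ≤-refl)))
      (coeff-Pos (suc l) (suc l) l (n≤1+n l) ≤-refl
        (trans (solve 1 (λ l → (con 1 :+ l) :+ ((con 1 :+ l) :+ l) := l :* con 3 :+ con 2) refl l) (sym e))
        (subst (Selects _) (cong₂ (λ i j → i ∷ i ∷ j ∷ []) (ℕₚ.+-comm l 1) (ℕₚ.+-identityʳ l)) (selects-e₃^ l selects-e₂))
        (X-Pos (allFin n) (replicate l 3 ++ 2 ∷ [])))
    go l (suc (suc (suc N))) e = subst (λ μ → Pos (coeff μ))
      (sym (trans (cong (λ x → arrange (x ∸ 1) l) (+-suc l (suc (suc N)))) (arrange-above (l ℕ.+ suc (suc N)) l l<x)))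
      (coeff-Pos (l ℕ.+ suc (suc N)) (suc l) l (n≤1+n l) l<x
        (trans (solve 2 (λ l N → (l :+ (con 2 :+ N)) :+ ((con 1 :+ l) :+ l) := l :* con 3 :+ (con 3 :+ N)) refl l N) (sym e))
        (subst (Selects _) (cong₂ (λ i j → l ℕ.+ suc (suc N) ∷ i ∷ j ∷ []) (ℕₚ.+-comm l 1) (ℕₚ.+-identityʳ l)) (selects-e₃^ l (selects-M N)))
        (M-triples-Pos l N (allFin n) allFin-sorted (trans length-allFin e)))
      where
      l<x : suc l ≤ l ℕ.+ suc (suc N)
      l<x = subst (suc l ℕ.≤_) (sym (+-suc l (suc N))) (s≤s (m≤m+n l (suc N)))

  open Polynomials seriesWeights using (ind; ι; q^_)
  open Splittings seriesWeights using (ΣL)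

  ΣL-at : ∀ {Y : Set} (xs : List Y) (f : Y → Carrier) k → ΣL xs f k ≡ sumℤ (map (λ x → f x k) xs)
  ΣL-at []       f k = refl
  ΣL-at (x ∷ xs) f k = cong (_+_ (f x k)) (ΣL-at xs f k)

  ι-at : ∀ f m k → (f ⊛ ι m) k ≡ f k * + m
  ι-at f zero    k = trans (⊛-comm f (λ _ → + 0) k) (trans (⊛-zeroˡ f k) (sym (ℤₚ.*-zeroʳ (f k))))
  ι-at f (suc m) k = trans (Weights.distribˡ seriesWeights f (constant (+ 1)) (ι m) k)
    (trans (cong₂ _+_ (Weights.*-identityʳ seriesWeights f k) (ι-at f m k)) (sym (ℤₚ.*-suc (f k) (+ m))))

  q^-at : ∀ a k → (q^ a) k ≡ + bit (a ≡ᵇ k)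
  q^-at zero    zero    = refl
  q^-at zero    (suc k) = refl
  q^-at (suc a) zero    = refl
  q^-at (suc a) (suc k) = trans (indeterminate-suc (q^ a) k) (q^-at a k)

  term-at : ∀ a b m k → (ind a ⊛ (ind b ⊛ q^ m)) k ≡ + bit (a ∧ (b ∧ (m ≡ᵇ k)))
  term-at true  true  m k = trans (⊛-identityˡ _ k) (trans (⊛-identityˡ _ k) (q^-at m k))
  term-at true  false m k = trans (⊛-identityˡ _ k) (⊛-zeroˡ _ k)
  term-at false b     m k = ⊛-zeroˡ _ k

  count-at : ∀ {Y : Set} (xs : List Y) p (f : Y → Carrier) k → (∀ x → f x k ≡ + bit (p x)) → ΣL xs f k ≡ + count p xs
  count-at []       p f k e = refl
  count-at (x ∷ xs) p f k e with p x | e x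
  ... | true  | e′ = cong₂ _+_ e′ (count-at xs p f k e)
  ... | false | e′ = trans (cong₂ _+_ e′ (count-at xs p f k e)) (ℤₚ.+-identityˡ _)

  expands : ExpandsAs n d coeff
  expands α k = begin
    + Xcoef n d α k
      ≡⟨ sym (count-at (colorings n) _ _ k (λ κ → term-at (proper n d κ) (hasContent n κ α) (asc n d κ) k)) ⟩
    ΣL (colorings n) (λ κ → ind (proper n d κ) ⊛ (ind (hasContent n κ α) ⊛ q^ asc n d κ)) k
      ≡⟨ X-coefficient α k ⟩
    X (allFin n) (tabulate α) k
      ≡⟨ e-expansion (allFin n) allFin-sorted (tabulate α) k ⟩
    ΣL (partitions (length (allFin n))) (λ μ → coeff μ ⊛ ι (matrices μ (tabulate α))) k
      ≡⟨ cong (λ m → ΣL (partitions m) (λ μ → coeff μ ⊛ ι (matrices μ (tabulate α))) k) length-allFin ⟩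
    ΣL (partitions n) (λ μ → coeff μ ⊛ ι (matrices μ (tabulate α))) k
      ≡⟨ ΣL-at (partitions n) _ k ⟩
    sumℤ (map (λ μ → (coeff μ ⊛ ι (matrices μ (tabulate α))) k) (partitions n))
      ≡⟨ cong sumℤ (map-cong (λ μ → trans (ι-at (coeff μ) _ k) (cong (λ m → coeff μ k * + m) (sym (ecoef-matrices n μ α)))) (partitions n)) ⟩
    sumℤ (map (λ μ → coeff μ k * + ecoef n μ α) (partitions n)) ∎
    where open ≡-Reasoning

-- The block sizes n - b, b - a and a add up to n.
triples-fit : ∀ {n a b} l → a ℕ.< n → b ℕ.< n → l ≤ n ∸ b → l ≤ b ∸ a → l ≤ a → l ℕ.* 3 ≤ n
triples-fit zero    _ _ _ _ _ = z≤n
triples-fit {n} {a} {b} l@(suc _) a<n b<n l≤c l≤m l≤a = subst₂ ℕ._≤_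
  (solve 1 (λ l → (l :+ l) :+ l := l :* con 3) refl l)
  (ℕₚ.m∸n+n≡m (ℕₚ.<⇒≤ b<n))
  (subst (ℕ._≤ (n ∸ b) ℕ.+ b) (sym (ℕₚ.+-assoc l l l))
    (ℕₚ.+-mono-≤ l≤c (subst (l ℕ.+ l ℕ.≤_) (ℕₚ.m∸n+n≡m a≤b) (ℕₚ.+-mono-≤ l≤m l≤a))))
  where
  open ℕ-Solver using (solve; _:*_; _:+_; _:=_; con)
  a≤b : a ≤ b
  -- The truncated difference b - a is at least l > 0, so it is a genuine one.
  a≤b = ℕₚ.<⇒≤ (ℕₚ.m∸n≢0⇒n<m λ e → ℕₚ.<⇒≱ (s≤s z≤n) (subst (l ℕ.≤_) e l≤m))

theorem3p6 : (n : ℕ) (d : ℕ → ℕ) → IsDyck n d → Bounce3 n d →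
  (l : ℕ) → l ≤ n ∸ bm1 n d → l ≤ bm1 n d ∸ bm0 n d → l ≤ bm0 n d →
  Σ (List ℕ → ℕ → ℤ) (λ c → ExpandsAs n d c × (∀ k → + 0 ≤ℤ c (targetPart n l) k))
theorem3p6 n d dyck bounce@(m₀<n , m₁<n , _) l l≤c l≤b l≤a =
  coeff , expands , target-Pos l (n ∸ l ℕ.* 3) (sym (ℕₚ.m+[n∸m]≡n (triples-fit l m₀<n m₁<n l≤c l≤b l≤a)))
                               (≤-trans (s≤s z≤n) m₀<n)
  where open Target dyck bounce
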